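{- Suppose $k$ is a positive integer and let $\alpha \in \mathbb{F}_2^k$. As $n \to \infty$ the following holds: \[ f_{\alpha}(n) = \begin{cases} 2^{\lfloor n/2 \rfloor} & \text{if } \operatorname{lv}(\alpha) = 0 \text{ and } \alpha = (0, \dots, 0),\\ 2^{\lfloor (n-1)/2 \rfloor} & \text{if } \operatorname{lv}(\alpha) = 0 \text{ and } \alpha = (1, \dots, 1),\\ \bigl(1 + o(1)\bigr) \cdot (t!)^{1/t} \cdot n^{1/t} & \text{if } \operatorname{lv}(\alpha) = t > 0 \text{ and } \operatorname{grd}(\alpha) = 1,\\ \bigl(1 + o(1)\bigr) \cdot (t!/2)^{1/t} \cdot n^{1/t} & \text{if } \operatorname{lv}(\alpha) = t > 0 \text{ and } \operatorname{grd}(\alpha) = 2. \end{cases} \]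
   Context: Write $[n] = \{1, \dots, n\}$ and let $2^{[n]}$ be its power set. For $\alpha = (\alpha_1, \dots, \alpha_k) \in \mathbb{F}_2^k$, a set family $\mathcal{F}$ is an $\alpha$-town if, for each $i = 1, \dots, k$, $|F_1 \cap \dots \cap F_i| \equiv \alpha_i \pmod 2$ holds for any distinct $F_1, \dots, F_i \in \mathcal{F}$. Let $f_\alpha(n)$ be the maximum of $|\mathcal{F}|$ over all $\alpha$-towns $\mathcal{F} \subseteq 2^{[n]}$. Canonical vectors: for integers $i \ge 1$, define infinite binary sequences $\gamma^{2i-1}, \gamma^{2i} \in \prod_{j=1}^\infty \mathbb{F}_2$ by, for every $j \ge 1$, \[ (\gamma^{2i-1})_j = \binom{ -i}{j-1} \bmod 2 = \binom{i+j-2}{j-1} \bmod 2, \qquad (\gamma^{2i})_j = \binom{i-1}{j-1} \bmod 2, \] where $\binom{ -a}{b} = \frac{(-a)(-a-1)\cdots(-a-b+1)}{b!}$ for $a \in \mathbb{Z}$, $b \in \mathbb{Z}_{\ge 0}$. For an infinite sequence $\gamma$, write $(\gamma)_{[k]} = (\gamma_1, \dots, \gamma_k) \in \mathbb{F}_2^k$. For every $k \ge 1$ the vectors $(\gamma^1)_{[k]}, \dots, (\gamma^k)_{[k]}$ form a basis of $\mathbb{F}_2^k$, so each $\alpha \in \mathbb{F}_2^k$ has a unique canonical decomposition $\alpha = c_1 (\gamma^1)_{[k]} + \dots + c_k (\gamma^k)_{[k]}$ with $c_1, \dots, c_k \in \mathbb{F}_2$. Level: $\operatorname{lv}(\gamma^i)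 = \lfloor i/2 \rfloor$, and $\operatorname{lv}(\alpha) = \max\{\operatorname{lv}(\gamma^i) : c_i = 1\}$, with the all-zero vector of any length having level $0$. Grade: if $\operatorname{lv}(\alpha) = t > 0$, then $\operatorname{grd}(\alpha) = 2$ if both $\gamma^{2t}$ and $\gamma^{2t+1}$ appear (with coefficient $1$) in the canonical decomposition of $\alpha$, and $\operatorname{grd}(\alpha) = 1$ if exactly one of them appears.
   Formalization: The two level-0 formulas are stated for k ≥ 2 only; for k = 1 they fail, since then only the parity of |F| is constrained and f_α(n) = 2^{n-1} (e.g. n = 3, α = (0): 4 instead of 2). -}

module Defs where

open import Data.Empty using (⊥-elim)
open import Data.Fin.Base as Fin using (Fin; zero; suc; toℕ; fromℕ<)
import Data.Fin.Properties as Fin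
open import Data.Fin.Subset using (Subset; ∣_∣; ⋂)
open import Data.Fin.Subset.Properties using (anySubset?)
open import Data.Bool.Properties using () renaming (_≟_ to _≟ᵇ_)
import Data.Integer.Base as ℤ
open import Data.List.Base as List using (List; []; _∷_; length; filter; allFin)
open import Data.List.Extrema.Nat using (max)
open import Data.List.Membership.DecPropositional using (_∈?_)
open import Data.List.Membership.Propositional using (_∈_)
open import Data.List.Membership.Propositional.Properties using (∈-lookup)
open import Data.List.Relation.Unary.All as All using (All)
open import Data.List.Relation.Unary.AllPairs using ([]; _∷_)
open import Data.List.Relation.Unary.Unique.DecPropositional using (unique?)
open import Data.List.Relation.Unary.Unique.Propositional using (Unique)
open import Data.Nat.Base as ℕ
  using (ℕ; zero; suc; _∸_; _^_; _≤_; _<_; z≤n; s≤s; ⌈_/2⌉; ⌊_/2⌋; parity)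
open import Data.Nat.Combinatorics using (_C_; nCn≡1; nCk+nC[k+1]≡[n+1]C[k+1])
import Data.Nat.Properties as ℕ
open import Data.Parity.Base using (Parity; 0ℙ; 1ℙ; _+_; _*_)
import Data.Parity.Properties as ℙ
open import Data.Product using (Σ-syntax; ∃; ∃!; _×_; _,_; proj₁; proj₂; uncurry)
open import Data.Product.Function.NonDependent.Propositional using (_×-↔_)
open import Data.Rational.Base as ℚ using (ℚ; 0ℚ; 1ℚ)
import Data.Rational.Properties as ℚ
open import Data.Sum.Base using (inj₁; inj₂)
open import Data.Vec.Base
  using (Vec; []; _∷_; lookup; tabulate; zipWith; replicate; toList; fromList; uncons)
import Data.Vec.Properties as Vec
open import Function.Base using (_∘_)
open import Function.Bundles using (_↔_; mk↔ₛ′; Inverse)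
open import Function.Properties.Inverse using (↔-trans; ↔-sym)
open import Relation.Binary.Definitions using (DecidableEquality)
open import Relation.Binary.PropositionalEquality
open import Relation.Nullary.Decidable
  using (Dec; yes; no; map′; ¬?; _×-dec_; _→-dec_; decidable-stable)
open import Relation.Nullary.Negation using (¬_)
open import Relation.Unary using (Decidable)

open import Algebra.Bundles using (CommutativeRing)
open import Algebra.Properties.CommutativeMonoid.Sum ℙ.+-0-commutativeMonoid
  using (sum-syntax; sum-cong-≗; ∑-distrib-+)
open import Algebra.Properties.Semiring.Exp
  (CommutativeRing.semiring ℚ.+-*-commutativeRing) using () renaming (_^_ to _^ℚ_)

private
  variable
    k n : ℕ
    A : Set

𝔽₂ : Set
𝔽₂ = Parity

Vec↔Fin : A ↔ Fin 2 → ∀ n → Vec A n ↔ Fin (2 ^ n)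
Vec↔Fin A↔2 zero = mk↔ₛ′ (λ _ → zero) (λ _ → []) (λ { zero → refl }) (λ { [] → refl })
Vec↔Fin A↔2 (suc n) =
  ↔-trans (mk↔ₛ′ uncons (uncurry _∷_) (λ _ → refl) (λ { (_ ∷ _) → refl }))
 (↔-trans (A↔2 ×-↔ Vec↔Fin A↔2 n) (↔-sym Fin.*↔×))

Subset↔Fin : ∀ n → Subset n ↔ Fin (2 ^ n)
Subset↔Fin = Vec↔Fin (↔-sym Fin.2↔Bool)

𝔽₂^↔Fin : ∀ k → Vec 𝔽₂ k ↔ Fin (2 ^ k)
𝔽₂^↔Fin = Vec↔Fin (mk↔ₛ′ (λ { 0ℙ → zero ; 1ℙ → suc zero }) (λ { zero → 0ℙ ; (suc zero) → 1ℙ })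
  (λ { zero → refl ; (suc zero) → refl }) (λ { 0ℙ → refl ; 1ℙ → refl }))

↔-injective : ∀ {B : Set} (A↔B : A ↔ B) {x y : A} →
              Inverse.to A↔B x ≡ Inverse.to A↔B y → x ≡ y
↔-injective A↔B {x} {y} eq = begin
  x                ≡⟨ strictlyInverseʳ x ⟨
  from (to x)      ≡⟨ cong from eq ⟩
  from (to y)      ≡⟨ strictlyInverseʳ y ⟩
  y                ∎
  where
  open Inverse A↔B
  open ≡-Reasoning

Unique-lookup : {xs : List A} → Unique xs → ∀ {i j} → i Fin.< j →
                List.lookup xs i ≢ List.lookup xs j
Unique-lookup {xs = x ∷ xs} (x∉xs ∷ _) {zero} {suc j} _ = All.lookup x∉xs (∈-lookup j)
Unique-lookup {xs = x ∷ xs} (_ ∷ uniq) {suc i} {suc j} (s≤s i<j) = Unique-lookup uniq i<j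

Unique⇒length≤ : ∀ {m} → A ↔ Fin m → {xs : List A} → Unique xs → length xs ≤ m
Unique⇒length≤ A↔m {xs} uniq = ℕ.≮⇒≥ λ m<l →
  let i , j , i<j , eq = Fin.pigeonhole m<l (Inverse.to A↔m ∘ List.lookup xs)
  in Unique-lookup uniq i<j (↔-injective A↔m eq)

Searchable : Set → Set₁
Searchable A = {P : A → Set} → Decidable P → Dec (∃ P)

Vec-searchable : Searchable A → ∀ n → Searchable (Vec A n)
Vec-searchable any? zero    P? = map′ ([] ,_) (λ { ([] , p) → p }) (P? [])
Vec-searchable any? (suc n) P? =
  map′ (λ { (x , xs , p) → x ∷ xs , p }) (λ { (x ∷ xs , p) → x , xs , p })
       (any? λ x → Vec-searchable any? n λ xs → P? (x ∷ xs))

ofLength-searchable : Searchable A → ∀ m {P : List A → Set} → Decidable P →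
                      Dec (∃ λ xs → length xs ≡ m × P xs)
ofLength-searchable any? m {P} P? =
  map′ (λ { (v , p) → toList v , Vec.length-toList v , p })
       (λ { (xs , refl , p) → fromList xs , subst P (sym (Vec.toList∘fromList xs)) p })
       (Vec-searchable any? m (P? ∘ toList))

ofLength-all? : Searchable A → ∀ m {P : List A → Set} → Decidable P →
                Dec (∀ xs → length xs ≡ m → P xs)
ofLength-all? any? m P? =
  map′ (λ ∄ xs eq → decidable-stable (P? xs) λ ¬p → ∄ (xs , eq , ¬p))
       (λ ∀P (xs , eq , ¬p) → ¬p (∀P xs eq))
       (¬? (ofLength-searchable any? m (¬? ∘ P?)))

greatest : {P : ℕ → Set} → Decidable P → P 0 → (b : ℕ) → (∀ m → P m → m ≤ b) →
           ∃ λ m → P m × (∀ l → P l → l ≤ m)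
greatest P? p₀ zero    bound = 0 , p₀ , bound
greatest {P} P? p₀ (suc b) bound with P? (suc b)
... | yes p = suc b , p , bound
... | no ¬p = greatest P? p₀ b λ m p → ℕ.≤-pred
  (ℕ.≤∧≢⇒< (bound m p) λ { refl → ¬p p })

-- Positions are 0-based: i : Fin k stands for the index toℕ i + 1.
IsTown : Vec 𝔽₂ k → List (Subset n) → Set
IsTown {k} {n} α 𝓕 =
  ∀ (i : Fin k) (Fs : List (Subset n)) → length Fs ≡ suc (toℕ i) →
  Unique Fs → All (_∈ 𝓕) Fs → parity ∣ ⋂ Fs ∣ ≡ lookup α i

-- A family of subsets is a duplicate-free list, so that its length is its size.
IsMaximumTownSize : Vec 𝔽₂ k → ℕ → ℕ → Set
IsMaximumTownSize α n m =
    (Σ[ 𝓕 ∈ List (Subset n) ] (Unique 𝓕 × IsTown α 𝓕 × length 𝓕 ≡ m))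
  × (∀ (𝓕 : List (Subset n)) → Unique 𝓕 → IsTown α 𝓕 → length 𝓕 ≤ m)

_≟ˢ_ : DecidableEquality (Subset n)
_≟ˢ_ = Vec.≡-dec _≟ᵇ_

isTown? : (α : Vec 𝔽₂ k) → Decidable (IsTown {n = n} α)
isTown? α 𝓕 = Fin.all? λ i → ofLength-all? anySubset? (suc (toℕ i)) λ Fs →
  unique? _≟ˢ_ Fs →-dec (All.all? (λ F → _∈?_ _≟ˢ_ F 𝓕) Fs →-dec
    (parity ∣ ⋂ Fs ∣ ℙ.≟ lookup α i))

[]-isTown : (α : Vec 𝔽₂ k) → IsTown {n = n} α []
[]-isTown α i (F ∷ Fs) _ _ (() All.∷ _)

maximumTownSize : (α : Vec 𝔽₂ k) (n : ℕ) → ∃ (IsMaximumTownSize α n)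
maximumTownSize {k} α n =
  let m , (𝓕 , len , uniq , town) , maximal =
        greatest (λ m → ofLength-searchable anySubset? m λ 𝓕 →
                    unique? _≟ˢ_ 𝓕 ×-dec isTown? α 𝓕)
                 ([] , refl , [] , []-isTown α)
                 (2 ^ n)
                 (λ m (𝓕 , len , uniq , _) →
                    subst (_≤ 2 ^ n) len (Unique⇒length≤ (Subset↔Fin n) uniq))
  in m , (𝓕 , uniq , town , len) , λ 𝓖 uniq′ town′ → maximal _ (𝓖 , refl , uniq′ , town′)

f : Vec 𝔽₂ k → ℕ → ℕ
f α n = proj₁ (maximumTownSize α n)

-- All indices i, j, m below are at least 1.  γᵒᵈᵈ i is the vector γ^{2i-1} and
-- γᵉᵛᵉⁿ i is γ^{2i}; for the former, binom(-i, j-1) = ± binom(i+j-2, j-1).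
γᵒᵈᵈ γᵉᵛᵉⁿ : ℕ → ℕ → 𝔽₂
γᵒᵈᵈ  i j = parity ((i ℕ.+ j ∸ 2) C (j ∸ 1))
γᵉᵛᵉⁿ i j = parity ((i ∸ 1) C (j ∸ 1))

γ-ofParity : 𝔽₂ → ℕ → ℕ → 𝔽₂
γ-ofParity 1ℙ = γᵒᵈᵈ
γ-ofParity 0ℙ = γᵉᵛᵉⁿ

γ : ℕ → ℕ → 𝔽₂
γ m = γ-ofParity (parity m) ⌈ m /2⌉

combine : Vec 𝔽₂ k → Vec 𝔽₂ k
combine {k} c = tabulate λ j → ∑[ i < k ] (lookup c i * γ (suc (toℕ i)) (suc (toℕ j)))

-- The canonical vectors form a basis of 𝔽₂^k.  Identifying a sequence with its
-- generating function over 𝔽₂, γ^{2i-1} is (1+x)^{-i} and γ^{2i} is (1+x)^{i-1}.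

-- power m r is (1+x)^{r-m}, with coefficients indexed from 0.
power : ℕ → ℕ → ℕ → 𝔽₂
power zero    r       j = parity (r C j)
power (suc m) zero    j = parity ((m ℕ.+ j) C j)
power (suc m) (suc r) j = power m r j

powerIndex : ℕ → ℕ → ℕ
powerIndex zero    r       = suc r ℕ.+ suc r
powerIndex (suc m) zero    = suc (m ℕ.+ m)
powerIndex (suc m) (suc r) = powerIndex m r

-- shifted m r d is x^d (1+x)^{r-m}.
shifted : ℕ → ℕ → ℕ → ℕ → 𝔽₂
shifted m r zero    j       = power m r j
shifted m r (suc d) zero    = 0ℙ
shifted m r (suc d) (suc j) = shifted m r d j

linear : (Fin k → 𝔽₂) → Vec 𝔽₂ k → 𝔽₂
linear {k} F c = ∑[ i < k ] (lookup c i * F i)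

InSpan : ∀ k → (ℕ → 𝔽₂) → Set
InSpan k s = ∃ λ (c : Vec 𝔽₂ k) → ∀ j → j < k → linear (λ i → γ (suc (toℕ i)) (suc j)) c ≡ s j

private
  p+p≡0 : ∀ p → p + p ≡ 0ℙ
  p+p≡0 0ℙ = refl
  p+p≡0 1ℙ = refl

  p+[p+q]≡q : ∀ p q → p + (p + q) ≡ q
  p+[p+q]≡q 0ℙ q  = refl
  p+[p+q]≡q 1ℙ 0ℙ = refl
  p+[p+q]≡q 1ℙ 1ℙ = refl

  parity-double : ∀ m → parity (m ℕ.+ m) ≡ 0ℙ
  parity-double m = trans (ℙ.+-homo-+ m m) (p+p≡0 (parity m))

  parity-suc-double : ∀ m → parity (suc (m ℕ.+ m)) ≡ 1ℙ
  parity-suc-double m = trans (ℙ.+-homo-+ 1 (m ℕ.+ m)) (cong (1ℙ +_) (parity-double m))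

  ⌈suc-double/2⌉ : ∀ m → ⌈ suc (m ℕ.+ m) /2⌉ ≡ suc m
  ⌈suc-double/2⌉ m = cong suc (sym (ℕ.n≡⌊n+n/2⌋ m))

  pascal : ∀ a j → parity (a C suc j) + parity (a C j) ≡ parity (suc a C suc j)
  pascal a j = begin
    parity (a C suc j) + parity (a C j)  ≡⟨ ℙ.+-comm (parity (a C suc j)) _ ⟩
    parity (a C j) + parity (a C suc j)  ≡⟨ ℙ.+-homo-+ (a C j) (a C suc j) ⟨
    parity (a C j ℕ.+ a C suc j)         ≡⟨ cong parity (nCk+nC[k+1]≡[n+1]C[k+1] a j) ⟩
    parity (suc a C suc j)               ∎
    where open ≡-Reasoning

γ-even : ∀ i j → γ (suc i ℕ.+ suc i) j ≡ γᵉᵛᵉⁿ (suc i) j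
γ-even i j = cong₂ (λ p a → γ-ofParity p a j) (parity-double (suc i)) (sym (ℕ.n≡⌈n+n/2⌉ (suc i)))

γ-odd : ∀ i j → γ (suc (i ℕ.+ i)) j ≡ γᵒᵈᵈ (suc i) j
γ-odd i j = cong₂ (λ p a → γ-ofParity p a j) (parity-suc-double i) (⌈suc-double/2⌉ i)

γ-powerIndex : ∀ m r j → γ (powerIndex m r) (suc j) ≡ power m r j
γ-powerIndex zero    r       j = γ-even r (suc j)
γ-powerIndex (suc m) zero    j = begin
  γ (suc (m ℕ.+ m)) (suc j)         ≡⟨ γ-odd m (suc j) ⟩
  parity ((m ℕ.+ suc j ∸ 1) C j)    ≡⟨ cong (λ a → parity ((a ∸ 1) C j)) (ℕ.+-suc m j) ⟩
  parity ((m ℕ.+ j) C j)            ∎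
  where open ≡-Reasoning
γ-powerIndex (suc m) (suc r) j = γ-powerIndex m r j

power-head : ∀ m r → power m r 0 ≡ 1ℙ
power-head zero    r       = refl
power-head (suc m) zero    = refl
power-head (suc m) (suc r) = power-head m r

power-suc : ∀ m r j → power m r (suc j) + power m r j ≡ power m (suc r) (suc j)
power-suc zero          r       j = pascal r j
power-suc (suc zero)    zero    j rewrite nCn≡1 (suc j) | nCn≡1 j = refl
power-suc (suc (suc m)) zero    j rewrite ℕ.+-suc m j = begin
  parity (suc (suc (m ℕ.+ j)) C suc j) + b   ≡⟨ cong (_+ b) (pascal (suc (m ℕ.+ j)) j) ⟨
  (a + b) + b                                 ≡⟨ ℙ.+-assoc a b b ⟩
  a + (b + b)                                 ≡⟨ cong (a +_) (p+p≡0 b) ⟩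
  a + 0ℙ                                      ≡⟨ ℙ.+-identityʳ a ⟩
  a                                           ∎
  where
  open ≡-Reasoning
  a = parity (suc (m ℕ.+ j) C suc j)
  b = parity (suc (m ℕ.+ j) C j)
power-suc (suc m) (suc r) j = power-suc m r j

shifted-suc : ∀ m r d j → shifted m r (suc d) j ≡ shifted m r d j + shifted m (suc r) d j
shifted-suc m r zero    zero    rewrite power-head m r | power-head m (suc r) = refl
shifted-suc m r zero    (suc j) = sym (trans
  (cong (power m r (suc j) +_) (sym (power-suc m r j)))
  (p+[p+q]≡q (power m r (suc j)) (power m r j)))
shifted-suc m r (suc d) zero    = refl
shifted-suc m r (suc d) (suc j) = shifted-suc m r d j

shifted-below : ∀ m r d j → j < d → shifted m r d j ≡ 0ℙ
shifted-below m r (suc d) zero    _         = refl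
shifted-below m r (suc d) (suc j) (s≤s j<d) = shifted-below m r d j j<d

shifted-diagonal : ∀ m r d → shifted m r d d ≡ 1ℙ
shifted-diagonal m r zero    = power-head m r
shifted-diagonal m r (suc d) = shifted-diagonal m r d

linear-+ : (F : Fin k → 𝔽₂) (c d : Vec 𝔽₂ k) → linear F (zipWith _+_ c d) ≡ linear F c + linear F d
linear-+ F c d = trans
  (sum-cong-≗ λ i → trans (cong (_* F i) (Vec.lookup-zipWith _+_ i c d))
                          (ℙ.*-distribʳ-+ (F i) (lookup c i) (lookup d i)))
  (∑-distrib-+ (λ i → lookup c i * F i) (λ i → lookup d i * F i))

linear-0 : (F : Fin k → 𝔽₂) → linear F (replicate k 0ℙ) ≡ 0ℙ
linear-0 {zero}  F = refl
linear-0 {suc k} F = linear-0 (F ∘ suc)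

unit : Fin k → Vec 𝔽₂ k
unit {suc k} zero    = 1ℙ ∷ replicate k 0ℙ
unit {suc k} (suc i) = 0ℙ ∷ unit i

linear-unit : (F : Fin k → 𝔽₂) (i : Fin k) → linear F (unit i) ≡ F i
linear-unit F zero    = trans (cong (F zero +_) (linear-0 (F ∘ suc))) (ℙ.+-identityʳ _)
linear-unit F (suc i) = linear-unit (F ∘ suc) i

InSpan-cong : ∀ {s t} → (∀ j → j < k → s j ≡ t j) → InSpan k s → InSpan k t
InSpan-cong s≡t (c , eq) = c , λ j j<k → trans (eq j j<k) (s≡t j j<k)

InSpan-0 : InSpan k (λ _ → 0ℙ)
InSpan-0 {k} = replicate k 0ℙ , λ j _ → linear-0 {k} (λ i → γ (suc (toℕ i)) (suc j))

InSpan-+ : ∀ {s t} → InSpan k s → InSpan k t → InSpan k (λ j → s j + t j)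
InSpan-+ (c , eq) (d , eq′) = zipWith _+_ c d , λ j j<k →
  trans (linear-+ _ c d) (cong₂ _+_ (eq j j<k) (eq′ j j<k))

InSpan-γ : ∀ i → i < k → InSpan k (λ j → γ (suc i) (suc j))
InSpan-γ i i<k = unit (fromℕ< i<k) , λ j _ →
  trans (linear-unit _ (fromℕ< i<k)) (cong (λ a → γ (suc a) (suc j)) (Fin.toℕ-fromℕ< i<k))

-- (1+x)^{-m}, …, (1+x)^{k-1-m} are canonical vectors for m = ⌈k/2⌉.
IsCentre : ℕ → ℕ → Set
IsCentre k m = m ℕ.+ m ≤ suc k × k ≤ m ℕ.+ m

centre : ∀ k → IsCentre k ⌈ k /2⌉
centre zero          = z≤n , z≤n
centre (suc zero)    = s≤s (s≤s z≤n) , s≤s z≤n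
centre (suc (suc k)) rewrite ℕ.+-suc ⌈ k /2⌉ ⌈ k /2⌉ =
  let l , u = centre k in s≤s (s≤s l) , s≤s (s≤s u)

powerIndex-≤ : ∀ m r {k} → m ℕ.+ m ≤ suc k → suc r ℕ.+ suc r ≤ k ℕ.+ (m ℕ.+ m) → powerIndex m r ≤ k
powerIndex-≤ zero    r       {k} l u = ℕ.≤-trans u (ℕ.≤-reflexive (ℕ.+-identityʳ k))
powerIndex-≤ (suc m) zero    l u rewrite ℕ.+-suc m m = ℕ.≤-pred l
powerIndex-≤ (suc m) (suc r) {k} l u = powerIndex-≤ m r
  (ℕ.≤-trans (ℕ.+-mono-≤ (ℕ.n≤1+n m) (ℕ.n≤1+n m)) l)
  (ℕ.≤-pred (ℕ.≤-pred (subst₂ _≤_ (cong suc (ℕ.+-suc (suc r) (suc r)))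
    (trans (cong (λ a → k ℕ.+ suc a) (ℕ.+-suc m m))
      (trans (ℕ.+-suc k _) (cong suc (ℕ.+-suc k _)))) u)))

InSpan-power : ∀ m r → IsCentre k m → r < k → InSpan k (power m r)
InSpan-power {k} m r (l , u) r<k = index (powerIndex m r) refl
  (powerIndex-≤ m r l (ℕ.+-mono-≤ r<k (ℕ.≤-trans r<k u)))
  where
  positive : ∀ m r → powerIndex m r ≢ 0
  positive (suc m) (suc r) = positive m r
  index : ∀ i → powerIndex m r ≡ i → i ≤ k → InSpan k (power m r)
  index zero    eq _   = ⊥-elim (positive m r eq)
  index (suc i) eq i<k = InSpan-cong
    (λ j _ → trans (cong (λ a → γ a (suc j)) (sym eq)) (γ-powerIndex m r j))
    (InSpan-γ i i<k)

InSpan-shifted : ∀ m r d → IsCentre k m → d ℕ.+ r < k → InSpan k (shifted m r d)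
InSpan-shifted m r zero    mid r<k   = InSpan-power m r mid r<k
InSpan-shifted {k} m r (suc d) mid d+r<k = InSpan-cong (λ j _ → sym (shifted-suc m r d j))
  (InSpan-+ (InSpan-shifted m r d mid (ℕ.<-trans (ℕ.n<1+n _) d+r<k))
            (InSpan-shifted m (suc r) d mid (subst (_< k) (sym (ℕ.+-suc d r)) d+r<k)))

InSpan-all : ∀ e p → e ℕ.+ p ≡ k → ∀ s → (∀ j → j < p → s j ≡ 0ℙ) → InSpan k s
InSpan-all zero    p refl s low = InSpan-cong (λ j j<p → sym (low j j<p)) InSpan-0
InSpan-all {k} (suc e) p eq s low with s p in sp
... | 0ℙ = InSpan-all e (suc p) (trans (ℕ.+-suc e p) eq) s low′
  where
  low′ : ∀ j → j < suc p → s j ≡ 0ℙ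
  low′ j j<1+p with ℕ.m<1+n⇒m<n∨m≡n j<1+p
  ... | inj₁ j<p  = low j j<p
  ... | inj₂ refl = sp
... | 1ℙ = InSpan-cong (λ j _ → p+[p+q]≡q (x^p j) (s j))
  (InSpan-+ (InSpan-shifted ⌈ k /2⌉ 0 p (centre k) p+0<k)
            (InSpan-all e (suc p) (trans (ℕ.+-suc e p) eq) (λ j → x^p j + s j) low′))
  where
  x^p = shifted ⌈ k /2⌉ 0 p
  p+0<k : p ℕ.+ 0 < k
  p+0<k rewrite ℕ.+-identityʳ p | sym eq = s≤s (ℕ.m≤n+m p e)
  low′ : ∀ j → j < suc p → x^p j + s j ≡ 0ℙ
  low′ j j<1+p with ℕ.m<1+n⇒m<n∨m≡n j<1+p
  ... | inj₁ j<p  = cong₂ _+_ (shifted-below ⌈ k /2⌉ 0 p j j<p) (low j j<p)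
  ... | inj₂ refl = cong₂ _+_ (shifted-diagonal ⌈ k /2⌉ 0 p) sp

sequence : Vec 𝔽₂ k → ℕ → 𝔽₂
sequence []      _       = 0ℙ
sequence (a ∷ α) zero    = a
sequence (a ∷ α) (suc j) = sequence α j

sequence-toℕ : (α : Vec 𝔽₂ k) (j : Fin k) → sequence α (toℕ j) ≡ lookup α j
sequence-toℕ (a ∷ α) zero    = refl
sequence-toℕ (a ∷ α) (suc j) = sequence-toℕ α j

combine-surjective : (α : Vec 𝔽₂ k) → ∃ λ c → combine c ≡ α
combine-surjective {k} α =
  let c , eq = InSpan-all k 0 (ℕ.+-identityʳ k) (sequence α) (λ _ ())
  in c , trans (Vec.tabulate-cong λ j → trans (eq (toℕ j) (Fin.toℕ<n j)) (sequence-toℕ α j))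
               (Vec.tabulate∘lookup α)

_≟ᵛ_ : DecidableEquality (Vec 𝔽₂ k)
_≟ᵛ_ = Vec.≡-dec ℙ._≟_

section-surjective : (α c : Vec 𝔽₂ k) → combine c ≡ α → proj₁ (combine-surjective α) ≡ c
section-surjective {k} α c eq with proj₁ (combine-surjective α) ≟ᵛ c
... | yes eq′ = eq′
... | no  neq = ⊥-elim (collision (Fin.pigeonhole (ℕ.n<1+n (2 ^ k)) code))
  where
  open Inverse (𝔽₂^↔Fin k)
  s : Vec 𝔽₂ k → Vec 𝔽₂ k
  s β = proj₁ (combine-surjective β)
  missed : ∀ β → c ≢ s β
  missed β refl = neq (cong s (trans (sym eq) (proj₂ (combine-surjective β))))
  s-injective : ∀ {β δ} → s β ≡ s δ → β ≡ δ
  s-injective {β} {δ} eq′ = trans (sym (proj₂ (combine-surjective β)))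
    (trans (cong combine eq′) (proj₂ (combine-surjective δ)))
  code : Fin (suc (2 ^ k)) → Fin (2 ^ k)
  code zero    = to c
  code (suc i) = to (s (from i))
  collision : ¬ (∃ λ i → ∃ λ j → i Fin.< j × code i ≡ code j)
  collision (zero  , suc j , _ , eq′) = missed (from j) (↔-injective (𝔽₂^↔Fin k) eq′)
  collision (suc i , suc j , i<j , eq′) = ℕ.<⇒≢ i<j (cong (suc ∘ toℕ)
    (↔-injective (↔-sym (𝔽₂^↔Fin k)) (s-injective (↔-injective (𝔽₂^↔Fin k) eq′))))

canonicalDecomposition : (α : Vec 𝔽₂ k) → ∃! _≡_ λ c → combine c ≡ α
canonicalDecomposition α =
  proj₁ (combine-surjective α) , proj₂ (combine-surjective α) , λ {c} → section-surjective α c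

coefficients : Vec 𝔽₂ k → Vec 𝔽₂ k
coefficients α = proj₁ (canonicalDecomposition α)

lv : Vec 𝔽₂ k → ℕ
lv {k} α = max 0 (List.map (λ i → ⌊ suc (toℕ i) /2⌋)
                           (filter (λ i → lookup (coefficients α) i ℙ.≟ 1ℙ) (allFin k)))

-- γ^m occurs in the canonical decomposition of α; never the case if m > k.
Appears : ℕ → Vec 𝔽₂ k → Set
Appears {k} m α = Σ[ i ∈ Fin k ] (suc (toℕ i) ≡ m × lookup (coefficients α) i ≡ 1ℙ)

appears? : ∀ m (α : Vec 𝔽₂ k) → Dec (Appears m α)
appears? m α = Fin.any? λ i → (suc (toℕ i) ℕ.≟ m) ×-dec (lookup (coefficients α) i ℙ.≟ 1ℙ)

-- Only meaningful when lv α > 0; the last clause is then impossible.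
grd : Vec 𝔽₂ k → ℕ
grd α with appears? (2 ℕ.* lv α) α | appears? (suc (2 ℕ.* lv α)) α
... | yes _ | yes _ = 2
... | yes _ | no  _ = 1
... | no  _ | yes _ = 1
... | no  _ | no  _ = 0

toℚ : ℕ → ℚ
toℚ m = ℤ.+ m ℚ./ 1

-- g(n) = (1 + o(1)) · x(n)^{1/t}.  For x(n) ≥ 0, t ≥ 1 and 0 < ε < 1, raising
-- (1 - ε) x(n)^{1/t} ≤ g(n) ≤ (1 + ε) x(n)^{1/t} to the t-th power gives
-- inequalities between rationals.
AsymptoticToRoot : (g : ℕ → ℕ) (t : ℕ) (x : ℕ → ℚ) → Set
AsymptoticToRoot g t x =
  ∀ (ε : ℚ) → 0ℚ ℚ.< ε → ε ℚ.< 1ℚ →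
  ∃ λ N → ∀ n → N ≤ n →
      (1ℚ ℚ.- ε) ^ℚ t ℚ.* x n ℚ.≤ toℚ (g n) ^ℚ t
    × toℚ (g n) ^ℚ t ℚ.≤ (1ℚ ℚ.+ ε) ^ℚ t ℚ.* x n

{-# OPTIONS --safe #-}
-- A family 𝓕 of m subsets of [n] is the same as a list of n points, each recorded as the set of
-- the members of 𝓕 that contain it; the town condition then prescribes, for every set A of at
-- most k members, the parity s |A| of the number of points S ⊇ A.  Let ∂ be the operator with
-- (∂ s) j = s j + s (j+1), which on generating functions is multiplication by 1 + x.  By
-- inclusion-exclusion, the number of points that contain J and avoid I, for disjoint I and J of
-- size t = lv α, is (∂^t s) t modulo 2, and this is 1 if the grade is 1.  Hence the disjointness
-- matrix of the t-sets has rank at most n over 𝔽₂.  As disj(I, J) = [I = J] + (the number of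
-- common subsets of I and J of size less than t), this matrix differs from the identity by one
-- of rank O(m^(t-1)), so that binom(m, t) ≤ n + O(m^(t-1)).  If the grade is 2, the points
-- inside and the points outside a fixed member both satisfy the hypotheses of this argument,
-- which gives 2 binom(m, t) ≤ n + O(m^(t-1)).
--
-- Conversely, if m is divisible by a large power of 2, then the t-subsets of [m] realise γ^{2t},
-- and their complements realise γ^{2t+1}, so that binom(m, t) points per canonical vector of
-- top level suffice, together with O(m^(t-1)) further points.
--
-- At level 0, two families U ⊥ V in 𝔽₂^n satisfy |U| |V| ≤ 2^n; this is applied to an eventown
-- and the same eventown enlarged by complements or translates.
module Submission where

open import Defs
open import Data.Bool.Base using (Bool; true; false; not; _∧_; _xor_)
import Data.Bool.Properties as Bool
open import Data.Empty using (⊥-elim)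
open import Data.Fin.Base using (Fin; zero; suc; toℕ; fromℕ<)
import Data.Fin.Properties as Fin
open import Data.Fin.Subset using (Subset; inside; outside; ∣_∣; ⊥; ⊤; ∁; _∩_; ⋂)
open import Data.Fin.Subset.Properties using (∩-identityʳ; ∩-idem)
open import Data.List.Base as List using (List; []; _∷_; _++_; length)
import Data.List.Properties as List
open import Data.List.Extrema.Nat using (xs≤max)
open import Data.List.Membership.Propositional using (_∈_)
open import Data.List.Membership.Propositional.Properties
  using (∈-lookup; ∈-map⁺; ∈-map⁻; ∈-++⁺ˡ; ∈-++⁺ʳ; ∈-++⁻; ∈-filter⁺; ∈-allFin; ∈-tabulate⁻)
open import Data.List.Relation.Unary.All as All using (All; []; _∷_)
open import Data.List.Relation.Unary.AllPairs using ([]; _∷_)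
open import Data.List.Relation.Unary.Any as Any using (here; there)
open import Data.List.Relation.Unary.Any.Properties using (lookup-index)
open import Data.List.Relation.Unary.Unique.Propositional using (Unique)
import Data.List.Relation.Unary.Unique.Propositional.Properties as Unique
open import Data.Nat.Base as ℕ using (ℕ; zero; suc; z≤n; s≤s; parity; ⌊_/2⌋; _!)
open import Data.Nat.Combinatorics
  using (_C_; nC1≡n; nCn≡1; k>n⇒nCk≡0; nCk≡nC[n∸k]; nCk+nC[k+1]≡[n+1]C[k+1])
import Data.Nat.Properties as ℕ
open import Data.Nat.Tactic.RingSolver using (solve-∀)
open import Data.Parity.Base as ℙ using (0ℙ; 1ℙ)
import Data.Parity.Properties as ℙ
open import Data.Product.Base using (∃; _×_; _,_; proj₁; proj₂)
open import Data.Sum.Base using (_⊎_; inj₁; inj₂)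
open import Data.Vec.Base as Vec using (Vec; []; _∷_; lookup; replicate; zipWith; _[_]≔_)
import Data.Vec.Properties as Vec
open import Function.Base using (_∘_)
open import Function.Bundles using (Inverse)
open import Function.Properties.Inverse using (↔-sym)
open import Relation.Binary.Definitions using (tri<; tri≈; tri>)
open import Relation.Binary.PropositionalEquality
open import Relation.Nullary.Decidable using (yes; no; decidable-stable)
open import Relation.Nullary.Negation using (¬_)

-- Why the top level decides: with positions counted from 1, `∂^ a s j` is the coefficient of
-- x^(a+j-1) in (1+x)^a times the generating function of s. Put a = t = lv α. A canonical vector of
-- level below t becomes a polynomial of degree at most 2t-2, while γ^{2t} becomes (1+x)^(2t-1) and
-- γ^{2t+1} becomes (1+x)^(-1), all of whose coefficients are 1 over 𝔽₂. Hence (∂^t s) t, the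
-- coefficient of x^(2t-1), is the sum of the two coefficients of top level: 1 in grade 1, but 0 in
-- grade 2. This cancellation is the obstacle that forces the split along a fixed member. Inside it,
-- the coefficient of x^(2t) in (1+x)^t s is read, to which only γ^{2t+1} contributes; outside it,
-- the one in (1+x)^(t+1) s, to which only γ^{2t} does. The entry of s at 0 would be the parity of
-- n, which no town prescribes; since t > 0, the argument never reads it. Only leading terms matter,
-- so constants at lower powers are chosen for convenience.

module Sums where

  -- Sums over 𝔽₂ and a rank bound

  open import Data.Parity.Base using (_+_; _*_)
  open import Data.Nat.Base using (_≤_; _^_)
  open import Algebra.Properties.Semiring.Sum ℙ.+-*-semiring public
    using (sum; sum-cong-≗; sum-replicate-zero; ∑-distrib-+; ∑-comm; *-distribˡ-sum; *-distribʳ-sum)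
  open import Algebra.Properties.CommutativeSemigroup ℙ.+-commutativeSemigroup public
    using () renaming (interchange to +-interchange)

  private
    variable
      A B : Set

  -- Indexed by positions, so that repeated points count separately and a list can serve directly as
  -- the inner index set of a matrix product in `rank-bound`.
  ∑ : List A → (A → 𝔽₂) → 𝔽₂
  ∑ xs g = sum (g ∘ List.lookup xs)

  ∑-cong : ∀ (xs : List A) {g h : A → 𝔽₂} → (∀ x → g x ≡ h x) → ∑ xs g ≡ ∑ xs h
  ∑-cong xs g≗h = sum-cong-≗ (g≗h ∘ List.lookup xs)

  ∑-zero : ∀ (xs : List A) → ∑ xs (λ _ → 0ℙ) ≡ 0ℙ
  ∑-zero xs = sum-replicate-zero (length xs)

  ∑-++ : ∀ (xs ys : List A) (g : A → 𝔽₂) → ∑ (xs ++ ys) g ≡ ∑ xs g + ∑ ys g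
  ∑-++ []       ys g = refl
  ∑-++ (x ∷ xs) ys g = trans (cong (g x +_) (∑-++ xs ys g)) (sym (ℙ.+-assoc (g x) _ _))

  ∑-map : ∀ (φ : B → A) (xs : List B) (g : A → 𝔽₂) → ∑ (List.map φ xs) g ≡ ∑ xs (g ∘ φ)
  ∑-map φ []       g = refl
  ∑-map φ (x ∷ xs) g = cong (g (φ x) +_) (∑-map φ xs g)

  sum-single : ∀ {n} (g : Fin n → 𝔽₂) (i : Fin n) → (∀ j → j ≢ i → g j ≡ 0ℙ) → sum g ≡ g i
  sum-single {suc n} g zero    z = trans
    (cong (g zero +_) (trans (sum-cong-≗ λ j → z (suc j) λ ()) (sum-replicate-zero n)))
    (ℙ.+-identityʳ _)
  sum-single {suc n} g (suc i) z = cong₂ _+_ (z zero λ ())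
    (sum-single (g ∘ suc) i λ j j≢i → z (suc j) (j≢i ∘ Fin.suc-injective))

  -- c ↦ c A is an injection of 𝔽₂^m into 𝔽₂^n, because c is recovered as (c A) B.
  rank-bound : ∀ {m n} (A : Fin m → Fin n → 𝔽₂) (B : Fin n → Fin m → 𝔽₂) →
    (∀ i → sum (λ l → A i l * B l i) ≡ 1ℙ) →
    (∀ i j → i ≢ j → sum (λ l → A i l * B l j) ≡ 0ℙ) → m ≤ n
  rank-bound {m} {n} A B diagonal off-diagonal = ℕ.≮⇒≥ λ n<m →
    ℕ.<⇒≱ (ℕ.^-monoʳ-< 2 (s≤s (s≤s z≤n)) n<m) (Fin.injective⇒≤ code-injective)
    where
    encode : Vec 𝔽₂ m → Vec 𝔽₂ n
    encode c = Vec.tabulate λ l → sum λ i → lookup c i * A i l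

    decode : ∀ c j → sum (λ l → lookup (encode c) l * B l j) ≡ lookup c j
    decode c j = begin
      sum (λ l → lookup (encode c) l * B l j)
        ≡⟨ sum-cong-≗ (λ l → trans (cong (_* B l j) (Vec.lookup∘tabulate _ l))
                                   (*-distribʳ-sum (B l j) (λ i → lookup c i * A i l))) ⟩
      sum (λ l → sum λ i → (lookup c i * A i l) * B l j)
        ≡⟨ ∑-comm (λ l i → (lookup c i * A i l) * B l j) ⟩
      sum (λ i → sum λ l → (lookup c i * A i l) * B l j)
        ≡⟨ sum-cong-≗ (λ i → trans (sum-cong-≗ λ l → ℙ.*-assoc (lookup c i) (A i l) (B l j))
                                   (sym (*-distribˡ-sum (lookup c i) (λ l → A i l * B l j)))) ⟩
      sum (λ i → lookup c i * sum λ l → A i l * B l j)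
        ≡⟨ sum-single _ j (λ i i≢j → trans (cong (lookup c i *_) (off-diagonal i j i≢j)) (ℙ.*-zeroʳ _)) ⟩
      lookup c j * sum (λ l → A j l * B l j)
        ≡⟨ trans (cong (lookup c j *_) (diagonal j)) (ℙ.*-identityʳ _) ⟩
      lookup c j ∎
      where open ≡-Reasoning

    encode-injective : ∀ {c d} → encode c ≡ encode d → c ≡ d
    encode-injective {c} {d} eq = trans (sym (Vec.tabulate∘lookup c)) (trans
      (Vec.tabulate-cong λ j → trans (sym (decode c j)) (trans
        (cong (λ v → sum λ l → lookup v l * B l j) eq) (decode d j)))
      (Vec.tabulate∘lookup d))

    code : Fin (2 ^ m) → Fin (2 ^ n)
    code = Inverse.to (𝔽₂^↔Fin n) ∘ encode ∘ Inverse.from (𝔽₂^↔Fin m)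

    code-injective : ∀ {i j} → code i ≡ code j → i ≡ j
    code-injective {i} {j} eq = begin
      i                       ≡⟨ strictlyInverseˡ i ⟨
      to (from i)             ≡⟨ cong to (encode-injective (↔-injective (𝔽₂^↔Fin n) eq)) ⟩
      to (from j)             ≡⟨ strictlyInverseˡ j ⟩
      j                       ∎
      where
      open Inverse (𝔽₂^↔Fin m)
      open ≡-Reasoning

-- The disjointness matrix of the t-sets over 𝔽₂

module DisjointnessMatrix where

  open import Data.Parity.Base using (_+_; _*_)
  open import Data.Nat.Base using (_≤_; _<_; _^_)
  open Sums

  private
    variable
      m : ℕ

  ⟦_⟧ : Bool → 𝔽₂
  ⟦ true  ⟧ = 1ℙ
  ⟦ false ⟧ = 0ℙ

  -- The truth values of I ⊆ S, of I ∩ S = ∅ and of I = S.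
  sub disj same : Subset m → Subset m → 𝔽₂
  sub []            []      = 1ℙ
  sub (outside ∷ I) (_ ∷ S) = sub I S
  sub (inside  ∷ I) (b ∷ S) = ⟦ b ⟧ * sub I S

  disj []            []            = 1ℙ
  disj (outside ∷ I) (_       ∷ S) = disj I S
  disj (inside  ∷ I) (inside  ∷ S) = 0ℙ
  disj (inside  ∷ I) (outside ∷ S) = disj I S

  same []            []            = 1ℙ
  same (outside ∷ I) (outside ∷ S) = same I S
  same (outside ∷ I) (inside  ∷ S) = 0ℙ
  same (inside  ∷ I) (outside ∷ S) = 0ℙ
  same (inside  ∷ I) (inside  ∷ S) = same I S

  same-refl : (I : Subset m) → same I I ≡ 1ℙ
  same-refl []            = refl
  same-refl (outside ∷ I) = same-refl I
  same-refl (inside  ∷ I) = same-refl I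

  same-≢ : (I J : Subset m) → I ≢ J → same I J ≡ 0ℙ
  same-≢ []            []            I≢J = ⊥-elim (I≢J refl)
  same-≢ (outside ∷ I) (outside ∷ J) I≢J = same-≢ I J (I≢J ∘ cong (outside ∷_))
  same-≢ (outside ∷ I) (inside  ∷ J) I≢J = refl
  same-≢ (inside  ∷ I) (outside ∷ J) I≢J = refl
  same-≢ (inside  ∷ I) (inside  ∷ J) I≢J = same-≢ I J (I≢J ∘ cong (inside ∷_))

  disj-comm : (I J : Subset m) → disj I J ≡ disj J I
  disj-comm []            []            = refl
  disj-comm (outside ∷ I) (outside ∷ J) = disj-comm I J
  disj-comm (outside ∷ I) (inside  ∷ J) = disj-comm I J
  disj-comm (inside  ∷ I) (outside ∷ J) = disj-comm I J
  disj-comm (inside  ∷ I) (inside  ∷ J) = refl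

  subsetsOfSize : ∀ m → ℕ → List (Subset m)
  subsetsOfSize m       zero    = ⊥ ∷ []
  subsetsOfSize zero    (suc t) = []
  subsetsOfSize (suc m) (suc t) =
    List.map (outside ∷_) (subsetsOfSize m (suc t)) ++ List.map (inside ∷_) (subsetsOfSize m t)

  subsetsBelow : ∀ m → ℕ → List (Subset m)
  subsetsBelow m       zero    = []
  subsetsBelow zero    (suc t) = [] ∷ []
  subsetsBelow (suc m) (suc t) =
    List.map (outside ∷_) (subsetsBelow m (suc t)) ++ List.map (inside ∷_) (subsetsBelow m t)

  length-map-++-map : ∀ {A B C : Set} (g : A → C) (h : B → C) xs ys →
    length (List.map g xs ++ List.map h ys) ≡ length xs ℕ.+ length ys
  length-map-++-map g h xs ys = trans (List.length-++ (List.map g xs))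
    (cong₂ ℕ._+_ (List.length-map g xs) (List.length-map h ys))

  ∑-map-++-map : ∀ {A B C : Set} (g : A → C) (h : B → C) xs ys (F : C → 𝔽₂) →
    ∑ (List.map g xs ++ List.map h ys) F ≡ ∑ xs (F ∘ g) + ∑ ys (F ∘ h)
  ∑-map-++-map g h xs ys F = trans (∑-++ (List.map g xs) (List.map h ys) F)
    (cong₂ _+_ (∑-map g xs F) (∑-map h ys F))

  length-subsetsOfSize : ∀ m t → length (subsetsOfSize m t) ≡ m C t
  length-subsetsOfSize m       zero    = refl
  length-subsetsOfSize zero    (suc t) = refl
  length-subsetsOfSize (suc m) (suc t) = begin
    length (subsetsOfSize (suc m) (suc t))  ≡⟨ length-map-++-map _ _ (subsetsOfSize m (suc t)) _ ⟩
    length (subsetsOfSize m (suc t)) ℕ.+ length (subsetsOfSize m t)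
      ≡⟨ cong₂ ℕ._+_ (length-subsetsOfSize m (suc t)) (length-subsetsOfSize m t) ⟩
    m C suc t ℕ.+ m C t                     ≡⟨ ℕ.+-comm (m C suc t) (m C t) ⟩
    m C t ℕ.+ m C suc t                     ≡⟨ nCk+nC[k+1]≡[n+1]C[k+1] m t ⟩
    suc m C suc t                           ∎
    where open ≡-Reasoning

  -- Crude, but of degree t in m, one less than binom(m, t+1), to which it is an error term.
  length-subsetsBelow : ∀ m t → length (subsetsBelow m (suc t)) ≤ suc m ^ t
  length-subsetsBelow zero    t       = ℕ.≤-reflexive (sym (ℕ.^-zeroˡ t))
  length-subsetsBelow (suc m) zero    = ℕ.≤-trans
    (ℕ.≤-reflexive (length-map-++-map (outside ∷_) (inside ∷_) (subsetsBelow m 1) (subsetsBelow m 0)))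
    (ℕ.≤-trans (ℕ.≤-reflexive (ℕ.+-identityʳ _)) (length-subsetsBelow m zero))
  length-subsetsBelow (suc m) (suc t) = begin
    length (subsetsBelow (suc m) (suc (suc t)))
      ≡⟨ length-map-++-map _ _ (subsetsBelow m (suc (suc t))) _ ⟩
    length (subsetsBelow m (suc (suc t))) ℕ.+ length (subsetsBelow m (suc t))
      ≤⟨ ℕ.+-mono-≤ (length-subsetsBelow m (suc t)) (length-subsetsBelow m t) ⟩
    suc m ℕ.* suc m ^ t ℕ.+ suc m ^ t   ≡⟨ ℕ.+-comm (suc m ℕ.* suc m ^ t) _ ⟩
    suc (suc m) ℕ.* suc m ^ t             ≤⟨ ℕ.*-monoʳ-≤ (suc (suc m)) (ℕ.^-monoˡ-≤ t (ℕ.n≤1+n (suc m))) ⟩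
    suc (suc m) ℕ.* suc (suc m) ^ t       ∎
    where open ℕ.≤-Reasoning

  ∣⊥∣≡0 : ∀ m → ∣ ⊥ {m} ∣ ≡ 0
  ∣⊥∣≡0 zero    = refl
  ∣⊥∣≡0 (suc m) = ∣⊥∣≡0 m

  ∈-subsetsOfSize : ∀ m t {I} → I ∈ subsetsOfSize m t → ∣ I ∣ ≡ t
  ∈-subsetsOfSize m       zero    (here refl) = ∣⊥∣≡0 m
  ∈-subsetsOfSize (suc m) (suc t) I∈ with ∈-++⁻ (List.map (outside ∷_) (subsetsOfSize m (suc t))) I∈
  ... | inj₁ out with ∈-map⁻ _ out
  ...   | _ , I∈′ , refl = ∈-subsetsOfSize m (suc t) I∈′
  ∈-subsetsOfSize (suc m) (suc t) I∈ | inj₂ inn with ∈-map⁻ _ inn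
  ...   | _ , I∈′ , refl = cong suc (∈-subsetsOfSize m t I∈′)

  subsetsOfSize-unique : ∀ m t → Unique (subsetsOfSize m t)
  subsetsOfSize-unique m       zero    = All.[] ∷ []
  subsetsOfSize-unique zero    (suc t) = []
  subsetsOfSize-unique (suc m) (suc t) = Unique.++⁺
    (Unique.map⁺ Vec.∷-injectiveʳ (subsetsOfSize-unique m (suc t)))
    (Unique.map⁺ Vec.∷-injectiveʳ (subsetsOfSize-unique m t))
    λ (I∈out , I∈in) → disjoint (subsetsOfSize m (suc t)) (subsetsOfSize m t) I∈out I∈in
    where
    disjoint : ∀ {I} xs ys → I ∈ List.map (outside ∷_) xs → ¬ I ∈ List.map (inside ∷_) ys
    disjoint _ _ I∈out I∈in with ∈-map⁻ _ I∈out | ∈-map⁻ _ I∈in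
    ... | _ , _ , refl | _ , _ , ()

  commonBelow : ℕ → Subset m → Subset m → 𝔽₂
  commonBelow {m} t I J = ∑ (subsetsBelow m t) λ R → sub R I * sub R J

  private
    ∑-inside : ∀ (Rs : List (Subset m)) b c (I J : Subset m) →
      ∑ Rs (λ R → sub (inside ∷ R) (b ∷ I) * sub (inside ∷ R) (c ∷ J))
        ≡ (⟦ b ⟧ * ⟦ c ⟧) * ∑ Rs (λ R → sub R I * sub R J)
    ∑-inside Rs true true   I J = refl
    ∑-inside Rs true false  I J = trans (∑-cong Rs λ R → ℙ.*-zeroʳ (sub R I)) (∑-zero Rs)
    ∑-inside Rs false c     I J = ∑-zero Rs

  commonBelow-∷ : ∀ t b c (I J : Subset m) → commonBelow (suc t) (b ∷ I) (c ∷ J)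
    ≡ commonBelow (suc t) I J + ((⟦ b ⟧ * ⟦ c ⟧) * commonBelow t I J)
  commonBelow-∷ {m} t b c I J = trans
    (∑-map-++-map (outside ∷_) (inside ∷_) (subsetsBelow m (suc t)) (subsetsBelow m t)
      (λ R → sub R (b ∷ I) * sub R (c ∷ J)))
    (cong (commonBelow (suc t) I J +_) (∑-inside (subsetsBelow m t) b c I J))

  -- A finite set has an odd number of subsets exactly when it is empty; apply this to I ∩ J.
  commonBelow-disj : ∀ t (I J : Subset m) → ∣ I ∣ < t → commonBelow t I J ≡ disj I J
  commonBelow-disj (suc t) [] [] _ = refl
  commonBelow-disj (suc t) (outside ∷ I) (c ∷ J) I<t = trans (commonBelow-∷ t outside c I J)
    (trans (ℙ.+-identityʳ _) (commonBelow-disj (suc t) I J I<t))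
  commonBelow-disj (suc t) (inside ∷ I) (outside ∷ J) (s≤s I<t) = trans (commonBelow-∷ t inside outside I J)
    (trans (ℙ.+-identityʳ _) (commonBelow-disj (suc t) I J (ℕ.m≤n⇒m≤1+n I<t)))
  commonBelow-disj (suc t) (inside ∷ I) (inside ∷ J) (s≤s I<t) = begin
    commonBelow (suc t) (inside ∷ I) (inside ∷ J)  ≡⟨ commonBelow-∷ t inside inside I J ⟩
    commonBelow (suc t) I J + commonBelow t I J    ≡⟨ cong₂ _+_ (commonBelow-disj (suc t) I J (ℕ.m≤n⇒m≤1+n I<t))
                                                                (commonBelow-disj t I J I<t) ⟩
    disj I J + disj I J                            ≡⟨ ℙ.p+p≡0ℙ (disj I J) ⟩
    0ℙ                                             ∎
    where open ≡-Reasoning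

  commonBelow-comm : ∀ t (I J : Subset m) → commonBelow t I J ≡ commonBelow t J I
  commonBelow-comm {m} t I J = ∑-cong (subsetsBelow m t) λ R → ℙ.*-comm (sub R I) (sub R J)

  -- The number of all common subsets is `disj I J` modulo 2, and a common subset of two t-sets has
  -- size t only if it equals both. So the sizes below t miss one subset if I = J and none
  -- otherwise.
  commonBelow-same : ∀ t (I J : Subset m) → ∣ I ∣ ≡ t → ∣ J ∣ ≡ t →
                     disj I J + commonBelow t I J ≡ same I J
  commonBelow-same zero    [] [] _ _ = refl
  commonBelow-same zero (outside ∷ I) (outside ∷ J) I≡t J≡t = commonBelow-same zero I J I≡t J≡t
  commonBelow-same (suc t) (outside ∷ I) (outside ∷ J) I≡t J≡t = trans
    (cong (disj I J +_) (trans (commonBelow-∷ t outside outside I J) (ℙ.+-identityʳ _)))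
    (commonBelow-same (suc t) I J I≡t J≡t)
  -- Here only the tail of J is known to have size below `suc t`, and `commonBelow-disj` asks this
  -- of its first argument: hence the swaps.
  commonBelow-same (suc t) (outside ∷ I) (inside ∷ J) I≡t J≡t = trans
    (cong (disj I J +_) (begin
      commonBelow (suc t) (outside ∷ I) (inside ∷ J)  ≡⟨ commonBelow-∷ t outside inside I J ⟩
      commonBelow (suc t) I J + 0ℙ                    ≡⟨ ℙ.+-identityʳ _ ⟩
      commonBelow (suc t) I J                         ≡⟨ commonBelow-comm (suc t) I J ⟩
      commonBelow (suc t) J I                         ≡⟨ commonBelow-disj (suc t) J I (ℕ.≤-reflexive J≡t) ⟩
      disj J I                                        ≡⟨ disj-comm J I ⟩
      disj I J                                        ∎))
    (ℙ.p+p≡0ℙ (disj I J))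
    where open ≡-Reasoning
  commonBelow-same (suc t) (inside ∷ I) (outside ∷ J) I≡t J≡t = trans
    (cong (disj I J +_) (trans (commonBelow-∷ t inside outside I J)
      (trans (ℙ.+-identityʳ _) (commonBelow-disj (suc t) I J (ℕ.≤-reflexive I≡t)))))
    (ℙ.p+p≡0ℙ (disj I J))
  commonBelow-same (suc t) (inside ∷ I) (inside ∷ J) I≡t J≡t = begin
    commonBelow (suc t) (inside ∷ I) (inside ∷ J)  ≡⟨ commonBelow-∷ t inside inside I J ⟩
    commonBelow (suc t) I J + commonBelow t I J    ≡⟨ cong (_+ commonBelow t I J)
                                                        (commonBelow-disj (suc t) I J (ℕ.≤-reflexive I≡t)) ⟩
    disj I J + commonBelow t I J                   ≡⟨ commonBelow-same t I J (ℕ.suc-injective I≡t) (ℕ.suc-injective J≡t) ⟩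
    same I J                                       ∎
    where open ≡-Reasoning

  Unique-lookup-injective : ∀ {A : Set} {xs : List A} → Unique xs →
    ∀ {i j} → i ≢ j → List.lookup xs i ≢ List.lookup xs j
  Unique-lookup-injective xs! {i} {j} i≢j with Fin.<-cmp i j
  ... | tri< i<j _ _ = Unique-lookup xs! i<j
  ... | tri≈ _ i≡j _ = ⊥-elim (i≢j i≡j)
  ... | tri> _ _ j<i = Unique-lookup xs! j<i ∘ sym

  -- Over 𝔽₂ the disjointness matrix of the t-sets differs from the identity by a matrix that
  -- factors through the smaller sets, and it factors through P by hypothesis.
  disjointness-bound : ∀ t (P : List (Subset m)) →
    (∀ I J → ∣ I ∣ ≡ t → ∣ J ∣ ≡ t → ∑ P (λ S → disj I S * sub J S) ≡ disj I J) →
    m C t ≤ length P ℕ.+ length (subsetsBelow m t)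
  disjointness-bound {m} t P gram = begin
    m C t                                     ≡⟨ length-subsetsOfSize m t ⟨
    length (subsetsOfSize m t)                ≤⟨ rank-bound (λ i l → A (set i) (feature l)) (λ l j → B (feature l) (set j))
                                                   (λ i → trans (product i i) (same-refl (set i)))
                                                   (λ i j i≢j → trans (product i j) (same-≢ (set i) (set j)
                                                     (Unique-lookup-injective (subsetsOfSize-unique m t) i≢j))) ⟩
    length features                           ≡⟨ length-map-++-map inj₁ inj₂ P (subsetsBelow m t) ⟩
    length P ℕ.+ length (subsetsBelow m t)    ∎
    where
    open ℕ.≤-Reasoning
    set : Fin (length (subsetsOfSize m t)) → Subset m
    set = List.lookup (subsetsOfSize m t)
    ∣set∣ : ∀ i → ∣ set i ∣ ≡ t
    ∣set∣ i = ∈-subsetsOfSize m t (∈-lookup i)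
    features : List (Subset m ⊎ Subset m)
    features = List.map inj₁ P ++ List.map inj₂ (subsetsBelow m t)
    feature : Fin (length features) → Subset m ⊎ Subset m
    feature = List.lookup features
    A : Subset m → Subset m ⊎ Subset m → 𝔽₂
    A I (inj₁ S) = disj I S
    A I (inj₂ R) = sub R I
    B : Subset m ⊎ Subset m → Subset m → 𝔽₂
    B (inj₁ S) J = sub J S
    B (inj₂ R) J = sub R J
    product : ∀ i j → ∑ features (λ l → A (set i) l * B l (set j)) ≡ same (set i) (set j)
    product i j = trans (∑-map-++-map inj₁ inj₂ P (subsetsBelow m t) (λ l → A (set i) l * B l (set j)))
      (trans (cong (_+ commonBelow t (set i) (set j)) (gram (set i) (set j) (∣set∣ i) (∣set∣ j)))
             (commonBelow-same t (set i) (set j) (∣set∣ i) (∣set∣ j)))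

-- Inclusion-exclusion on the points of a town

module Moments where

  open import Data.Parity.Base using (_+_; _*_)
  open import Data.Nat.Base using (_≤_; _<_)
  open Sums
  open DisjointnessMatrix

  private
    variable
      k m n : ℕ

  ∂ : (ℕ → 𝔽₂) → ℕ → 𝔽₂
  ∂ s j = s j + s (suc j)

  ∂^ : ℕ → (ℕ → 𝔽₂) → ℕ → 𝔽₂
  ∂^ zero    s = s
  ∂^ (suc a) s = ∂ (∂^ a s)

  ∂^-suc : ∀ a s j → ∂^ a (s ∘ suc) j ≡ ∂^ a s (suc j)
  ∂^-suc zero    s j = refl
  ∂^-suc (suc a) s j = cong₂ _+_ (∂^-suc a s j) (∂^-suc a s (suc j))

  ∂^-+ : ∀ a r s j → ∂^ a (λ i → r i + s i) j ≡ ∂^ a r j + ∂^ a s j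
  ∂^-+ zero    r s j = refl
  ∂^-+ (suc a) r s j = trans (cong₂ _+_ (∂^-+ a r s j) (∂^-+ a r s (suc j)))
    (+-interchange (∂^ a r j) (∂^ a s j) (∂^ a r (suc j)) (∂^ a s (suc j)))

  -- If Φ A counts the points in all the sets of A, then mixed Φ I J counts the points that
  -- are in all the sets of J but in none of those of I.
  mixed : (Subset m → 𝔽₂) → Subset m → Subset m → 𝔽₂
  mixed Φ []            []            = Φ []
  mixed Φ (outside ∷ I) (b       ∷ J) = mixed (Φ ∘ (b ∷_)) I J
  mixed Φ (inside  ∷ I) (outside ∷ J) = mixed (Φ ∘ (outside ∷_)) I J + mixed (Φ ∘ (inside ∷_)) I J
  mixed Φ (inside  ∷ I) (inside  ∷ J) = 0ℙ

  mixed-0 : (I J : Subset m) → mixed (λ _ → 0ℙ) I J ≡ 0ℙ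
  mixed-0 []            []            = refl
  mixed-0 (outside ∷ I) (b       ∷ J) = mixed-0 I J
  mixed-0 (inside  ∷ I) (outside ∷ J) = cong₂ _+_ (mixed-0 I J) (mixed-0 I J)
  mixed-0 (inside  ∷ I) (inside  ∷ J) = refl

  mixed-+ : ∀ Φ Ψ (I J : Subset m) → mixed (λ A → Φ A + Ψ A) I J ≡ mixed Φ I J + mixed Ψ I J
  mixed-+ Φ Ψ []            []            = refl
  mixed-+ Φ Ψ (outside ∷ I) (b       ∷ J) = mixed-+ (Φ ∘ (b ∷_)) (Ψ ∘ (b ∷_)) I J
  mixed-+ Φ Ψ (inside  ∷ I) (outside ∷ J) = trans
    (cong₂ _+_ (mixed-+ (Φ ∘ (outside ∷_)) (Ψ ∘ (outside ∷_)) I J)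
               (mixed-+ (Φ ∘ (inside ∷_)) (Ψ ∘ (inside ∷_)) I J))
    (+-interchange (mixed (Φ ∘ (outside ∷_)) I J) _ _ _)
  mixed-+ Φ Ψ (inside  ∷ I) (inside  ∷ J) = refl

  mixed-sub : ∀ S (I J : Subset m) → mixed (λ A → sub A S) I J ≡ disj I S * sub J S
  mixed-sub []            []            []            = refl
  mixed-sub (b       ∷ S) (outside ∷ I) (outside ∷ J) = mixed-sub S I J
  mixed-sub (inside  ∷ S) (outside ∷ I) (inside  ∷ J) = mixed-sub S I J
  mixed-sub (outside ∷ S) (outside ∷ I) (inside  ∷ J) =
    trans (mixed-0 I J) (sym (ℙ.*-zeroʳ (disj I S)))
  mixed-sub (inside  ∷ S) (inside  ∷ I) (outside ∷ J) = ℙ.p+p≡0ℙ (mixed (λ A → sub A S) I J)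
  mixed-sub (outside ∷ S) (inside  ∷ I) (outside ∷ J) =
    trans (cong₂ _+_ (mixed-sub S I J) (mixed-0 I J)) (ℙ.+-identityʳ _)
  mixed-sub (inside  ∷ S) (inside  ∷ I) (inside  ∷ J) = refl
  mixed-sub (outside ∷ S) (inside  ∷ I) (inside  ∷ J) = sym (ℙ.*-zeroʳ (disj I S))

  mixed-∑ : ∀ P (I J : Subset m) → mixed (λ A → ∑ P (sub A)) I J ≡ ∑ P (λ S → disj I S * sub J S)
  mixed-∑ []      I J = mixed-0 I J
  mixed-∑ (S ∷ P) I J = trans (mixed-+ (λ A → sub A S) (λ A → ∑ P (sub A)) I J)
    (cong₂ _+_ (mixed-sub S I J) (mixed-∑ P I J))

  -- An element of J shifts s by one, an element of I turns s into `∂ s`, and a common element makes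
  -- both sides 0. The sets A that are read satisfy J ⊆ A ⊆ I ∪ J, which is where the window of
  -- sizes comes from.
  mixed-∂^ : ∀ s Φ (I J : Subset m) →
    (∀ A → ∣ J ∣ ≤ ∣ A ∣ → ∣ A ∣ ≤ ∣ I ∣ ℕ.+ ∣ J ∣ → Φ A ≡ s ∣ A ∣) →
    mixed Φ I J ≡ disj I J * (∂^ ∣ I ∣ s) ∣ J ∣
  mixed-∂^ s Φ [] [] moment = moment [] z≤n z≤n
  mixed-∂^ s Φ (outside ∷ I) (outside ∷ J) moment =
    mixed-∂^ s (Φ ∘ (outside ∷_)) I J λ A → moment (outside ∷ A)
  mixed-∂^ s Φ (outside ∷ I) (inside ∷ J) moment = trans
    (mixed-∂^ (s ∘ suc) (Φ ∘ (inside ∷_)) I J λ A l u → moment (inside ∷ A) (s≤s l)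
      (ℕ.≤-trans (s≤s u) (ℕ.≤-reflexive (sym (ℕ.+-suc ∣ I ∣ ∣ J ∣)))))
    (cong (disj I J *_) (∂^-suc (∣ I ∣) s (∣ J ∣)))
  mixed-∂^ s Φ (inside ∷ I) (outside ∷ J) moment = begin
    mixed (Φ ∘ (outside ∷_)) I J + mixed (Φ ∘ (inside ∷_)) I J
      ≡⟨ cong₂ _+_ (mixed-∂^ s (Φ ∘ (outside ∷_)) I J λ A l u → moment (outside ∷ A) l (ℕ.m≤n⇒m≤1+n u))
                   (mixed-∂^ (s ∘ suc) (Φ ∘ (inside ∷_)) I J λ A l u → moment (inside ∷ A) (ℕ.m≤n⇒m≤1+n l) (s≤s u)) ⟩
    disj I J * (∂^ ∣ I ∣ s) ∣ J ∣ + (disj I J * (∂^ ∣ I ∣ (s ∘ suc)) ∣ J ∣)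
      ≡⟨ cong (λ x → disj I J * (∂^ ∣ I ∣ s) ∣ J ∣ + (disj I J * x)) (∂^-suc (∣ I ∣) s (∣ J ∣)) ⟩
    disj I J * (∂^ ∣ I ∣ s) ∣ J ∣ + (disj I J * (∂^ ∣ I ∣ s) (suc ∣ J ∣))
      ≡⟨ ℙ.*-distribˡ-+ (disj I J) ((∂^ ∣ I ∣ s) ∣ J ∣) _ ⟨
    disj I J * (∂^ (suc ∣ I ∣) s) ∣ J ∣ ∎
    where open ≡-Reasoning
  mixed-∂^ s Φ (inside ∷ I) (inside ∷ J) moment = refl

  moment-bound : ∀ t s (P : List (Subset m)) →
    (∀ A → t ≤ ∣ A ∣ → ∣ A ∣ ≤ t ℕ.+ t → ∑ P (sub A) ≡ s ∣ A ∣) → ∂^ t s t ≡ 1ℙ →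
    m C t ≤ length P ℕ.+ length (subsetsBelow m t)
  moment-bound {m} t s P moment one = disjointness-bound t P gram
    where
    open ≡-Reasoning
    gram : ∀ (I J : Subset m) → ∣ I ∣ ≡ t → ∣ J ∣ ≡ t → ∑ P (λ S → disj I S * sub J S) ≡ disj I J
    gram I J refl J≡t = begin
      ∑ P (λ S → disj I S * sub J S)   ≡⟨ mixed-∑ P I J ⟨
      mixed (λ A → ∑ P (sub A)) I J    ≡⟨ mixed-∂^ s (λ A → ∑ P (sub A)) I J (λ A l u → moment A
                                            (subst (_≤ ∣ A ∣) J≡t l) (subst (λ j → ∣ A ∣ ≤ ∣ I ∣ ℕ.+ j) J≡t u)) ⟩
      disj I J * (∂^ ∣ I ∣ s) ∣ J ∣      ≡⟨ cong (λ j → disj I J * ∂^ ∣ I ∣ s j) J≡t ⟩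
      disj I J * (∂^ ∣ I ∣ s) ∣ I ∣      ≡⟨ cong (disj I J *_) one ⟩
      disj I J * 1ℙ                    ≡⟨ ℙ.*-identityʳ _ ⟩
      disj I J                         ∎

  tails : Bool → List (Subset (suc m)) → List (Subset m)
  tails b       []                  = []
  tails inside  ((inside  ∷ S) ∷ P) = S ∷ tails inside P
  tails inside  ((outside ∷ S) ∷ P) = tails inside P
  tails outside ((inside  ∷ S) ∷ P) = tails outside P
  tails outside ((outside ∷ S) ∷ P) = S ∷ tails outside P

  length-tails : (P : List (Subset (suc m))) → length (tails outside P) ℕ.+ length (tails inside P) ≡ length P
  length-tails []                  = refl
  length-tails ((outside ∷ S) ∷ P) = cong suc (length-tails P)
  length-tails ((inside  ∷ S) ∷ P) = trans (ℕ.+-suc _ _) (cong suc (length-tails P))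

  ∑-tails-inside : ∀ (P : List (Subset (suc m))) A → ∑ (tails inside P) (sub A) ≡ ∑ P (sub (inside ∷ A))
  ∑-tails-inside []                  A = refl
  ∑-tails-inside ((outside ∷ S) ∷ P) A = ∑-tails-inside P A
  ∑-tails-inside ((inside  ∷ S) ∷ P) A = cong (sub A S +_) (∑-tails-inside P A)

  -- Outside is everything minus inside, and minus is plus modulo 2; this is why the outer half of a
  -- split carries the sequence `∂ s`.
  ∑-tails-outside : ∀ (P : List (Subset (suc m))) A →
    ∑ (tails outside P) (sub A) ≡ ∑ P (sub (outside ∷ A)) + ∑ P (sub (inside ∷ A))
  ∑-tails-outside []                  A = refl
  ∑-tails-outside ((outside ∷ S) ∷ P) A = trans (cong (sub A S +_) (∑-tails-outside P A))
    (sym (ℙ.+-assoc (sub A S) _ _))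
  ∑-tails-outside ((inside  ∷ S) ∷ P) A = begin
    ∑ (tails outside P) (sub A)        ≡⟨ ∑-tails-outside P A ⟩
    p + q                              ≡⟨ cong (_+ (p + q)) (ℙ.p+p≡0ℙ (sub A S)) ⟨
    sub A S + sub A S + (p + q)        ≡⟨ +-interchange (sub A S) (sub A S) p q ⟩
    sub A S + p + (sub A S + q)        ∎
    where
    open ≡-Reasoning
    p = ∑ P (sub (outside ∷ A))
    q = ∑ P (sub (inside ∷ A))

  -- The points inside and outside the first set both satisfy the hypotheses of moment-bound
  -- for the remaining sets.
  double-moment-bound : ∀ t s (P : List (Subset (suc m))) →
    (∀ A → t ≤ ∣ A ∣ → ∣ A ∣ ≤ suc (t ℕ.+ t) → ∑ P (sub A) ≡ s ∣ A ∣) →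
    ∂^ t s (suc t) ≡ 1ℙ → ∂^ (suc t) s t ≡ 1ℙ →
    2 ℕ.* (m C t) ≤ length P ℕ.+ 2 ℕ.* length (subsetsBelow m t)
  double-moment-bound {m} t s P moment one one′ = begin
    2 ℕ.* (m C t)                              ≡⟨ double (m C t) ⟩
    m C t ℕ.+ m C t                            ≤⟨ ℕ.+-mono-≤ out inn ⟩
    (p ℕ.+ b) ℕ.+ (q ℕ.+ b)                    ≡⟨ ℕ+-interchange p b q b ⟩
    (p ℕ.+ q) ℕ.+ (b ℕ.+ b)                    ≡⟨ cong₂ ℕ._+_ (length-tails P) (sym (double b)) ⟩
    length P ℕ.+ 2 ℕ.* b                       ∎
    where
    open ℕ.≤-Reasoning
    open import Algebra.Properties.CommutativeSemigroup ℕ.+-commutativeSemigroup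
      using () renaming (interchange to ℕ+-interchange)
    p = length (tails outside P)
    q = length (tails inside P)
    b = length (subsetsBelow m t)
    double : ∀ x → 2 ℕ.* x ≡ x ℕ.+ x
    double x = cong (x ℕ.+_) (ℕ.+-identityʳ x)
    out : m C t ≤ p ℕ.+ b
    out = moment-bound t (∂ s) (tails outside P)
      (λ A l u → trans (∑-tails-outside P A) (cong₂ _+_
        (moment (outside ∷ A) l (ℕ.m≤n⇒m≤1+n u)) (moment (inside ∷ A) (ℕ.m≤n⇒m≤1+n l) (s≤s u))))
      -- `∂^` adds each new `∂` outermost, so linearity is needed to turn `∂^ t (∂ s)` into
      -- `∂^ (suc t) s`.
      (trans (∂^-+ t s (s ∘ suc) t) (trans (cong (∂^ t s t +_) (∂^-suc t s t)) one′))
    inn : m C t ≤ q ℕ.+ b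
    inn = moment-bound t (s ∘ suc) (tails inside P)
      (λ A l u → trans (∑-tails-inside P A) (moment (inside ∷ A) (ℕ.m≤n⇒m≤1+n l) (s≤s u)))
      (trans (∂^-suc t s t) one)

  parity-suc : ∀ a → parity (suc a) ≡ 1ℙ + parity a
  parity-suc = ℙ.+-homo-+ 1

  parity-∣∣ : (S : Subset n) → parity ∣ S ∣ ≡ sum (λ x → ⟦ lookup S x ⟧)
  parity-∣∣ []            = refl
  parity-∣∣ (outside ∷ S) = parity-∣∣ S
  parity-∣∣ (inside  ∷ S) = trans (parity-suc ∣ S ∣) (cong (1ℙ +_) (parity-∣∣ S))

  ∑-tabulate : ∀ {A : Set} (h : Fin n → A) (g : A → 𝔽₂) → ∑ (List.tabulate h) g ≡ sum (g ∘ h)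
  ∑-tabulate {zero}  h g = refl
  ∑-tabulate {suc n} h g = cong (g (h zero) +_) (∑-tabulate (h ∘ suc) g)

  ⟦⟧-∧ : ∀ b c → ⟦ b ∧ c ⟧ ≡ ⟦ b ⟧ * ⟦ c ⟧
  ⟦⟧-∧ true  c = refl
  ⟦⟧-∧ false c = refl

  column : (𝓕 : List (Subset n)) → Fin n → Subset (length 𝓕)
  column []      x = []
  column (F ∷ 𝓕) x = lookup F x ∷ column 𝓕 x

  columns : (𝓕 : List (Subset n)) → List (Subset (length 𝓕))
  columns 𝓕 = List.tabulate (column 𝓕)

  pick : {A : Set} (xs : List A) → Subset (length xs) → List A
  pick []       []            = []
  pick (x ∷ xs) (outside ∷ I) = pick xs I
  pick (x ∷ xs) (inside  ∷ I) = x ∷ pick xs I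

  module _ {A : Set} where

    length-pick : ∀ (xs : List A) I → length (pick xs I) ≡ ∣ I ∣
    length-pick []       []            = refl
    length-pick (x ∷ xs) (outside ∷ I) = length-pick xs I
    length-pick (x ∷ xs) (inside  ∷ I) = cong suc (length-pick xs I)

    pick-All : ∀ {Q : A → Set} {xs : List A} I → All Q xs → All Q (pick xs I)
    pick-All []            []       = []
    pick-All (outside ∷ I) (_ ∷ qs) = pick-All I qs
    pick-All (inside  ∷ I) (q ∷ qs) = q ∷ pick-All I qs

    pick-Unique : ∀ {xs : List A} I → Unique xs → Unique (pick xs I)
    pick-Unique []            []           = []
    pick-Unique (outside ∷ I) (_ ∷ xs!)    = pick-Unique I xs!
    pick-Unique (inside  ∷ I) (x∉xs ∷ xs!) = pick-All I x∉xs ∷ pick-Unique I xs!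

  lookup-⋂-pick : ∀ (𝓕 : List (Subset n)) I x → ⟦ lookup (⋂ (pick 𝓕 I)) x ⟧ ≡ sub I (column 𝓕 x)
  lookup-⋂-pick []      []            x = cong ⟦_⟧ (Vec.lookup-replicate x true)
  lookup-⋂-pick (F ∷ 𝓕) (outside ∷ I) x = lookup-⋂-pick 𝓕 I x
  lookup-⋂-pick (F ∷ 𝓕) (inside  ∷ I) x = begin
    ⟦ lookup (⋂ (F ∷ pick 𝓕 I)) x ⟧                ≡⟨ cong ⟦_⟧ (Vec.lookup-zipWith _∧_ x F _) ⟩
    ⟦ lookup F x ∧ lookup (⋂ (pick 𝓕 I)) x ⟧       ≡⟨ ⟦⟧-∧ (lookup F x) _ ⟩
    ⟦ lookup F x ⟧ * ⟦ lookup (⋂ (pick 𝓕 I)) x ⟧   ≡⟨ cong (⟦ lookup F x ⟧ *_) (lookup-⋂-pick 𝓕 I x) ⟩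
    ⟦ lookup F x ⟧ * sub I (column 𝓕 x)            ∎
    where open ≡-Reasoning

  -- A point lies in all the picked members exactly when its column contains I, so both sides count
  -- the same points. The sequence s is an extension of α to all of ℕ, to which `∂` can be applied;
  -- it describes the town only at the positions 1, ..., k.
  town-moments : ∀ {α : Vec 𝔽₂ k} {𝓕 : List (Subset n)} → Unique 𝓕 → IsTown α 𝓕 →
    ∀ s → (∀ i → lookup α i ≡ s (suc (toℕ i))) →
    ∀ I → 0 < ∣ I ∣ → ∣ I ∣ ≤ k → ∑ (columns 𝓕) (sub I) ≡ s ∣ I ∣
  town-moments {k} {α = α} {𝓕} 𝓕! town s α≡s I I>0 I≤k = go ∣ I ∣ refl I>0 I≤k
    where
    open ≡-Reasoning
    go : ∀ j → ∣ I ∣ ≡ j → 0 < j → j ≤ k → ∑ (columns 𝓕) (sub I) ≡ s j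
    go (suc j) I≡ _ j<k = begin
      ∑ (columns 𝓕) (sub I)                    ≡⟨ ∑-tabulate (column 𝓕) (sub I) ⟩
      sum (sub I ∘ column 𝓕)                   ≡⟨ sum-cong-≗ (lookup-⋂-pick 𝓕 I) ⟨
      sum (λ x → ⟦ lookup (⋂ (pick 𝓕 I)) x ⟧)  ≡⟨ parity-∣∣ (⋂ (pick 𝓕 I)) ⟨
      parity ∣ ⋂ (pick 𝓕 I) ∣                  ≡⟨ town (fromℕ< j<k) (pick 𝓕 I)
                                                    (trans (length-pick 𝓕 I) (trans I≡ (cong suc (sym toℕ≡))))
                                                    (pick-Unique I 𝓕!) (pick-All I (All.tabulate λ F∈ → F∈)) ⟩
      lookup α (fromℕ< j<k)                    ≡⟨ α≡s (fromℕ< j<k) ⟩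
      s (suc (toℕ (fromℕ< j<k)))               ≡⟨ cong (s ∘ suc) toℕ≡ ⟩
      s (suc j)                                ∎
      where
      toℕ≡ : toℕ (fromℕ< j<k) ≡ j
      toℕ≡ = Fin.toℕ-fromℕ< j<k

-- Canonical decompositions under iterated `∂`

module Levels where

  open import Data.Parity.Base using (_+_; _*_)
  open import Data.Nat.Base using (_≤_; _<_)
  open Sums
  open Moments

  private
    variable
      k : ℕ

  -- The part of a canonical decomposition up to a given level. The coefficients are indexed from 0,
  -- so `c 0` belongs to γ^1, the only vector of level 0, and the two coefficients in the second
  -- clause to γ^{2u+2} and γ^{2u+3}.
  levelSum : (ℕ → 𝔽₂) → ℕ → ℕ → 𝔽₂
  levelSum c zero    j = c 0 * γᵒᵈᵈ 1 j
  levelSum c (suc u) j = levelSum c u j +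
    ((c (suc (u ℕ.+ u)) * γᵉᵛᵉⁿ (suc u) j) + (c (suc (suc (u ℕ.+ u))) * γᵒᵈᵈ (suc (suc u)) j))

  sum-last : ∀ n (h : ℕ → 𝔽₂) → sum {suc n} (h ∘ toℕ) ≡ sum {n} (h ∘ toℕ) + h n
  sum-last zero    h = ℙ.+-identityʳ (h 0)
  sum-last (suc n) h = trans (cong (h 0 +_) (sum-last n (h ∘ suc))) (sym (ℙ.+-assoc (h 0) _ _))

  sum-vanishing : ∀ a d (h : ℕ → 𝔽₂) → (∀ i → a ≤ i → h i ≡ 0ℙ) →
                  sum {a ℕ.+ d} (h ∘ toℕ) ≡ sum {a} (h ∘ toℕ)
  sum-vanishing zero    d h h≡0 = trans (sum-cong-≗ {d} λ i → h≡0 (toℕ i) z≤n) (sum-replicate-zero d)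
  sum-vanishing (suc a) d h h≡0 =
    cong (h 0 +_) (sum-vanishing a d (h ∘ suc) λ i a≤i → h≡0 (suc i) (s≤s a≤i))

  sum≡levelSum : ∀ c u j → sum {suc (u ℕ.+ u)} (λ i → c (toℕ i) * γ (suc (toℕ i)) j) ≡ levelSum c u j
  sum≡levelSum c zero    j = ℙ.+-identityʳ _
  sum≡levelSum c (suc u) j rewrite ℕ.+-suc u u = begin
    sum {suc (suc (suc (u ℕ.+ u)))} (h ∘ toℕ)
      ≡⟨ trans (sum-last (suc (suc (u ℕ.+ u))) h)
               (cong (_+ h (suc (suc (u ℕ.+ u)))) (sum-last (suc (u ℕ.+ u)) h)) ⟩
    sum {suc (u ℕ.+ u)} (h ∘ toℕ) + h (suc (u ℕ.+ u)) + h (suc (suc (u ℕ.+ u)))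
      ≡⟨ ℙ.+-assoc (sum {suc (u ℕ.+ u)} (h ∘ toℕ)) _ _ ⟩
    sum {suc (u ℕ.+ u)} (h ∘ toℕ) + (h (suc (u ℕ.+ u)) + h (suc (suc (u ℕ.+ u))))
      ≡⟨ cong₂ _+_ (sum≡levelSum c u j) (cong₂ _+_
           (cong (c (suc (u ℕ.+ u)) *_) (trans (cong (λ i → γ (suc i) j) (sym (ℕ.+-suc u u))) (γ-even u j)))
           (cong (c (suc (suc (u ℕ.+ u))) *_)
             (trans (cong (λ i → γ (suc (suc i)) j) (sym (ℕ.+-suc u u))) (γ-odd (suc u) j)))) ⟩
    levelSum c (suc u) j ∎
    where
    open ≡-Reasoning
    h : ℕ → 𝔽₂
    h i = c i * γ (suc i) j

  sequence-beyond : (v : Vec 𝔽₂ k) → ∀ i → k ≤ i → sequence v i ≡ 0ℙ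
  sequence-beyond []      i       _         = refl
  sequence-beyond (x ∷ v) (suc i) (s≤s k≤i) = sequence-beyond v i k≤i

  sequence-1⇒< : (v : Vec 𝔽₂ k) → ∀ i → sequence v i ≡ 1ℙ → i < k
  sequence-1⇒< v i eq = ℕ.≰⇒> λ k≤i → 0≢1 (trans (sym (sequence-beyond v i k≤i)) eq)
    where
    0≢1 : 0ℙ ≢ 1ℙ
    0≢1 ()

  ≢1⇒≡0 : ∀ {p} → p ≢ 1ℙ → p ≡ 0ℙ
  ≢1⇒≡0 {0ℙ} _   = refl
  ≢1⇒≡0 {1ℙ} p≢1 = ⊥-elim (p≢1 refl)

  coefficient : Vec 𝔽₂ k → ℕ → 𝔽₂
  coefficient α = sequence (coefficients α)

  coefficient-1⇒Appears : ∀ (α : Vec 𝔽₂ k) i → coefficient α i ≡ 1ℙ → Appears (suc i) α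
  coefficient-1⇒Appears α i eq = fromℕ< i<k , cong suc toℕ≡ ,
    trans (sym (sequence-toℕ (coefficients α) (fromℕ< i<k))) (trans (cong (coefficient α) toℕ≡) eq)
    where
    i<k = sequence-1⇒< (coefficients α) i eq
    toℕ≡ = Fin.toℕ-fromℕ< i<k

  Appears⇒coefficient-1 : ∀ (α : Vec 𝔽₂ k) i → Appears (suc i) α → coefficient α i ≡ 1ℙ
  Appears⇒coefficient-1 α i (j , refl , eq) = trans (sequence-toℕ (coefficients α) j) eq

  ⌊/2⌋-cancel-≤ : ∀ i t → ⌊ suc i /2⌋ ≤ t → i ≤ t ℕ.+ t
  ⌊/2⌋-cancel-≤ zero          t       _       = z≤n
  ⌊/2⌋-cancel-≤ (suc zero)    (suc t) (s≤s l) = s≤s z≤n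
  ⌊/2⌋-cancel-≤ (suc (suc i)) (suc t) (s≤s l) rewrite ℕ.+-suc t t = s≤s (s≤s (⌊/2⌋-cancel-≤ i t l))

  coefficient-beyond-level : ∀ (α : Vec 𝔽₂ k) i → suc (lv α ℕ.+ lv α) ≤ i → coefficient α i ≡ 0ℙ
  coefficient-beyond-level {k} α i i> = ≢1⇒≡0 λ eq →
    let j , 1+j≡1+i , eq′ = coefficient-1⇒Appears α i eq
        j∈ = ∈-map⁺ (λ i → ⌊ suc (toℕ i) /2⌋)
               (∈-filter⁺ (λ i → lookup (coefficients α) i ℙ.≟ 1ℙ) (∈-allFin j) eq′)
        j≤lv = All.lookup (xs≤max 0 _) j∈
    in ℕ.<⇒≱ i> (subst (_≤ lv α ℕ.+ lv α) (ℕ.suc-injective 1+j≡1+i) (⌊/2⌋-cancel-≤ (toℕ j) (lv α) j≤lv))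

  lookup≡levelSum : ∀ (α : Vec 𝔽₂ k) i → lookup α i ≡ levelSum (coefficient α) (lv α) (suc (toℕ i))
  lookup≡levelSum {k} α i = begin
    lookup α i
      ≡⟨ cong (λ β → lookup β i) (proj₁ (proj₂ (canonicalDecomposition α))) ⟨
    lookup (combine (coefficients α)) i
      ≡⟨ Vec.lookup∘tabulate _ i ⟩
    sum {k} (λ j → lookup (coefficients α) j * γ (suc (toℕ j)) (suc (toℕ i)))
      ≡⟨ sum-cong-≗ (λ j → cong (_* γ (suc (toℕ j)) (suc (toℕ i))) (sequence-toℕ (coefficients α) j)) ⟨
    sum {k} (h ∘ toℕ)
      -- Either of k and `b` can be the larger one, so both sums are compared with the one of k + b
      -- terms: coefficients vanish from k on by padding, and from `b` on by the definition of the
      -- level.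
      ≡⟨ sum-vanishing k b h (λ j k≤j → cong (_* γ (suc j) (suc (toℕ i))) (sequence-beyond (coefficients α) j k≤j)) ⟨
    sum {k ℕ.+ b} (h ∘ toℕ)
      ≡⟨ cong (λ n → sum {n} (h ∘ toℕ)) (ℕ.+-comm k b) ⟩
    sum {b ℕ.+ k} (h ∘ toℕ)
      ≡⟨ sum-vanishing b k h (λ j b≤j → cong (_* γ (suc j) (suc (toℕ i))) (coefficient-beyond-level α j b≤j)) ⟩
    sum {b} (h ∘ toℕ)
      ≡⟨ sum≡levelSum (coefficient α) (lv α) (suc (toℕ i)) ⟩
    levelSum (coefficient α) (lv α) (suc (toℕ i)) ∎
    where
    open ≡-Reasoning
    b = suc (lv α ℕ.+ lv α)
    h : ℕ → 𝔽₂
    h j = coefficient α j * γ (suc j) (suc (toℕ i))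

  module _ (α : Vec 𝔽₂ k) (u : ℕ) (level : lv α ≡ suc u) where
    private
      evenCoefficient oddCoefficient : 𝔽₂
      evenCoefficient = coefficient α (suc (u ℕ.+ u))
      oddCoefficient  = coefficient α (suc (suc (u ℕ.+ u)))

      2*level : 2 ℕ.* lv α ≡ suc (suc (u ℕ.+ u))
      2*level rewrite level | ℕ.+-identityʳ u = cong suc (ℕ.+-suc u u)

      present : ∀ i {m} → m ≡ suc i → Appears m α → coefficient α i ≡ 1ℙ
      present i refl = Appears⇒coefficient-1 α i

      absent : ∀ i {m} → m ≡ suc i → ¬ Appears m α → coefficient α i ≡ 0ℙ
      absent i refl ¬a = ≢1⇒≡0 (¬a ∘ coefficient-1⇒Appears α i)

    grade-1 : grd α ≡ 1 → (evenCoefficient ≡ 1ℙ × oddCoefficient ≡ 0ℙ) ⊎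
                          (evenCoefficient ≡ 0ℙ × oddCoefficient ≡ 1ℙ)
    grade-1 grade with appears? (2 ℕ.* lv α) α | appears? (suc (2 ℕ.* lv α)) α
    ... | yes e | no o  = inj₁ (present _ 2*level e , absent _ (cong suc 2*level) o)
    ... | no e  | yes o = inj₂ (absent _ 2*level e , present _ (cong suc 2*level) o)

    grade-2 : grd α ≡ 2 → evenCoefficient ≡ 1ℙ × oddCoefficient ≡ 1ℙ
    grade-2 grade with appears? (2 ℕ.* lv α) α | appears? (suc (2 ℕ.* lv α)) α
    ... | yes e | yes o = present _ 2*level e , present _ (cong suc 2*level) o
    grade-2 ()    | yes _ | no _
    grade-2 ()    | no _  | yes _
    grade-2 ()    | no _  | no _

  power-cancel : ∀ a m r j → power (a ℕ.+ m) (a ℕ.+ r) j ≡ power m r j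
  power-cancel zero    m r j = refl
  power-cancel (suc a) m r j = power-cancel a m r j

  ∂^-cong : ∀ a {r s} → (∀ j → r j ≡ s j) → ∀ j → ∂^ a r j ≡ ∂^ a s j
  ∂^-cong zero    r≗s j = r≗s j
  ∂^-cong (suc a) r≗s j = cong₂ _+_ (∂^-cong a r≗s j) (∂^-cong a r≗s (suc j))

  ∂^-* : ∀ a c s j → ∂^ a (λ i → c * s i) j ≡ c * ∂^ a s j
  ∂^-* zero    c s j = refl
  ∂^-* (suc a) c s j = trans (cong₂ _+_ (∂^-* a c s j) (∂^-* a c s (suc j))) (sym (ℙ.*-distribˡ-+ c _ _))

  -- Each `∂` multiplies by 1 + x, by `power-suc`, and also moves the index up by one.
  ∂^-power : ∀ a m r j → ∂^ a (power m r) j ≡ power m (a ℕ.+ r) (a ℕ.+ j)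
  ∂^-power zero    m r j = refl
  ∂^-power (suc a) m r j = begin
    ∂^ a (power m r) j + ∂^ a (power m r) (suc j)
      ≡⟨ cong₂ _+_ (∂^-power a m r j) (∂^-power a m r (suc j)) ⟩
    power m (a ℕ.+ r) (a ℕ.+ j) + power m (a ℕ.+ r) (a ℕ.+ suc j)
      ≡⟨ cong (λ i → power m (a ℕ.+ r) (a ℕ.+ j) + power m (a ℕ.+ r) i) (ℕ.+-suc a j) ⟩
    power m (a ℕ.+ r) (a ℕ.+ j) + power m (a ℕ.+ r) (suc (a ℕ.+ j))
      ≡⟨ ℙ.+-comm (power m (a ℕ.+ r) (a ℕ.+ j)) _ ⟩
    power m (a ℕ.+ r) (suc (a ℕ.+ j)) + power m (a ℕ.+ r) (a ℕ.+ j)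
      ≡⟨ power-suc m (a ℕ.+ r) (a ℕ.+ j) ⟩
    power m (suc (a ℕ.+ r)) (suc (a ℕ.+ j)) ∎
    where open ≡-Reasoning

  ∂^-even : ∀ a i b → ∂^ a (γᵉᵛᵉⁿ (suc i)) (suc b) ≡ parity ((a ℕ.+ i) C (a ℕ.+ b))
  ∂^-even a i b = trans (sym (∂^-suc a (γᵉᵛᵉⁿ (suc i)) b)) (∂^-power a 0 i b)

  γᵒᵈᵈ≡power : ∀ i j → γᵒᵈᵈ (suc i) (suc j) ≡ power (suc i) 0 j
  γᵒᵈᵈ≡power i j = cong (λ a → parity ((a ℕ.∸ 1) C j)) (ℕ.+-suc i j)

  ∂^-odd : ∀ a i b → ∂^ a (γᵒᵈᵈ (suc i)) (suc b) ≡ power (suc i) a (a ℕ.+ b)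
  ∂^-odd a i b = begin
    ∂^ a (γᵒᵈᵈ (suc i)) (suc b)          ≡⟨ ∂^-suc a (γᵒᵈᵈ (suc i)) b ⟨
    ∂^ a (γᵒᵈᵈ (suc i) ∘ suc) b          ≡⟨ ∂^-cong a (γᵒᵈᵈ≡power i) b ⟩
    ∂^ a (power (suc i) 0) b             ≡⟨ ∂^-power a (suc i) 0 b ⟩
    power (suc i) (a ℕ.+ 0) (a ℕ.+ b)    ≡⟨ cong (λ r → power (suc i) r (a ℕ.+ b)) (ℕ.+-identityʳ a) ⟩
    power (suc i) a (a ℕ.+ b)            ∎
    where open ≡-Reasoning

  C-vanishes : ∀ {n j} → n < j → parity (n C j) ≡ 0ℙ
  C-vanishes n<j = cong parity (k>n⇒nCk≡0 n<j)

  -- (1+x)^(a-i-1) is a polynomial of degree less than a, and its coefficient of index a + b is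
  -- read.
  ∂^-odd-vanishes : ∀ a i b → suc i ≤ a → ∂^ a (γᵒᵈᵈ (suc i)) (suc b) ≡ 0ℙ
  ∂^-odd-vanishes a i b i<a = begin
    ∂^ a (γᵒᵈᵈ (suc i)) (suc b)                       ≡⟨ ∂^-odd a i b ⟩
    power (suc i) a (a ℕ.+ b)                         ≡⟨ cong₂ (λ m r → power m r (a ℕ.+ b))
                                                           (sym (ℕ.+-identityʳ (suc i))) (sym (ℕ.m+[n∸m]≡n i<a)) ⟩
    power (suc i ℕ.+ 0) (suc i ℕ.+ (a ℕ.∸ suc i)) (a ℕ.+ b)  ≡⟨ power-cancel (suc i) 0 (a ℕ.∸ suc i) (a ℕ.+ b) ⟩
    parity ((a ℕ.∸ suc i) C (a ℕ.+ b))                ≡⟨ C-vanishes (ℕ.≤-trans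
                                                           (ℕ.∸-monoʳ-< (s≤s z≤n) i<a) (ℕ.m≤m+n a b)) ⟩
    0ℙ                                                ∎
    where open ≡-Reasoning

  private
    zeros : ∀ {p q} c d → p ≡ 0ℙ → q ≡ 0ℙ → c * p + (d * q) ≡ 0ℙ
    zeros c d refl refl = cong₂ _+_ (ℙ.*-zeroʳ c) (ℙ.*-zeroʳ d)

  ∂^-layer : ∀ a c u b → ∂^ a (levelSum c (suc u)) (suc b) ≡ ∂^ a (levelSum c u) (suc b) +
    ((c (suc (u ℕ.+ u)) * parity ((a ℕ.+ u) C (a ℕ.+ b))) +
     (c (suc (suc (u ℕ.+ u))) * ∂^ a (γᵒᵈᵈ (suc (suc u))) (suc b)))
  ∂^-layer a c u b = trans (∂^-+ a (levelSum c u) _ (suc b)) (cong (∂^ a (levelSum c u) (suc b) +_)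
    (trans (∂^-+ a (λ j → c (suc (u ℕ.+ u)) * γᵉᵛᵉⁿ (suc u) j) _ (suc b)) (cong₂ _+_
      (trans (∂^-* a (c (suc (u ℕ.+ u))) (γᵉᵛᵉⁿ (suc u)) (suc b))
             (cong (c (suc (u ℕ.+ u)) *_) (∂^-even a u b)))
      (∂^-* a (c (suc (suc (u ℕ.+ u)))) (γᵒᵈᵈ (suc (suc u))) (suc b)))))

  -- By degree: multiplication by (1+x)^a makes every vector of level at most u a polynomial of
  -- degree at most a+u-1, and the index a + b lies above that.
  ∂^-levelSum-vanishes : ∀ c u a b → suc u ≤ a → u ≤ b → ∂^ a (levelSum c u) (suc b) ≡ 0ℙ
  ∂^-levelSum-vanishes c zero    a b u<a u≤b = trans (∂^-* a (c 0) (γᵒᵈᵈ 1) (suc b))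
    (trans (cong (c 0 *_) (∂^-odd-vanishes a 0 b u<a)) (ℙ.*-zeroʳ (c 0)))
  ∂^-levelSum-vanishes c (suc u) a b u<a u≤b = trans (∂^-layer a c u b) (cong₂ _+_
    (∂^-levelSum-vanishes c u a b (ℕ.<⇒≤ u<a) (ℕ.<⇒≤ u≤b))
    (zeros (c (suc (u ℕ.+ u))) (c (suc (suc (u ℕ.+ u)))) (C-vanishes (ℕ.+-monoʳ-< a u≤b)) (∂^-odd-vanishes a (suc u) b u<a)))

  ∂^-top : ∀ c u a b {x y} → suc u ≤ a → u ≤ b → parity ((a ℕ.+ u) C (a ℕ.+ b)) ≡ x →
    ∂^ a (γᵒᵈᵈ (suc (suc u))) (suc b) ≡ y →
    ∂^ a (levelSum c (suc u)) (suc b) ≡ (c (suc (u ℕ.+ u)) * x) + (c (suc (suc (u ℕ.+ u))) * y)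
  ∂^-top c u a b u<a u≤b refl refl = trans (∂^-layer a c u b)
    (cong (_+ ((c (suc (u ℕ.+ u)) * parity ((a ℕ.+ u) C (a ℕ.+ b))) +
      (c (suc (suc (u ℕ.+ u))) * ∂^ a (γᵒᵈᵈ (suc (suc u))) (suc b)))) (∂^-levelSum-vanishes c u a b u<a u≤b))

  private
    nCn-odd : ∀ n → parity (n C n) ≡ 1ℙ
    nCn-odd n = cong parity (nCn≡1 n)

    -- (1+x)^(u+1) cancels (1+x)^(-u-2) down to (1+x)^(-1), the all-one sequence.
    odd-top : ∀ u b → ∂^ (suc u) (γᵒᵈᵈ (suc (suc u))) (suc b) ≡ 1ℙ
    odd-top u b = trans (∂^-odd (suc u) (suc u) b) (trans
      (cong₂ (λ m r → power m r (suc u ℕ.+ b)) (sym (ℕ.+-comm (suc u) 1)) (sym (ℕ.+-identityʳ (suc u))))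
      (trans (power-cancel (suc u) 1 0 (suc u ℕ.+ b)) (nCn-odd (suc u ℕ.+ b))))

    *1+*1 : ∀ p q → p * 1ℙ + (q * 1ℙ) ≡ p + q
    *1+*1 p q = cong₂ _+_ (ℙ.*-identityʳ p) (ℙ.*-identityʳ q)

    *0+*1 : ∀ p q → p * 0ℙ + (q * 1ℙ) ≡ q
    *0+*1 p q = cong₂ _+_ (ℙ.*-zeroʳ p) (ℙ.*-identityʳ q)

    *1+*0 : ∀ p q → p * 1ℙ + (q * 0ℙ) ≡ p
    *1+*0 p q = trans (cong₂ _+_ (ℙ.*-identityʳ p) (ℙ.*-zeroʳ q)) (ℙ.+-identityʳ p)

  ∂^-levelSum-balanced : ∀ c u → ∂^ (suc u) (levelSum c (suc u)) (suc u) ≡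
                                 c (suc (u ℕ.+ u)) + c (suc (suc (u ℕ.+ u)))
  ∂^-levelSum-balanced c u = trans
    (∂^-top c u (suc u) u ℕ.≤-refl ℕ.≤-refl (nCn-odd (suc u ℕ.+ u)) (odd-top u u))
    (*1+*1 (c (suc (u ℕ.+ u))) (c (suc (suc (u ℕ.+ u)))))

  ∂^-levelSum-odd : ∀ c u → ∂^ (suc u) (levelSum c (suc u)) (suc (suc u)) ≡ c (suc (suc (u ℕ.+ u)))
  ∂^-levelSum-odd c u = trans
    (∂^-top c u (suc u) (suc u) ℕ.≤-refl (ℕ.n≤1+n u)
      (C-vanishes (ℕ.+-monoʳ-< (suc u) (ℕ.n<1+n u))) (odd-top u (suc u)))
    (*0+*1 (c (suc (u ℕ.+ u))) _)

  ∂^-levelSum-even : ∀ c u → ∂^ (suc (suc u)) (levelSum c (suc u)) (suc u) ≡ c (suc (u ℕ.+ u))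
  ∂^-levelSum-even c u = trans
    (∂^-top c u (suc (suc u)) u (ℕ.n≤1+n (suc u)) ℕ.≤-refl
      (nCn-odd (suc (suc u) ℕ.+ u)) (∂^-odd-vanishes (suc (suc u)) (suc u) u ℕ.≤-refl))
    (*1+*0 (c (suc (u ℕ.+ u))) _)

-- Upper bounds at positive level

module UpperBound where

  open import Data.Nat.Base using (_+_; _*_; _^_; _≤_; _<_)
  open import Data.Nat.Properties
  open Sums
  open DisjointnessMatrix
  open Moments
  open Levels

  -- The rule (t+1) binom(m, t+1) = (m-t) binom(m, t), with t moved to the left to avoid truncated
  -- subtraction. Multiplied by t!, it becomes the recurrence of the falling factorial.
  absorption : ∀ m t → suc t * (m C suc t) + t * (m C t) ≡ m * (m C t)
  absorption zero    zero    = refl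
  absorption zero    (suc t) = cong₂ _+_ (*-zeroʳ (suc (suc t))) (*-zeroʳ (suc t))
  absorption (suc m) zero    = trans (+-identityʳ _) (trans (*-identityˡ _) (trans (nC1≡n (suc m)) (sym (*-identityʳ (suc m)))))
  absorption (suc m) (suc t) = begin
    suc (suc t) * (suc m C suc (suc t)) + suc t * (suc m C suc t)
      ≡⟨ cong₂ (λ a b → suc (suc t) * a + suc t * b)
           (sym (nCk+nC[k+1]≡[n+1]C[k+1] m (suc t))) (sym (nCk+nC[k+1]≡[n+1]C[k+1] m t)) ⟩
    suc (suc t) * (q + r) + suc t * (p + q)
      ≡⟨ regroup t p q r ⟩
    suc (suc t) * r + suc t * q + (suc t * q + t * p) + (p + q)
      ≡⟨ cong₂ (λ a b → a + b + (p + q)) (absorption m (suc t)) (absorption m t) ⟩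
    m * q + m * p + (p + q)
      ≡⟨ collect m p q ⟩
    suc m * (p + q)
      ≡⟨ cong (suc m *_) (nCk+nC[k+1]≡[n+1]C[k+1] m t) ⟩
    suc m * (suc m C suc t) ∎
    where
    open ≡-Reasoning
    p = m C t
    q = m C suc t
    r = m C suc (suc t)
    regroup : ∀ t p q r → suc (suc t) * (q + r) + suc t * (p + q) ≡
                          suc (suc t) * r + suc t * q + (suc t * q + t * p) + (p + q)
    regroup = solve-∀
    collect : ∀ m p q → m * q + m * p + (p + q) ≡ suc m * (p + q)
    collect = solve-∀

  !*C-suc : ∀ m t → suc t ! * (m C suc t) + t * (t ! * (m C t)) ≡ m * (t ! * (m C t))
  !*C-suc m t = begin
    suc t ! * (m C suc t) + t * (t ! * (m C t))    ≡⟨ factor t (t !) (m C suc t) (m C t) ⟩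
    t ! * (suc t * (m C suc t) + t * (m C t))      ≡⟨ cong (t ! *_) (absorption m t) ⟩
    t ! * (m * (m C t))                            ≡⟨ swap (t !) m (m C t) ⟩
    m * (t ! * (m C t))                            ∎
    where
    open ≡-Reasoning
    factor : ∀ t a x y → suc t * a * x + t * (a * y) ≡ a * (suc t * x + t * y)
    factor = solve-∀
    swap : ∀ a m x → a * (m * x) ≡ m * (a * x)
    swap = solve-∀

  !*C≤^ : ∀ m t → t ! * (m C t) ≤ m ^ t
  !*C≤^ m zero    = ≤-refl
  !*C≤^ m (suc t) = begin
    suc t ! * (m C suc t)                          ≤⟨ m≤m+n _ _ ⟩
    suc t ! * (m C suc t) + t * (t ! * (m C t))    ≡⟨ !*C-suc m t ⟩
    m * (t ! * (m C t))                            ≤⟨ *-monoʳ-≤ m (!*C≤^ m t) ⟩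
    m * m ^ t                                      ∎
    where open ≤-Reasoning

  -- The power exceeds the falling factorial by at most binom(u+1, 2) m^u; u * u is a coarser
  -- constant that avoids the division by 2.
  ^≤!*C : ∀ m u → m ^ suc u ≤ suc u ! * (m C suc u) + u * u * m ^ u
  ^≤!*C m zero    = ≤-reflexive (trans (*-identityʳ m) (trans (sym (nC1≡n m)) (sym (trans (+-identityʳ _) (+-identityʳ _)))))
  ^≤!*C m (suc u) = begin
    m * m ^ suc u                              ≤⟨ *-monoʳ-≤ m (^≤!*C m u) ⟩
    m * (G + u * u * m ^ u)                    ≡⟨ expand m G (u * u) (m ^ u) ⟩
    m * G + u * u * m ^ suc u                  ≡⟨ cong (_+ u * u * m ^ suc u) (!*C-suc m (suc u)) ⟨
    G′ + suc u * G + u * u * m ^ suc u         ≤⟨ +-monoˡ-≤ _ (+-monoʳ-≤ G′ (*-monoʳ-≤ (suc u) (!*C≤^ m (suc u)))) ⟩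
    -- The added u completes the square: u * u + suc u + u is suc u * suc u.
    G′ + suc u * m ^ suc u + u * u * m ^ suc u ≤⟨ m≤m+n _ (u * m ^ suc u) ⟩
    G′ + suc u * m ^ suc u + u * u * m ^ suc u + u * m ^ suc u ≡⟨ collect u G′ (m ^ suc u) ⟩
    G′ + suc u * suc u * m ^ suc u             ∎
    where
    open ≤-Reasoning
    G  = suc u ! * (m C suc u)
    G′ = suc (suc u) ! * (m C suc (suc u))
    expand : ∀ m g c x → m * (g + c * x) ≡ m * g + c * (m * x)
    expand = solve-∀
    collect : ∀ u g x → g + suc u * x + u * u * x + u * x ≡ g + suc u * suc u * x
    collect = solve-∀

  -- A mean value estimate, with the derivative of x^(u+1) taken at the right end of the interval.
  ^-shift : ∀ m d u → (m + d) ^ suc u ≤ m ^ suc u + suc u * d * (m + d) ^ u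
  ^-shift m d zero    = ≤-reflexive (base m d)
    where
    base : ∀ m d → (m + d) * 1 ≡ m * 1 + 1 * d * 1
    base = solve-∀
  ^-shift m d (suc u) = begin
    h * h ^ suc u                                          ≤⟨ *-monoʳ-≤ h (^-shift m d u) ⟩
    h * (m ^ suc u + suc u * d * h ^ u)                    ≡⟨ expand m d (m ^ suc u) (suc u * d) (h ^ u) ⟩
    m * m ^ suc u + d * m ^ suc u + suc u * d * (h * h ^ u)
      ≤⟨ +-monoˡ-≤ _ (+-monoʳ-≤ (m * m ^ suc u) (*-monoʳ-≤ d (^-monoˡ-≤ (suc u) (m≤m+n m d)))) ⟩
    m * m ^ suc u + d * h ^ suc u + suc u * d * h ^ suc u  ≡⟨ collect u d (m * m ^ suc u) (h ^ suc u) ⟩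
    m * m ^ suc u + suc (suc u) * d * h ^ suc u            ∎
    where
    open ≤-Reasoning
    h = m + d
    expand : ∀ m d x c y → (m + d) * (x + c * y) ≡ m * x + d * x + c * ((m + d) * y)
    expand = solve-∀
    collect : ∀ u d x y → x + d * y + suc u * d * y ≡ x + suc (suc u) * d * y
    collect = solve-∀

  power≤-of-C≤ : ∀ g m u n → g * (m C suc u) ≤ n + g * length (subsetsBelow m (suc u)) →
    g * m ^ suc u ≤ suc u ! * n + g * (suc u ! + u * u) * suc m ^ u
  power≤-of-C≤ g m u n bound = begin
    g * m ^ suc u                                      ≤⟨ *-monoʳ-≤ g (^≤!*C m u) ⟩
    g * (w * (m C suc u) + u * u * m ^ u)              ≡⟨ expand g w (m C suc u) (u * u) (m ^ u) ⟩
    w * (g * (m C suc u)) + g * (u * u) * m ^ u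
      ≤⟨ +-mono-≤ (*-monoʳ-≤ w (≤-trans bound (+-monoʳ-≤ n (*-monoʳ-≤ g (length-subsetsBelow m u)))))
                  (*-monoʳ-≤ (g * (u * u)) (^-monoˡ-≤ u (n≤1+n m))) ⟩
    w * (n + g * suc m ^ u) + g * (u * u) * suc m ^ u  ≡⟨ collect w n g (u * u) (suc m ^ u) ⟩
    w * n + g * (w + u * u) * suc m ^ u                ∎
    where
    open ≤-Reasoning
    w = suc u !
    expand : ∀ g w x c y → g * (w * x + c * y) ≡ w * (g * x) + g * c * y
    expand = solve-∀
    collect : ∀ w n g c y → w * (n + g * y) + g * c * y ≡ w * n + g * (w + c) * y
    collect = solve-∀

  module _ {k} (α : Vec 𝔽₂ k) (u : ℕ) (level : lv α ≡ suc u) where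
    private
      s : ℕ → 𝔽₂
      s = levelSum (coefficient α) (suc u)

      moments : ∀ {n} {𝓕 : List (Subset n)} → Unique 𝓕 → IsTown α 𝓕 → ∀ I → 0 < ∣ I ∣ → ∣ I ∣ ≤ k →
                ∑ (columns 𝓕) (sub I) ≡ s ∣ I ∣
      moments 𝓕! town = town-moments {α = α} 𝓕! town s
        (λ i → trans (lookup≡levelSum α i) (cong (λ t → levelSum (coefficient α) t (suc (toℕ i))) level))

      1≤size : ∀ {a} → suc u ≤ a → 0 < a
      1≤size = ≤-trans (s≤s z≤n)

      -- A canonical vector that appears has index at most k. This keeps the sizes up to 2t, or 2t+1
      -- for the split along a member, within the k sizes on which α imposes a condition.
      even<k : coefficient α (suc (u + u)) ≡ ℙ.1ℙ → suc u + suc u ≤ k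
      even<k eq = subst (_≤ k) (cong suc (sym (+-suc u u))) (sequence-1⇒< (coefficients α) _ eq)

      odd<k : coefficient α (suc (suc (u + u))) ≡ ℙ.1ℙ → suc (suc u + suc u) ≤ k
      odd<k eq = subst (_≤ k) (cong (λ a → suc (suc a)) (sym (+-suc u u))) (sequence-1⇒< (coefficients α) _ eq)

    town-C-bound-1 : grd α ≡ 1 → ∀ {n} (𝓕 : List (Subset n)) → Unique 𝓕 → IsTown α 𝓕 →
      1 * (length 𝓕 C suc u) ≤ n + 1 * length (subsetsBelow (length 𝓕) (suc u))
    town-C-bound-1 grade {n} 𝓕 𝓕! town = subst₂ _≤_ (sym (*-identityˡ _))
      (cong₂ _+_ (List.length-tabulate (column 𝓕)) (sym (*-identityˡ _)))
      (moment-bound (suc u) s (columns 𝓕)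
        (λ A l r → moments 𝓕! town A (1≤size l) (≤-trans r (2t≤k (grade-1 α u level grade))))
        (trans (∂^-levelSum-balanced (coefficient α) u) (sum≡1 (grade-1 α u level grade))))
      where
      2t≤k : ∀ {x y} → (coefficient α (suc (u + u)) ≡ ℙ.1ℙ × x) ⊎ (y × coefficient α (suc (suc (u + u))) ≡ ℙ.1ℙ) →
             suc u + suc u ≤ k
      2t≤k (inj₁ (e , _)) = even<k e
      2t≤k (inj₂ (_ , o)) = <⇒≤ (odd<k o)
      sum≡1 : ∀ {e o} → (e ≡ ℙ.1ℙ × o ≡ ℙ.0ℙ) ⊎ (e ≡ ℙ.0ℙ × o ≡ ℙ.1ℙ) → e ℙ.+ o ≡ ℙ.1ℙ
      sum≡1 (inj₁ (refl , refl)) = refl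
      sum≡1 (inj₂ (refl , refl)) = refl

    town-C-bound-2 : grd α ≡ 2 → ∀ {n} F (𝓕 : List (Subset n)) → Unique (F ∷ 𝓕) → IsTown α (F ∷ 𝓕) →
      2 * (length 𝓕 C suc u) ≤ n + 2 * length (subsetsBelow (length 𝓕) (suc u))
    town-C-bound-2 grade {n} F 𝓕 𝓕! town =
      let e , o = grade-2 α u level grade
      in subst (λ l → 2 * (length 𝓕 C suc u) ≤ l + 2 * length (subsetsBelow (length 𝓕) (suc u)))
           (List.length-tabulate (column (F ∷ 𝓕)))
           (double-moment-bound (suc u) s (columns (F ∷ 𝓕))
             (λ A l r → moments 𝓕! town A (1≤size l) (≤-trans r (odd<k o)))
             (trans (∂^-levelSum-odd (coefficient α) u) o)
             (trans (∂^-levelSum-even (coefficient α) u) e))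

    PowerBound : ℕ → Set
    PowerBound g = ∃ λ c → ∀ n →
      g * f α n ^ suc u ≤ suc u ! * n + c * suc (f α n) ^ u

    power-bound-1 : grd α ≡ 1 → PowerBound 1
    power-bound-1 grade = 1 * (suc u ! + u * u) , λ n →
      let (𝓕 , 𝓕! , town , len) , _ = proj₂ (maximumTownSize α n)
      in subst (λ m → 1 * m ^ suc u ≤ suc u ! * n + 1 * (suc u ! + u * u) * suc m ^ u) len
           (power≤-of-C≤ 1 (length 𝓕) u n (town-C-bound-1 grade 𝓕 𝓕! town))

    power-bound-2 : grd α ≡ 2 → PowerBound 2
    -- `K` bounds the error for the m members other than the fixed one, and `2 * suc u` pays for
    -- passing from m to m + 1.
    power-bound-2 grade = K + 2 * suc u , λ n →
      let (𝓕 , 𝓕! , town , len) , _ = proj₂ (maximumTownSize α n)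
      in subst (λ m → 2 * m ^ suc u ≤ w * n + (K + 2 * suc u) * suc m ^ u) len (bound n 𝓕 𝓕! town)
      where
      open ≤-Reasoning
      w = suc u !
      K = 2 * (w + u * u)
      collect : ∀ w v n c x → w * n + c * x + 2 * (v * 1 * x) ≡ w * n + (c + 2 * v) * x
      collect = solve-∀
      bound : ∀ n (𝓕 : List (Subset n)) → Unique 𝓕 → IsTown α 𝓕 →
              2 * length 𝓕 ^ suc u ≤ w * n + (K + 2 * suc u) * suc (length 𝓕) ^ u
      bound n []      _  _    = z≤n
      bound n (F ∷ 𝓕) 𝓕! town = begin
        2 * suc m ^ suc u
          ≡⟨ cong (λ a → 2 * a ^ suc u) (+-comm m 1) ⟨
        2 * (m + 1) ^ suc u
          ≤⟨ *-monoʳ-≤ 2 (^-shift m 1 u) ⟩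
        2 * (m ^ suc u + suc u * 1 * (m + 1) ^ u)
          ≡⟨ *-distribˡ-+ 2 (m ^ suc u) _ ⟩
        2 * m ^ suc u + 2 * (suc u * 1 * (m + 1) ^ u)
          ≤⟨ +-monoˡ-≤ _ (power≤-of-C≤ 2 m u n (town-C-bound-2 grade F 𝓕 𝓕! town)) ⟩
        w * n + K * suc m ^ u + 2 * (suc u * 1 * (m + 1) ^ u)
          ≡⟨ cong (λ a → w * n + K * suc m ^ u + 2 * (suc u * 1 * a ^ u)) (+-comm m 1) ⟩
        w * n + K * suc m ^ u + 2 * (suc u * 1 * suc m ^ u)
          ≡⟨ collect w (suc u) n K (suc m ^ u) ⟩
        w * n + (K + 2 * suc u) * suc m ^ u
          ≤⟨ +-monoʳ-≤ (w * n) (*-monoʳ-≤ (K + 2 * suc u) (^-monoˡ-≤ u (n≤1+n (suc m)))) ⟩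
        w * n + (K + 2 * suc u) * suc (suc m) ^ u ∎
        where m = length 𝓕

-- Towns from all t-subsets of [m] and their complements

module Construction where

  open import Data.Parity.Base using (_+_; _*_)
  open import Data.Nat.Base using (_≤_; _<_; _^_)
  open Sums
  open DisjointnessMatrix
  open Moments
  open Levels

  private
    variable
      k m n : ℕ

  C-pascal : ∀ a t → parity (suc a C suc t) ≡ parity (a C suc t) + parity (a C t)
  C-pascal a t = sym (power-suc 0 a t)

  -- (1 + x)^(2^p) = 1 + x^(2^p) over 𝔽₂.
  C-frobenius : ∀ p a t →
    parity ((2 ^ p ℕ.+ a) C (2 ^ p ℕ.+ t)) ≡ parity (a C (2 ^ p ℕ.+ t)) + parity (a C t)
  C-frobenius zero    a t = C-pascal a t
  C-frobenius (suc p) a t = begin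
    parity ((2 ^ suc p ℕ.+ a) C (2 ^ suc p ℕ.+ t))
      ≡⟨ cong₂ (λ x y → parity (x C y)) (double a) (double t) ⟩
    parity ((T ℕ.+ (T ℕ.+ a)) C (T ℕ.+ (T ℕ.+ t)))
      ≡⟨ C-frobenius p (T ℕ.+ a) (T ℕ.+ t) ⟩
    parity ((T ℕ.+ a) C (T ℕ.+ (T ℕ.+ t))) + parity ((T ℕ.+ a) C (T ℕ.+ t))
      ≡⟨ cong₂ _+_ (C-frobenius p a (T ℕ.+ t)) (C-frobenius p a t) ⟩
    x + y + (y + z)
      ≡⟨ telescope x y z ⟩
    x + z
      ≡⟨ cong (λ s → parity (a C s) + z) (double t) ⟨
    parity (a C (2 ^ suc p ℕ.+ t)) + z ∎
    where
    open ≡-Reasoning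
    T = 2 ^ p
    x = parity (a C (T ℕ.+ (T ℕ.+ t)))
    y = parity (a C (T ℕ.+ t))
    z = parity (a C t)
    double : ∀ b → 2 ^ suc p ℕ.+ b ≡ T ℕ.+ (T ℕ.+ b)
    double b = trans (cong (λ s → T ℕ.+ s ℕ.+ b) (ℕ.+-identityʳ T)) (ℕ.+-assoc T T b)
    telescope : ∀ x y z → x + y + (y + z) ≡ x + z
    telescope x y z = trans (ℙ.+-assoc x y (y + z)) (cong (x +_)
      (trans (sym (ℙ.+-assoc y y z)) (cong (_+ z) (ℙ.p+p≡0ℙ y))))

  -- (1+x)^(2^p) is 1 modulo x^(2^p), so it does not affect the coefficients of index t < 2^p.
  C-shift : ∀ p a t → t < 2 ^ p → parity ((2 ^ p ℕ.+ a) C t) ≡ parity (a C t)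
  C-shift zero    a zero    _ = refl
  C-shift zero    a (suc t) (s≤s ())
  C-shift (suc p) a t t<2T with t ℕ.<? 2 ^ p
  ... | yes t<T = trans (cong (λ x → parity (x C t))
          (trans (cong (λ s → T ℕ.+ s ℕ.+ a) (ℕ.+-identityʳ T)) (ℕ.+-assoc T T a)))
        (trans (C-shift p (T ℕ.+ a) t t<T) (C-shift p a t t<T))
    where T = 2 ^ p
  -- For T ≤ t < 2T each of the two shifts by T adds the same coefficient, and the two cancel.
  ... | no t≮T = subst (λ t → parity ((2 ^ suc p ℕ.+ a) C t) ≡ parity (a C t)) T+s≡t (begin
    parity ((2 ^ suc p ℕ.+ a) C (T ℕ.+ s))
      ≡⟨ cong (λ x → parity (x C (T ℕ.+ s)))
           (trans (cong (λ s → T ℕ.+ s ℕ.+ a) (ℕ.+-identityʳ T)) (ℕ.+-assoc T T a)) ⟩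
    parity ((T ℕ.+ (T ℕ.+ a)) C (T ℕ.+ s))
      ≡⟨ C-frobenius p (T ℕ.+ a) s ⟩
    parity ((T ℕ.+ a) C (T ℕ.+ s)) + parity ((T ℕ.+ a) C s)
      ≡⟨ cong₂ _+_ (C-frobenius p a s) (C-shift p a s s<T) ⟩
    x + z + z
      ≡⟨ trans (ℙ.+-assoc x z z) (trans (cong (x +_) (ℙ.p+p≡0ℙ z)) (ℙ.+-identityʳ x)) ⟩
    x ∎)
    where
    open ≡-Reasoning
    T = 2 ^ p
    s = t ℕ.∸ T
    x = parity (a C (T ℕ.+ s))
    z = parity (a C s)
    T+s≡t : T ℕ.+ s ≡ t
    T+s≡t = ℕ.m+[n∸m]≡n (ℕ.≮⇒≥ t≮T)
    s<T : s < T
    s<T = ℕ.+-cancelˡ-< T s T (subst₂ _<_ (sym T+s≡t) (cong (T ℕ.+_) (ℕ.+-identityʳ T)) t<2T)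

  C-periodic : ∀ p q a t → t < 2 ^ p → parity ((q ℕ.* 2 ^ p ℕ.+ a) C t) ≡ parity (a C t)
  C-periodic p zero    a t t<T = refl
  C-periodic p (suc q) a t t<T = trans
    (cong (λ x → parity (x C t)) (ℕ.+-assoc (2 ^ p) (q ℕ.* 2 ^ p) a))
    (trans (C-shift p (q ℕ.* 2 ^ p ℕ.+ a) t t<T) (C-periodic p q a t t<T))

  private
    -- The parity of binom(-j, t).
    negated : ℕ → ℕ → 𝔽₂
    negated zero    t = parity (0 C t)
    negated (suc j) t = parity ((t ℕ.+ j) C t)

    -- Pascal's rule for the upper arguments -j-1 and -j, rearranged; signs vanish modulo 2.
    negated-suc : ∀ j t → negated (suc j) (suc t) ≡ negated j (suc t) + negated (suc j) t
    negated-suc zero    t rewrite ℕ.+-identityʳ t = trans (C-pascal t t)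
      (cong (_+ parity (t C t)) (C-vanishes {t} {suc t} ℕ.≤-refl))
    negated-suc (suc j) t = trans (C-pascal (t ℕ.+ suc j) t)
      (cong (λ a → parity (a C suc t) + parity ((t ℕ.+ suc j) C t)) (ℕ.+-suc t j))

    -- Here l ≡ -j modulo 2^p. Pascal's rule raises l towards the multiple of 2^p, lowering j; at j
    -- = 0 periodicity applies.
    C-negated : ∀ p q j l t → l ℕ.+ j ≡ q ℕ.* 2 ^ p → t < 2 ^ p → parity (l C t) ≡ negated j t
    C-negated p q zero    l t l≡ t<T = trans
      (cong (λ a → parity (a C t)) (trans (sym (ℕ.+-identityʳ l)) (trans l≡ (sym (ℕ.+-identityʳ _)))))
      (C-periodic p q 0 t t<T)
    C-negated p q (suc j) l zero    l≡ t<T = refl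
    C-negated p q (suc j) l (suc t) l≡ t<T = begin
      parity (l C suc t)
        ≡⟨ trans (cong (x +_) (ℙ.p+p≡0ℙ y)) (ℙ.+-identityʳ x) ⟨
      x + (y + y)
        ≡⟨ ℙ.+-assoc x y y ⟨
      x + y + y
        ≡⟨ cong (_+ y) (C-pascal l t) ⟨
      parity (suc l C suc t) + y
        ≡⟨ cong₂ _+_ (C-negated p q j (suc l) (suc t) (trans (sym (ℕ.+-suc l j)) l≡) t<T)
                     (C-negated p q (suc j) l t l≡ (ℕ.<-trans (ℕ.n<1+n t) t<T)) ⟩
      negated j (suc t) + negated (suc j) t
        ≡⟨ negated-suc j t ⟨
      negated (suc j) (suc t) ∎
      where
      open ≡-Reasoning
      x = parity (l C suc t)
      y = parity (l C t)

  C-symmetric : ∀ t j → (t ℕ.+ j) C t ≡ (t ℕ.+ j) C j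
  C-symmetric t j = trans (nCk≡nC[n∸k] (ℕ.m≤m+n t j)) (cong ((t ℕ.+ j) C_) (ℕ.m+n∸m≡n t j))

  -- Here l ≡ -(j+1) modulo 2^p, and binom(-(j+1), t) = ± binom(t+j, j).
  C-reflect : ∀ p q j l t → l ℕ.+ suc j ≡ q ℕ.* 2 ^ p → t < 2 ^ p →
              parity (l C t) ≡ parity ((t ℕ.+ j) C j)
  C-reflect p q j l t l≡ t<T = trans (C-negated p q (suc j) l t l≡ t<T) (cong parity (C-symmetric t j))

  ∣∁∣+∣∣ : (I : Subset m) → ∣ ∁ I ∣ ℕ.+ ∣ I ∣ ≡ m
  ∣∁∣+∣∣ []            = refl
  ∣∁∣+∣∣ (outside ∷ I) = cong suc (∣∁∣+∣∣ I)
  ∣∁∣+∣∣ (inside  ∷ I) = trans (ℕ.+-suc _ _) (cong suc (∣∁∣+∣∣ I))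

  ∑-subsetsOfSize : ∀ m t (g : Subset (suc m) → 𝔽₂) → ∑ (subsetsOfSize (suc m) (suc t)) g ≡
    ∑ (subsetsOfSize m (suc t)) (g ∘ (outside ∷_)) + ∑ (subsetsOfSize m t) (g ∘ (inside ∷_))
  ∑-subsetsOfSize m t = ∑-map-++-map (outside ∷_) (inside ∷_) (subsetsOfSize m (suc t)) (subsetsOfSize m t)

  supersets-none : ∀ t (I : Subset m) → t < ∣ I ∣ → ∑ (subsetsOfSize m t) (sub I) ≡ 0ℙ
  supersets-none zero    (outside ∷ I) t<I       = supersets-none zero I t<I
  supersets-none zero    (inside  ∷ I) t<I       = refl
  supersets-none {suc m} (suc t) (outside ∷ I) t<I = trans (∑-subsetsOfSize m t (sub (outside ∷ I)))
    (cong₂ _+_ (supersets-none (suc t) I t<I) (supersets-none t I (ℕ.<-trans (ℕ.n<1+n t) t<I)))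
  supersets-none {suc m} (suc t) (inside ∷ I) (s≤s t<I) = trans (∑-subsetsOfSize m t (sub (inside ∷ I)))
    (cong₂ _+_ (∑-zero (subsetsOfSize m (suc t))) (supersets-none t I t<I))

  supersets-count : ∀ t u (I : Subset m) → t ≡ ∣ I ∣ ℕ.+ u →
    ∑ (subsetsOfSize m t) (sub I) ≡ parity (∣ ∁ I ∣ C u)
  supersets-count zero    zero    []            _ = refl
  supersets-count (suc t) (suc u) []            _ = refl
  supersets-count zero    zero    (outside ∷ I) t≡ = supersets-count zero zero I t≡
  supersets-count zero    (suc u) (outside ∷ I) t≡ with trans t≡ (ℕ.+-suc ∣ I ∣ u)
  ... | ()
  supersets-count {suc m} (suc t) zero    (outside ∷ I) t≡ = trans (∑-subsetsOfSize m t (sub (outside ∷ I)))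
    (cong₂ _+_ (supersets-count (suc t) zero I t≡)
               (supersets-none t I (ℕ.≤-reflexive (trans t≡ (ℕ.+-identityʳ _)))))
  supersets-count {suc m} (suc t) (suc u) (outside ∷ I) t≡ = trans (∑-subsetsOfSize m t (sub (outside ∷ I)))
    (trans (cong₂ _+_ (supersets-count (suc t) (suc u) I t≡)
                      (supersets-count t u I (ℕ.suc-injective (trans t≡ (ℕ.+-suc ∣ I ∣ u)))))
           (sym (C-pascal ∣ ∁ I ∣ u)))
  supersets-count {suc m} (suc t) u       (inside  ∷ I) t≡ = trans (∑-subsetsOfSize m t (sub (inside ∷ I)))
    (cong₂ _+_ (∑-zero (subsetsOfSize m (suc t))) (supersets-count t u I (ℕ.suc-injective t≡)))

  avoiders-count : ∀ t (I : Subset m) → ∑ (subsetsOfSize m t) (sub I ∘ ∁) ≡ parity (∣ ∁ I ∣ C t)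
  avoiders-count zero    []            = refl
  avoiders-count (suc t) []            = refl
  avoiders-count zero    (outside ∷ I) = avoiders-count zero I
  avoiders-count zero    (inside  ∷ I) = avoiders-count zero I
  avoiders-count {suc m} (suc t) (outside ∷ I) = trans (∑-subsetsOfSize m t (sub (outside ∷ I) ∘ ∁))
    (trans (cong₂ _+_ (avoiders-count (suc t) I) (avoiders-count t I)) (sym (C-pascal ∣ ∁ I ∣ t)))
  avoiders-count {suc m} (suc t) (inside ∷ I) = trans (∑-subsetsOfSize m t (sub (inside ∷ I) ∘ ∁))
    (trans (cong₂ _+_ (avoiders-count (suc t) I) (∑-zero (subsetsOfSize m t))) (ℙ.+-identityʳ _))

  module _ (p q : ℕ) (m≡ : m ≡ q ℕ.* 2 ^ p) where
    private
      ∁-complement : (I : Subset m) → ∀ {j} → ∣ I ∣ ≡ suc j → ∣ ∁ I ∣ ℕ.+ suc j ≡ q ℕ.* 2 ^ p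
      ∁-complement I I≡ = trans (cong (∣ ∁ I ∣ ℕ.+_) (sym I≡)) (trans (∣∁∣+∣∣ I) m≡)

    -- For |I| = j the count is binom(m-j, t+1-j). As 2^p divides m, the upper argument may be
    -- replaced by -j, and reflection gives binom(t, j-1), in which m no longer occurs.
    even-block : ∀ t (I : Subset m) → suc t < 2 ^ p → 0 < ∣ I ∣ →
      ∑ (subsetsOfSize m (suc t)) (sub I) ≡ γᵉᵛᵉⁿ (suc t) ∣ I ∣
    even-block t I t<T I>0 = go ∣ I ∣ refl I>0
      where
      go : ∀ j → ∣ I ∣ ≡ j → 0 < j → ∑ (subsetsOfSize m (suc t)) (sub I) ≡ γᵉᵛᵉⁿ (suc t) j
      go (suc j) I≡ _ with suc t ℕ.<? suc j
      ... | yes t<j = trans (supersets-none (suc t) I (subst (suc t <_) (sym I≡) t<j))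
                            (sym (C-vanishes (ℕ.≤-pred t<j)))
      ... | no  t≮j = begin
        ∑ (subsetsOfSize m (suc t)) (sub I)   ≡⟨ supersets-count (suc t) u I (trans (sym (ℕ.m+[n∸m]≡n (ℕ.≮⇒≥ t≮j)))
                                                                                   (cong (ℕ._+ u) (sym I≡))) ⟩
        parity (∣ ∁ I ∣ C u)                  ≡⟨ C-reflect p q j ∣ ∁ I ∣ u (∁-complement I I≡)
                                                  (ℕ.≤-<-trans (ℕ.≤-trans (ℕ.m∸n≤m t j) (ℕ.n≤1+n t)) t<T) ⟩
        parity ((u ℕ.+ j) C j)                ≡⟨ cong (λ a → parity (a C j)) (ℕ.m∸n+n≡m (ℕ.≤-pred (ℕ.≮⇒≥ t≮j))) ⟩
        parity (t C j)                        ∎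
        where
        open ≡-Reasoning
        u = t ℕ.∸ j

    -- A complement contains I when the t-set avoids I. For |I| = j this gives binom(m-j, t), which
    -- is congruent to binom(-j, t) and so to binom(t+j-1, j-1).
    odd-block : ∀ t (I : Subset m) → t < 2 ^ p → 0 < ∣ I ∣ →
      ∑ (List.map ∁ (subsetsOfSize m t)) (sub I) ≡ γᵒᵈᵈ (suc t) ∣ I ∣
    odd-block t I t<T I>0 = go ∣ I ∣ refl I>0
      where
      open ≡-Reasoning
      go : ∀ j → ∣ I ∣ ≡ j → 0 < j → ∑ (List.map ∁ (subsetsOfSize m t)) (sub I) ≡ γᵒᵈᵈ (suc t) j
      go (suc j) I≡ _ = begin
        ∑ (List.map ∁ (subsetsOfSize m t)) (sub I)   ≡⟨ ∑-map ∁ (subsetsOfSize m t) (sub I) ⟩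
        ∑ (subsetsOfSize m t) (sub I ∘ ∁)            ≡⟨ avoiders-count t I ⟩
        parity (∣ ∁ I ∣ C t)                         ≡⟨ C-reflect p q j ∣ ∁ I ∣ t (∁-complement I I≡) t<T ⟩
        parity ((t ℕ.+ j) C j)                       ≡⟨ γᵒᵈᵈ≡power t j ⟨
        γᵒᵈᵈ (suc t) (suc j)                         ∎

  _·_ : {A : Set} → 𝔽₂ → List A → List A
  0ℙ · xs = []
  1ℙ · xs = xs

  ∑-· : ∀ {A : Set} p (xs : List A) g → ∑ (p · xs) g ≡ p * ∑ xs g
  ∑-· 0ℙ xs g = refl
  ∑-· 1ℙ xs g = refl

  length-· : ∀ {A : Set} p (xs : List A) → length (p · xs) ≤ length xs
  length-· 0ℙ xs = z≤n
  length-· 1ℙ xs = ℕ.≤-refl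

  -- Concatenating lists of points adds their moments, so the canonical vectors that appear are
  -- realised block by block. Level 0 needs at most one point, lying in every member.
  points : (ℕ → 𝔽₂) → ∀ m → ℕ → List (Subset m)
  points c m zero    = c 0 · List.map ∁ (subsetsOfSize m 0)
  points c m (suc u) = points c m u ++
    (c (suc (u ℕ.+ u)) · subsetsOfSize m (suc u) ++
     c (suc (suc (u ℕ.+ u))) · List.map ∁ (subsetsOfSize m (suc u)))

  ∑-points : ∀ c p q → m ≡ q ℕ.* 2 ^ p → ∀ u (I : Subset m) → u < 2 ^ p → 0 < ∣ I ∣ →
    ∑ (points c m u) (sub I) ≡ levelSum c u ∣ I ∣
  ∑-points c p q m≡ zero I u<T I>0 = trans (∑-· (c 0) _ (sub I))
    (cong (c 0 *_) (odd-block p q m≡ 0 I u<T I>0))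
  ∑-points {m} c p q m≡ (suc u) I u<T I>0 = trans (∑-++ (points c m u) _ (sub I)) (cong₂ _+_
    (∑-points c p q m≡ u I (ℕ.<-trans (ℕ.n<1+n u) u<T) I>0)
    (trans (∑-++ (c (suc (u ℕ.+ u)) · subsetsOfSize m (suc u)) _ (sub I)) (cong₂ _+_
      (trans (∑-· (c (suc (u ℕ.+ u))) _ (sub I)) (cong (c (suc (u ℕ.+ u)) *_) (even-block p q m≡ u I u<T I>0)))
      (trans (∑-· (c (suc (suc (u ℕ.+ u)))) _ (sub I))
             (cong (c (suc (suc (u ℕ.+ u))) *_) (odd-block p q m≡ (suc u) I u<T I>0))))))

  subsetsOfSize-nonempty : ∀ {m t} → t ≤ m → ∃ λ S → S ∈ subsetsOfSize m t
  subsetsOfSize-nonempty z≤n = ⊥ , here refl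
  subsetsOfSize-nonempty {suc m} {suc t} (s≤s t≤m) =
    let S , S∈ = subsetsOfSize-nonempty t≤m
    in inside ∷ S , ∈-++⁺ʳ (List.map (outside ∷_) (subsetsOfSize m (suc t))) (∈-map⁺ (inside ∷_) S∈)

  private
    put-outside : ∀ {m t S} → S ∈ subsetsOfSize m (suc t) → outside ∷ S ∈ subsetsOfSize (suc m) (suc t)
    put-outside S∈ = ∈-++⁺ˡ (∈-map⁺ (outside ∷_) S∈)

    put-inside : ∀ {m t S} → S ∈ subsetsOfSize m t → inside ∷ S ∈ subsetsOfSize (suc m) (suc t)
    put-inside {m} {t} S∈ = ∈-++⁺ʳ (List.map (outside ∷_) (subsetsOfSize m (suc t))) (∈-map⁺ (inside ∷_) S∈)

  subsetsOfSize-avoiding : ∀ {m t} (b : Fin m) → t < m → ∃ λ S → S ∈ subsetsOfSize m t × lookup S b ≡ outside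
  subsetsOfSize-avoiding {suc m} {zero}  b       _         = ⊥ , here refl , Vec.lookup-replicate b outside
  subsetsOfSize-avoiding {suc m} {suc t} zero    (s≤s t<m) =
    let S , S∈ = subsetsOfSize-nonempty t<m in outside ∷ S , put-outside S∈ , refl
  subsetsOfSize-avoiding {suc m} {suc t} (suc b) (s≤s t<m) =
    let S , S∈ , S∌b = subsetsOfSize-avoiding b t<m in inside ∷ S , put-inside S∈ , S∌b

  -- The dual form of duplicate-freeness: it makes the m sets `member P a` distinct.
  Separates : List (Subset m) → Set
  Separates {m} P = ∀ (a b : Fin m) → a ≢ b → ∃ λ S → S ∈ P × lookup S a ≢ lookup S b

  -- The sizes 0 and m separate nothing, which explains the range of the size.
  subsetsOfSize-separates : ∀ m t → suc t < m → Separates (subsetsOfSize m (suc t))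
  subsetsOfSize-separates (suc m) t t<m zero    zero    a≢b = ⊥-elim (a≢b refl)
  subsetsOfSize-separates (suc m) t (s≤s t<m) zero (suc b) a≢b =
    let S , S∈ , S∌b = subsetsOfSize-avoiding b t<m
    in inside ∷ S , put-inside S∈ , λ eq → Bool.not-¬ (trans eq S∌b) refl
  subsetsOfSize-separates (suc m) t (s≤s t<m) (suc a) zero a≢b =
    let S , S∈ , S∌a = subsetsOfSize-avoiding a t<m
    in inside ∷ S , put-inside S∈ , λ eq → Bool.not-¬ (trans (sym eq) S∌a) refl
  subsetsOfSize-separates (suc (suc zero)) zero t<m (suc zero) (suc zero) a≢b = ⊥-elim (a≢b refl)
  subsetsOfSize-separates (suc (suc zero)) (suc t) (s≤s (s≤s ())) (suc a) (suc b) a≢b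
  -- When neither element is the head, a singleton has to omit the head, whereas a larger set takes
  -- it in, which keeps the size strictly below the number of remaining elements.
  subsetsOfSize-separates (suc (suc (suc m))) zero t<m (suc a) (suc b) a≢b =
    let S , S∈ , neq = subsetsOfSize-separates (suc (suc m)) zero (s≤s (s≤s z≤n)) a b (a≢b ∘ cong suc)
    in outside ∷ S , put-outside S∈ , neq
  subsetsOfSize-separates (suc (suc (suc m))) (suc t) (s≤s t<m) (suc a) (suc b) a≢b =
    let S , S∈ , neq = subsetsOfSize-separates (suc (suc m)) t t<m a b (a≢b ∘ cong suc)
    in inside ∷ S , put-inside S∈ , neq

  ∁-separates : ∀ {P : List (Subset m)} → Separates P → Separates (List.map ∁ P)
  ∁-separates separates a b a≢b =
    let S , S∈ , neq = separates a b a≢b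
    in ∁ S , ∈-map⁺ ∁ S∈ , λ eq → neq (Bool.not-injective
         (trans (sym (Vec.lookup-map a not S)) (trans eq (Vec.lookup-map b not S))))

  points-separates : ∀ c m u → suc u < m →
    c (suc (u ℕ.+ u)) ≡ 1ℙ ⊎ c (suc (suc (u ℕ.+ u))) ≡ 1ℙ → Separates (points c m (suc u))
  points-separates c m u u<m (inj₁ e≡1) a b a≢b =
    let S , S∈ , neq = subsetsOfSize-separates m u u<m a b a≢b
    in S , ∈-++⁺ʳ (points c m u) (∈-++⁺ˡ (subst (λ e → S ∈ e · subsetsOfSize m (suc u)) (sym e≡1) S∈)) , neq
  points-separates c m u u<m (inj₂ o≡1) a b a≢b =
    let S , S∈ , neq = ∁-separates (subsetsOfSize-separates m u u<m) a b a≢b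
    in S , ∈-++⁺ʳ (points c m u) (∈-++⁺ʳ (c (suc (u ℕ.+ u)) · subsetsOfSize m (suc u))
             (subst (λ o → S ∈ o · List.map ∁ (subsetsOfSize m (suc u))) (sym o≡1) S∈)) , neq

  -- The transposition opposite to `column`: from a list of points back to a family.
  member : (P : List (Subset m)) → Fin m → Subset (length P)
  member P a = Vec.tabulate λ x → lookup (List.lookup P x) a

  member-injective : ∀ {P : List (Subset m)} → Separates P → ∀ {a b} → member P a ≡ member P b → a ≡ b
  member-injective {P = P} separates {a} {b} eq = decidable-stable (a Fin.≟ b) λ a≢b →
    let S , S∈ , neq = separates a b a≢b
        x = Any.index S∈
    in neq (begin
      lookup S a                     ≡⟨ cong (λ S → lookup S a) (lookup-index S∈) ⟩
      lookup (List.lookup P x) a     ≡⟨ Vec.lookup∘tabulate _ x ⟨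
      lookup (member P a) x          ≡⟨ cong (λ F → lookup F x) eq ⟩
      lookup (member P b) x          ≡⟨ Vec.lookup∘tabulate _ x ⟩
      lookup (List.lookup P x) b     ≡⟨ cong (λ S → lookup S b) (lookup-index S∈) ⟨
      lookup S b                     ∎)
    where open ≡-Reasoning

  setOf : List (Fin m) → Subset m
  setOf []       = ⊥
  setOf (a ∷ as) = setOf as [ a ]≔ inside

  sub-⊥ : (S : Subset m) → sub ⊥ S ≡ 1ℙ
  sub-⊥ []      = refl
  sub-⊥ (_ ∷ S) = sub-⊥ S

  sub-insert : ∀ (I S : Subset m) a → sub (I [ a ]≔ inside) S ≡ ⟦ lookup S a ⟧ * sub I S
  sub-insert (outside ∷ I) (b ∷ S) zero    = refl
  sub-insert (inside  ∷ I) (b ∷ S) zero    = trans (cong (_* sub I S) (sym (ℙ.*-idem ⟦ b ⟧)))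
    (ℙ.*-assoc ⟦ b ⟧ ⟦ b ⟧ (sub I S))
  sub-insert (outside ∷ I) (b ∷ S) (suc a) = sub-insert I S a
  sub-insert (inside  ∷ I) (b ∷ S) (suc a) = begin
    ⟦ b ⟧ * sub (I [ a ]≔ inside) S           ≡⟨ cong (⟦ b ⟧ *_) (sub-insert I S a) ⟩
    ⟦ b ⟧ * (⟦ lookup S a ⟧ * sub I S)        ≡⟨ ℙ.*-assoc ⟦ b ⟧ _ _ ⟨
    ⟦ b ⟧ * ⟦ lookup S a ⟧ * sub I S          ≡⟨ cong (_* sub I S) (ℙ.*-comm ⟦ b ⟧ ⟦ lookup S a ⟧) ⟩
    ⟦ lookup S a ⟧ * ⟦ b ⟧ * sub I S          ≡⟨ ℙ.*-assoc ⟦ lookup S a ⟧ ⟦ b ⟧ _ ⟩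
    ⟦ lookup S a ⟧ * (⟦ b ⟧ * sub I S)        ∎
    where open ≡-Reasoning

  ∣insert∣ : ∀ (I : Subset m) a → lookup I a ≡ outside → ∣ I [ a ]≔ inside ∣ ≡ suc ∣ I ∣
  ∣insert∣ (outside ∷ I) zero    _  = refl
  ∣insert∣ (outside ∷ I) (suc a) eq = ∣insert∣ I a eq
  ∣insert∣ (inside  ∷ I) (suc a) eq = cong suc (∣insert∣ I a eq)

  lookup-setOf : ∀ {a} {as : List (Fin m)} → All (a ≢_) as → lookup (setOf as) a ≡ outside
  lookup-setOf {a = a} []                             = Vec.lookup-replicate a outside
  lookup-setOf {a = a} {b ∷ as} (a≢b ∷ a∉as) =
    trans (Vec.lookup∘update′ a≢b (setOf as) inside) (lookup-setOf a∉as)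

  ∣setOf∣ : ∀ {as : List (Fin m)} → Unique as → ∣ setOf as ∣ ≡ length as
  ∣setOf∣ {m} []                      = ∣⊥∣≡0 m
  ∣setOf∣ {as = a ∷ as} (a∉as ∷ as!) =
    trans (∣insert∣ (setOf as) a (lookup-setOf a∉as)) (cong suc (∣setOf∣ as!))

  lookup-⋂-member : ∀ (P : List (Subset m)) as x →
    ⟦ lookup (⋂ (List.map (member P) as)) x ⟧ ≡ sub (setOf as) (List.lookup P x)
  lookup-⋂-member P []       x = trans (cong ⟦_⟧ (Vec.lookup-replicate x true)) (sym (sub-⊥ (List.lookup P x)))
  lookup-⋂-member P (a ∷ as) x = begin
    ⟦ lookup (⋂ (member P a ∷ List.map (member P) as)) x ⟧
      ≡⟨ cong ⟦_⟧ (Vec.lookup-zipWith _∧_ x (member P a) _) ⟩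
    ⟦ lookup (member P a) x ∧ lookup (⋂ (List.map (member P) as)) x ⟧
      ≡⟨ ⟦⟧-∧ (lookup (member P a) x) _ ⟩
    ⟦ lookup (member P a) x ⟧ * ⟦ lookup (⋂ (List.map (member P) as)) x ⟧
      ≡⟨ cong₂ _*_ (cong ⟦_⟧ (Vec.lookup∘tabulate _ x)) (lookup-⋂-member P as x) ⟩
    ⟦ lookup (List.lookup P x) a ⟧ * sub (setOf as) (List.lookup P x)
      ≡⟨ sub-insert (setOf as) (List.lookup P x) a ⟨
    sub (setOf (a ∷ as)) (List.lookup P x) ∎
    where open ≡-Reasoning

  private
    indices : ∀ {A : Set} {g : Fin m → A} {xs} → All (_∈ List.tabulate g) xs → ∃ λ as → xs ≡ List.map g as
    indices []         = [] , refl
    indices (x∈ ∷ xs∈) =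
      let a , x≡ = ∈-tabulate⁻ x∈
          as , xs≡ = indices xs∈
      in a ∷ as , cong₂ _∷_ x≡ xs≡

  members-town : ∀ (α : Vec 𝔽₂ k) s → (∀ i → lookup α i ≡ s (suc (toℕ i))) → ∀ (P : List (Subset m)) →
    (∀ I → 0 < ∣ I ∣ → ∑ P (sub I) ≡ s ∣ I ∣) → IsTown α (List.tabulate (member P))
  members-town {m = m} α s α≡s P moment i Fs len Fs! Fs∈ = go (proj₁ (indices Fs∈)) (proj₂ (indices Fs∈)) len Fs!
    where
    open ≡-Reasoning
    go : ∀ as → Fs ≡ List.map (member P) as → length Fs ≡ suc (toℕ i) → Unique Fs → parity ∣ ⋂ Fs ∣ ≡ lookup α i
    go as refl len Fs! = begin
      parity ∣ ⋂ (List.map (member P) as) ∣                    ≡⟨ parity-∣∣ (⋂ (List.map (member P) as)) ⟩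
      sum (λ x → ⟦ lookup (⋂ (List.map (member P) as)) x ⟧)    ≡⟨ sum-cong-≗ (lookup-⋂-member P as) ⟩
      ∑ P (sub (setOf as))                                     ≡⟨ moment (setOf as) (subst (0 <_) (sym ∣as∣) (s≤s z≤n)) ⟩
      s ∣ setOf as ∣                                           ≡⟨ cong s ∣as∣ ⟩
      s (suc (toℕ i))                                          ≡⟨ α≡s i ⟨
      lookup α i                                               ∎
      where
      ∣as∣ : ∣ setOf as ∣ ≡ suc (toℕ i)
      ∣as∣ = trans (∣setOf∣ (Unique.map⁻ Fs!)) (trans (sym (List.length-map (member P) as)) len)

  sub-empty : (I : Subset m) → 0 < ∣ I ∣ → sub I ⊥ ≡ 0ℙ
  sub-empty (outside ∷ I) I>0 = sub-empty I I>0
  sub-empty (inside  ∷ I) I>0 = refl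

  ∑-replicate-⊥ : ∀ d (I : Subset m) → 0 < ∣ I ∣ → ∑ (List.replicate d ⊥) (sub I) ≡ 0ℙ
  ∑-replicate-⊥ zero    I I>0 = refl
  ∑-replicate-⊥ (suc d) I I>0 = cong₂ _+_ (sub-empty I I>0) (∑-replicate-⊥ d I I>0)

  -- Points that lie in no member pad P to n points.
  size≤f : ∀ (α : Vec 𝔽₂ k) s → (∀ i → lookup α i ≡ s (suc (toℕ i))) → ∀ (P : List (Subset m)) →
    (∀ I → 0 < ∣ I ∣ → ∑ P (sub I) ≡ s ∣ I ∣) → Separates P → length P ≤ n → m ≤ f α n
  size≤f {m = m} {n} α s α≡s P moment separates P≤n = subst (λ n → m ≤ f α n) length-P′
    (subst (_≤ f α (length P′)) (List.length-tabulate (member P′))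
      (proj₂ (proj₂ (maximumTownSize α (length P′))) (List.tabulate (member P′))
        (Unique.tabulate⁺ (member-injective {P = P′} separates′))
        (members-town α s α≡s P′ moment′)))
    where
    d = n ℕ.∸ length P
    P′ = P ++ List.replicate d ⊥
    length-P′ : length P′ ≡ n
    length-P′ = trans (List.length-++ P) (trans (cong (length P ℕ.+_) (List.length-replicate d)) (ℕ.m+[n∸m]≡n P≤n))
    moment′ : ∀ I → 0 < ∣ I ∣ → ∑ P′ (sub I) ≡ s ∣ I ∣
    moment′ I I>0 = trans (∑-++ P (List.replicate d ⊥) (sub I))
      (trans (cong₂ _+_ (moment I I>0) (∑-replicate-⊥ d I I>0)) (ℙ.+-identityʳ _))
    separates′ : Separates P′
    separates′ a b a≢b = let S , S∈ , neq = separates a b a≢b in S , ∈-++⁺ˡ S∈ , neq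

-- Lower bounds at positive level

module LowerBound where

  open import Data.Nat.Base using (_+_; _*_; _^_; _≤_; _<_; _/_; _%_; NonZero)
  open import Data.Nat.DivMod using (m≡m%n+[m/n]*n; m%n<n)
  open import Data.Nat.Properties
  open DisjointnessMatrix
  open Levels
  open UpperBound
  open Construction

  C≤^ : ∀ m t → m C t ≤ suc m ^ t
  C≤^ m t = begin
    m C t          ≡⟨ *-identityˡ _ ⟨
    1 * (m C t)    ≤⟨ *-monoˡ-≤ (m C t) (1≤n! t) ⟩
    t ! * (m C t)  ≤⟨ !*C≤^ m t ⟩
    m ^ t          ≤⟨ ^-monoˡ-≤ t (n≤1+n m) ⟩
    suc m ^ t      ∎
    where open ≤-Reasoning

  length-blocks : ∀ p q m t → length (p · subsetsOfSize m t ++ q · List.map ∁ (subsetsOfSize m t)) ≤ 2 * (m C t)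
  length-blocks p q m t = begin
    length (p · subsetsOfSize m t ++ q · List.map ∁ (subsetsOfSize m t))
      ≡⟨ List.length-++ (p · subsetsOfSize m t) ⟩
    length (p · subsetsOfSize m t) + length (q · List.map ∁ (subsetsOfSize m t))
      ≤⟨ +-mono-≤ (length-· p _) (length-· q _) ⟩
    length (subsetsOfSize m t) + length (List.map ∁ (subsetsOfSize m t))
      ≡⟨ cong₂ _+_ (length-subsetsOfSize m t) (trans (List.length-map ∁ (subsetsOfSize m t)) (length-subsetsOfSize m t)) ⟩
    m C t + m C t
      ≡⟨ cong (m C t +_) (+-identityʳ (m C t)) ⟨
    2 * (m C t) ∎
    where open ≤-Reasoning

  -- There are 2u+1 canonical vectors of level at most u, and each costs at most (m+1)^u points.
  length-points : ∀ c m u → length (points c m u) ≤ suc (u + u) * suc m ^ u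
  length-points c m zero    = length-· (c 0) (List.map ∁ (subsetsOfSize m 0))
  length-points c m (suc u) = begin
    length (points c m (suc u))
      ≡⟨ List.length-++ (points c m u) ⟩
    length (points c m u) + length (c (suc (u + u)) · subsetsOfSize m (suc u) ++
                                    c (suc (suc (u + u))) · List.map ∁ (subsetsOfSize m (suc u)))
      ≤⟨ +-mono-≤ (length-points c m u) (length-blocks (c (suc (u + u))) (c (suc (suc (u + u)))) m (suc u)) ⟩
    suc (u + u) * suc m ^ u + 2 * (m C suc u)
      ≤⟨ +-mono-≤ (*-monoʳ-≤ (suc (u + u)) (m≤m+n (suc m ^ u) (m * suc m ^ u))) (*-monoʳ-≤ 2 (C≤^ m (suc u))) ⟩
    suc (u + u) * suc m ^ suc u + 2 * suc m ^ suc u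
      ≡⟨ collect u (suc m ^ suc u) ⟩
    suc (suc u + suc u) * suc m ^ suc u ∎
    where
    open ≤-Reasoning
    collect : ∀ u x → suc (u + u) * x + 2 * x ≡ suc (suc u + suc u) * x
    collect = solve-∀

  1+u<2^1+u : ∀ u → suc u < 2 ^ suc u
  1+u<2^1+u zero    = s≤s (s≤s z≤n)
  1+u<2^1+u (suc u) = begin-strict
    suc (suc u)              ≤⟨ s≤s (m≤m+n (suc u) u) ⟩
    suc (suc u + u)          ≡⟨ +-suc (suc u) u ⟨
    suc u + suc u            <⟨ +-mono-< (1+u<2^1+u u) (1+u<2^1+u u) ⟩
    2 ^ suc u + 2 ^ suc u    ≡⟨ cong (2 ^ suc u +_) (+-identityʳ (2 ^ suc u)) ⟨
    2 ^ suc (suc u)          ∎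
    where open ≤-Reasoning

  ^-distrib-* : ∀ a b u → (a * b) ^ u ≡ a ^ u * b ^ u
  ^-distrib-* a b zero    = refl
  ^-distrib-* a b (suc u) = trans (cong (a * b *_) (^-distrib-* a b u)) ([m*n]*[o*p]≡[m*o]*[n*p] a b (a ^ u) (b ^ u))

  next-multiple : ∀ T .{{_ : NonZero T}} n → n < suc (n / T) * T × suc (n / T) * T ≤ n + T
  next-multiple T n = (begin-strict
      n                          ≡⟨ m≡m%n+[m/n]*n n T ⟩
      n % T + n / T * T          <⟨ +-monoˡ-< (n / T * T) (m%n<n n T) ⟩
      T + n / T * T              ∎)
    , (begin
      T + n / T * T              ≤⟨ +-monoʳ-≤ T (m≤n+m (n / T * T) (n % T)) ⟩
      T + (n % T + n / T * T)    ≡⟨ cong (T +_) (m≡m%n+[m/n]*n n T) ⟨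
      T + n                      ≡⟨ +-comm T n ⟩
      n + T                      ∎)
    where open ≤-Reasoning

  module _ {k} (α : Vec 𝔽₂ k) (u : ℕ) (level : lv α ≡ suc u) where
    private
      c : ℕ → 𝔽₂
      c = coefficient α
      top : ∀ m → List (Subset m)
      top m = c (suc (u + u)) · subsetsOfSize m (suc u) ++ c (suc (suc (u + u))) · List.map ∁ (subsetsOfSize m (suc u))

    LowerPowerBound : ℕ → Set
    LowerPowerBound g = ∃ λ d → ∀ n → suc u ! * n ≤ g * f α n ^ suc u + d * suc (f α n) ^ u

    -- By maximality: let m be the next multiple of `T` beyond F = f α n. Were n points enough for
    -- the construction with m members, f α n would be at least m > F. So n is less than the cost of
    -- that construction, where m ≤ F + T.
    lower-power-bound : ∀ g → c (suc (u + u)) ≡ ℙ.1ℙ ⊎ c (suc (suc (u + u))) ≡ ℙ.1ℙ →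
      (∀ m → length (top m) ≡ g * (m C suc u)) → LowerPowerBound g
    lower-power-bound g nonzero length-top = d , bound
      where
      open ≤-Reasoning
      w = suc u !
      D = suc (u + u)
      -- A power of 2 above the level `suc u`, as both kinds of blocks require.
      T = 2 ^ suc u
      -- `w * D` comes from the points of lower level, `g * (suc u * T)` from replacing m by F
      -- through `^-shift`, and the last factor from F + T + 1 ≤ (T + 1)(F + 1).
      d = (w * D + g * (suc u * T)) * suc T ^ u
      instance
        T≢0 : NonZero T
        T≢0 = m^n≢0 2 (suc u)

      length-points≤ : ∀ m → length (points c m (suc u)) ≤ D * suc m ^ u + g * (m C suc u)
      length-points≤ m = begin
        length (points c m (suc u))                 ≡⟨ List.length-++ (points c m u) ⟩
        length (points c m u) + length (top m)      ≤⟨ +-mono-≤ (length-points c m u) (≤-reflexive (length-top m)) ⟩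
        D * suc m ^ u + g * (m C suc u)             ∎

      expand : ∀ w D x g b → w * (D * x + g * b) ≡ w * D * x + g * (w * b)
      expand = solve-∀
      collect : ∀ a x g y s T z → a * x + g * (y + s * T * z) ≡ g * y + (a * x + g * (s * T) * z)
      collect = solve-∀
      factor : ∀ a b x y → a * (x * y) + b * (x * y) ≡ (a + b) * x * y
      factor = solve-∀
      swell : ∀ x T → suc (x + T) + T * x ≡ suc T * suc x
      swell = solve-∀

      bound : ∀ n → w * n ≤ g * f α n ^ suc u + d * suc (f α n) ^ u
      bound n = begin
        w * n
          ≤⟨ *-monoʳ-≤ w (≤-trans (<⇒≤ n<cost) (length-points≤ m)) ⟩
        w * (D * suc m ^ u + g * (m C suc u))
          ≡⟨ expand w D (suc m ^ u) g (m C suc u) ⟩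
        w * D * suc m ^ u + g * (w * (m C suc u))
          ≤⟨ +-monoʳ-≤ _ (*-monoʳ-≤ g (!*C≤^ m (suc u))) ⟩
        w * D * suc m ^ u + g * m ^ suc u
          ≤⟨ +-mono-≤ (*-monoʳ-≤ (w * D) (^-monoˡ-≤ u (s≤s m≤F+T)))
                      (*-monoʳ-≤ g (≤-trans (^-monoˡ-≤ (suc u) m≤F+T) (^-shift F T u))) ⟩
        w * D * suc (F + T) ^ u + g * (F ^ suc u + suc u * T * (F + T) ^ u)
          ≤⟨ +-monoʳ-≤ _ (*-monoʳ-≤ g (+-monoʳ-≤ (F ^ suc u) (*-monoʳ-≤ (suc u * T) (^-monoˡ-≤ u (n≤1+n (F + T)))))) ⟩
        w * D * suc (F + T) ^ u + g * (F ^ suc u + suc u * T * suc (F + T) ^ u)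
          ≡⟨ collect (w * D) _ g (F ^ suc u) (suc u) T _ ⟩
        g * F ^ suc u + (w * D * suc (F + T) ^ u + g * (suc u * T) * suc (F + T) ^ u)
          ≤⟨ +-monoʳ-≤ (g * F ^ suc u) (+-mono-≤ (*-monoʳ-≤ (w * D) F+T≤) (*-monoʳ-≤ (g * (suc u * T)) F+T≤)) ⟩
        g * F ^ suc u + (w * D * (suc T ^ u * suc F ^ u) + g * (suc u * T) * (suc T ^ u * suc F ^ u))
          ≡⟨ cong (g * F ^ suc u +_) (factor (w * D) (g * (suc u * T)) (suc T ^ u) (suc F ^ u)) ⟩
        g * F ^ suc u + d * suc F ^ u ∎
        where
        F = f α n
        q = suc (F / T)
        m = q * T
        m≤F+T : m ≤ F + T
        m≤F+T = proj₂ (next-multiple T F)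
        F+T≤ : suc (F + T) ^ u ≤ suc T ^ u * suc F ^ u
        F+T≤ = begin
          suc (F + T) ^ u         ≤⟨ ^-monoˡ-≤ u (≤-trans (m≤m+n _ (T * F)) (≤-reflexive (swell F T))) ⟩
          (suc T * suc F) ^ u     ≡⟨ ^-distrib-* (suc T) (suc F) u ⟩
          suc T ^ u * suc F ^ u   ∎
        n<cost : n < length (points c m (suc u))
        n<cost = ≰⇒> λ cost≤n → <⇒≱ (proj₁ (next-multiple T F))
          (size≤f α (levelSum c (suc u))
            (λ i → trans (lookup≡levelSum α i) (cong (λ t → levelSum c t (suc (toℕ i))) level))
            (points c m (suc u))
            (λ I → ∑-points c (suc u) q refl (suc u) I (1+u<2^1+u u))
            (points-separates c m u (<-≤-trans (1+u<2^1+u u) (m≤m+n T _)) nonzero)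
            cost≤n)

    lower-power-bound-1 : grd α ≡ 1 → LowerPowerBound 1
    lower-power-bound-1 grade with grade-1 α u level grade
    ... | inj₁ (e , o) = lower-power-bound 1 (inj₁ e) λ m → trans
      (cong₂ (λ x y → length (x · subsetsOfSize m (suc u) ++ y · List.map ∁ (subsetsOfSize m (suc u)))) e o)
      (trans (List.length-++ (subsetsOfSize m (suc u))) (cong (_+ 0) (length-subsetsOfSize m (suc u))))
    ... | inj₂ (e , o) = lower-power-bound 1 (inj₂ o) λ m → trans
      (cong₂ (λ x y → length (x · subsetsOfSize m (suc u) ++ y · List.map ∁ (subsetsOfSize m (suc u)))) e o)
      (trans (List.length-map ∁ (subsetsOfSize m (suc u))) (trans (length-subsetsOfSize m (suc u)) (sym (*-identityˡ _))))

    lower-power-bound-2 : grd α ≡ 2 → LowerPowerBound 2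
    lower-power-bound-2 grade =
      let e , o = grade-2 α u level grade
      in lower-power-bound 2 (inj₁ e) λ m → trans
        (cong₂ (λ x y → length (x · subsetsOfSize m (suc u) ++ y · List.map ∁ (subsetsOfSize m (suc u)))) e o)
        (trans (List.length-++ (subsetsOfSize m (suc u))) (cong₂ _+_ (length-subsetsOfSize m (suc u))
          (trans (List.length-map ∁ (subsetsOfSize m (suc u)))
            (trans (length-subsetsOfSize m (suc u)) (sym (+-identityʳ _))))))

-- From additive errors of lower order to ratios near 1

module Ratios where

  open import Data.Nat.Base using (_+_; _*_; _^_; _≤_; _<_)
  open import Data.Nat.Properties
  open UpperBound using (^-shift)

  -- F n < Y₀ is only possible for bounded n, and otherwise the error terms are at most F n ^ t / q.
  ratio-close : ∀ (F : ℕ → ℕ) u g w c → 0 < g → 0 < w →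
    (∀ n → g * F n ^ suc u ≤ w * n + c * suc (F n) ^ u) →
    (∀ n → w * n ≤ g * F n ^ suc u + c * suc (F n) ^ u) →
    ∀ q → ∃ λ N → ∀ n → N ≤ n → q * (w * n) ≤ suc q * (g * F n ^ suc u) ×
                                q * (g * F n ^ suc u) ≤ suc q * (w * n)
  ratio-close F u g w c g>0 w>0 upper lower q = suc (g * Y₀ ^ suc u + c * Y₀ ^ u) , bounds
    where
    -- `K` combines the error c with the loss `suc u` of replacing F n + 1 by F n. The factor 2 in
    -- `Y₀` provides one multiple of K to absorb that loss and a second one to remain in `error≤`.
    K = c + suc u
    Y₀ = 2 * (suc q * K)
    collect : ∀ a x y → a * x + a * y ≡ a * (x + y)
    collect = solve-∀
    module _ (n : ℕ) (N≤n : suc (g * Y₀ ^ suc u + c * Y₀ ^ u) ≤ n) where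
      open ≤-Reasoning
      y = suc (F n)
      G = g * F n ^ suc u

      F≤G : F n ^ suc u ≤ G
      F≤G = ≤-trans (≤-reflexive (sym (*-identityˡ _))) (*-monoˡ-≤ _ g>0)

      Y₀≤y : Y₀ ≤ y
      Y₀≤y = ≮⇒≥ λ y<Y₀ → <-irrefl refl (begin-strict
        n                              ≡⟨ *-identityˡ n ⟨
        1 * n                          ≤⟨ *-monoˡ-≤ n w>0 ⟩
        w * n                          ≤⟨ lower n ⟩
        G + c * y ^ u                  ≤⟨ +-mono-≤ (*-monoʳ-≤ g (^-monoˡ-≤ (suc u) (<⇒≤ (<-trans (n<1+n _) y<Y₀))))
                                                   (*-monoʳ-≤ c (^-monoˡ-≤ u (<⇒≤ y<Y₀))) ⟩
        g * Y₀ ^ suc u + c * Y₀ ^ u    <⟨ N≤n ⟩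
        n                              ∎)

      error≤ : suc q * K * y ^ u ≤ F n ^ suc u
      error≤ = +-cancelʳ-≤ (suc q * K * y ^ u) _ _ (begin
        suc q * K * y ^ u + suc q * K * y ^ u   ≡⟨ double (suc q * K) (y ^ u) ⟩
        Y₀ * y ^ u                              ≤⟨ *-monoˡ-≤ (y ^ u) Y₀≤y ⟩
        y ^ suc u                               ≡⟨ cong (_^ suc u) (+-comm (F n) 1) ⟨
        (F n + 1) ^ suc u                       ≤⟨ ^-shift (F n) 1 u ⟩
        F n ^ suc u + suc u * 1 * (F n + 1) ^ u ≡⟨ cong₂ (λ a b → F n ^ suc u + a * b ^ u)
                                                    (*-identityʳ (suc u)) (+-comm (F n) 1) ⟩
        F n ^ suc u + suc u * y ^ u             ≤⟨ +-monoʳ-≤ _ (*-monoˡ-≤ (y ^ u)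
                                                    (≤-trans (m≤n+m (suc u) c) (m≤m+n K (q * K)))) ⟩
        F n ^ suc u + suc q * K * y ^ u         ∎)
        where
        double : ∀ a x → a * x + a * x ≡ 2 * a * x
        double = solve-∀

      c-error≤ : suc q * (c * y ^ u) ≤ G
      c-error≤ = begin
        suc q * (c * y ^ u)    ≡⟨ *-assoc (suc q) c _ ⟨
        suc q * c * y ^ u      ≤⟨ *-monoˡ-≤ (y ^ u) (*-monoʳ-≤ (suc q) (m≤m+n c (suc u))) ⟩
        suc q * K * y ^ u      ≤⟨ error≤ ⟩
        F n ^ suc u            ≤⟨ F≤G ⟩
        G                      ∎

      bounds : q * (w * n) ≤ suc q * G × q * G ≤ suc q * (w * n)
      bounds = (begin
        q * (w * n)                  ≤⟨ *-monoʳ-≤ q (lower n) ⟩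
        q * (G + c * y ^ u)          ≡⟨ *-distribˡ-+ q G _ ⟩
        q * G + q * (c * y ^ u)      ≤⟨ +-monoʳ-≤ (q * G) (≤-trans (*-monoˡ-≤ _ (n≤1+n q)) c-error≤) ⟩
        q * G + G                    ≡⟨ +-comm (q * G) G ⟩
        suc q * G                    ∎)
        , +-cancelˡ-≤ G _ _ (begin
        suc q * G                            ≤⟨ *-monoʳ-≤ (suc q) (upper n) ⟩
        suc q * (w * n + c * y ^ u)          ≡⟨ *-distribˡ-+ (suc q) (w * n) _ ⟩
        suc q * (w * n) + suc q * (c * y ^ u) ≤⟨ +-monoʳ-≤ (suc q * (w * n)) c-error≤ ⟩
        suc q * (w * n) + G                  ≡⟨ +-comm _ G ⟩
        G + suc q * (w * n)                  ∎)

-- Rational inequalities for the t-th powers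

module Asymptotics where

  open import Algebra.Bundles using (CommutativeRing)
  open import Data.Integer.Base as ℤ using (+_)
  import Data.Integer.Properties as ℤ
  import Data.Nat.Coprimality as Coprime
  open import Data.Rational.Base
  open import Data.Rational.Properties
  import Data.Rational.Unnormalised.Base as ℚᵘ
  import Data.Rational.Unnormalised.Properties as ℚᵘ
  open import Algebra.Properties.Semiring.Exp
    (CommutativeRing.semiring +-*-commutativeRing) using () renaming (_^_ to _^ℚ_)
  open Ratios

  private
    -- The normal form of `toℚ m`: division by 1 is stuck on a gcd for a variable m, whereas
    -- arithmetic and order compute on this constructor.
    fromℕ : ℕ → ℚ
    fromℕ m = mkℚ (+ m) 0 (Coprime.sym (Coprime.1-coprimeTo m))

    toℚ≡ : ∀ m → toℚ m ≡ fromℕ m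
    toℚ≡ m = normalize-coprime (Coprime.sym (Coprime.1-coprimeTo m))

  toℚ-* : ∀ m n → toℚ (m ℕ.* n) ≡ toℚ m * toℚ n
  toℚ-* m n rewrite toℚ≡ m | toℚ≡ n = cong (_/ 1) (ℤ.pos-* m n)

  toℚ-+ : ∀ m n → toℚ (m ℕ.+ n) ≡ toℚ m + toℚ n
  toℚ-+ m n rewrite toℚ≡ m | toℚ≡ n =
    cong (_/ 1) (sym (cong₂ ℤ._+_ (ℤ.*-identityʳ (+ m)) (ℤ.*-identityʳ (+ n))))

  toℚ-mono-≤ : ∀ {m n} → m ℕ.≤ n → toℚ m ≤ toℚ n
  toℚ-mono-≤ {m} {n} m≤n rewrite toℚ≡ m | toℚ≡ n =
    *≤* (ℤ.*-monoʳ-≤-nonNeg (+ 1) (ℤ.+≤+ m≤n))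

  toℚ-nonNeg : ∀ m → NonNegative (toℚ m)
  toℚ-nonNeg m rewrite toℚ≡ m = _

  toℚ-pos : ∀ m → Positive (toℚ (suc m))
  toℚ-pos m rewrite toℚ≡ (suc m) = _

  toℚ-^ : ∀ m t → toℚ (m ℕ.^ t) ≡ toℚ m ^ℚ t
  toℚ-^ m zero    = refl
  toℚ-^ m (suc t) = trans (toℚ-* m (m ℕ.^ t)) (cong (toℚ m *_) (toℚ-^ m t))

  toℚ-*-/ : ∀ d m → toℚ (suc d) * (+ m / suc d) ≡ toℚ m
  toℚ-*-/ d m = toℚᵘ-injective (begin
    toℚᵘ (toℚ (suc d) * (+ m / suc d))                ≈⟨ toℚᵘ-homo-* (toℚ (suc d)) (+ m / suc d) ⟩
    toℚᵘ (toℚ (suc d)) ℚᵘ.* toℚᵘ (+ m / suc d)        ≈⟨ ℚᵘ.*-cong (toℚᵘ-fromℚᵘ (+ suc d ℚᵘ./ 1))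
                                                                     (toℚᵘ-fromℚᵘ (+ m ℚᵘ./ suc d)) ⟩
    (+ suc d ℚᵘ./ 1) ℚᵘ.* (+ m ℚᵘ./ suc d)            ≈⟨ ℚᵘ.*≡* cross ⟩
    + m ℚᵘ./ 1                                        ≈⟨ toℚᵘ-fromℚᵘ (+ m ℚᵘ./ 1) ⟨
    toℚᵘ (toℚ m)                                      ∎)
    where
    open ℚᵘ.≃-Reasoning
    cross : + suc d ℤ.* + m ℤ.* + 1 ≡ + m ℤ.* + (1 ℕ.* suc d)
    cross = trans (ℤ.*-identityʳ (+ suc d ℤ.* + m)) (trans (ℤ.*-comm (+ suc d) (+ m))
      (cong (λ a → + m ℤ.* + a) (sym (ℕ.*-identityˡ (suc d)))))

  -- The denominator of ε serves: multiplied by it, ε becomes its numerator, a positive integer.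
  archimedean : ∀ ε → 0ℚ < ε → ∃ λ q → 1ℚ ≤ toℚ (suc q) * ε
  archimedean ε@(mkℚ (+ zero)    d _) (*<* (ℤ.+<+ ()))
  archimedean ε@(mkℚ (ℤ.-[1+ a ]) d _) (*<* ())
  archimedean ε@(mkℚ (+ suc a)   d _) _ = d , subst (1ℚ ≤_) eq (toℚ-mono-≤ {1} {suc a} (s≤s z≤n))
    where
    eq : toℚ (suc a) ≡ toℚ (suc d) * ε
    eq = sym (trans (cong (toℚ (suc d) *_) (sym (↥p/↧p≡p ε))) (toℚ-*-/ d (suc a)))

  ^-≤1 : ∀ {p} → 0ℚ ≤ p → p ≤ 1ℚ → ∀ t → p ^ℚ t ≤ 1ℚ
  ^-≤1 0≤p p≤1 zero    = ≤-refl
  ^-≤1 {p} 0≤p p≤1 (suc t) = ≤-trans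
    (*-monoˡ-≤-nonNeg p {{nonNegative 0≤p}} (^-≤1 0≤p p≤1 t)) (≤-trans (≤-reflexive (*-identityʳ p)) p≤1)

  1≤-^ : ∀ {p} → 1ℚ ≤ p → ∀ t → 1ℚ ≤ p ^ℚ t
  1≤-^ 1≤p zero    = ≤-refl
  1≤-^ {p} 1≤p (suc t) = ≤-trans 1≤p (≤-trans (≤-reflexive (sym (*-identityʳ p)))
    (*-monoˡ-≤-nonNeg p {{nonNegative (≤-trans (toℚ-mono-≤ {0} {1} z≤n) 1≤p)}} (1≤-^ 1≤p t)))

  -- With Qε ≥ 1, the quotient Q/(Q+1) is at least 1-ε and (Q+1)/Q at most 1+ε. As (1-ε)^t ≤ 1-ε and
  -- 1+ε ≤ (1+ε)^t, these linear bounds already control the t-th powers.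
  asymptotic-of-close : ∀ (F : ℕ → ℕ) u g w (x : ℕ → ℚ) → (∀ n → toℚ (suc g) * x n ≡ toℚ (w ℕ.* n)) →
    (∀ q → ∃ λ N → ∀ n → N ℕ.≤ n →
      q ℕ.* (w ℕ.* n) ℕ.≤ suc q ℕ.* (suc g ℕ.* F n ℕ.^ suc u) ×
      q ℕ.* (suc g ℕ.* F n ℕ.^ suc u) ℕ.≤ suc q ℕ.* (w ℕ.* n)) →
    AsymptoticToRoot F (suc u) x
  asymptotic-of-close F u g w x gx≡wn close ε 0<ε ε<1 =
    proj₁ (close (suc q)) , λ n N≤n → bounds n (proj₂ (close (suc q)) n N≤n)
    where
    q = proj₁ (archimedean ε 0<ε)
    Q = toℚ (suc q)
    Q′ = toℚ (suc (suc q))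
    G = toℚ (suc g)
    δ = 1ℚ - ε

    1≤Qε : 1ℚ ≤ Q * ε
    1≤Qε = proj₂ (archimedean ε 0<ε)

    Q′≡ : Q′ ≡ Q + 1ℚ
    Q′≡ = trans (cong toℚ (ℕ.+-comm 1 (suc q))) (toℚ-+ (suc q) 1)

    instance
      _ = toℚ-pos q
      _ = toℚ-pos (suc q)
      _ = toℚ-pos g
      _ = toℚ-nonNeg (suc q)
      _ = toℚ-nonNeg (suc (suc q))
      _ = nonNegative (<⇒≤ 0<ε)

    δ+ε≡1 : δ + ε ≡ 1ℚ
    δ+ε≡1 = trans (+-assoc 1ℚ (- ε) ε) (trans (cong (_+_ 1ℚ) (+-inverseˡ ε)) (+-identityʳ 1ℚ))

    0≤δ : 0ℚ ≤ δ
    0≤δ = subst (_≤ δ) (+-inverseʳ ε) (+-monoˡ-≤ (- ε) (<⇒≤ ε<1))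

    δ≤1 : δ ≤ 1ℚ
    δ≤1 = ≤-trans (≤-reflexive (sym (+-identityʳ δ)))
      (≤-trans (+-monoʳ-≤ δ (<⇒≤ 0<ε)) (≤-reflexive δ+ε≡1))

    1≤1+ε : 1ℚ ≤ 1ℚ + ε
    1≤1+ε = ≤-trans (≤-reflexive (sym (+-identityʳ 1ℚ))) (+-monoʳ-≤ 1ℚ (<⇒≤ 0<ε))

    0≤1+ε : 0ℚ ≤ 1ℚ + ε
    0≤1+ε = ≤-trans (toℚ-mono-≤ {0} {1} z≤n) 1≤1+ε

    cancel-+1 : ∀ {a b} → a + 1ℚ ≤ b + 1ℚ → a ≤ b
    cancel-+1 {a} {b} le = subst₂ _≤_ (shift a) (shift b) (+-monoˡ-≤ (- 1ℚ) le)
      where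
      shift : ∀ c → c + 1ℚ + - 1ℚ ≡ c
      shift c = trans (+-assoc c 1ℚ (- 1ℚ)) (+-identityʳ c)

    Q′δ≤Q : Q′ * δ ≤ Q
    Q′δ≤Q = cancel-+1 (begin
      Q′ * δ + 1ℚ        ≤⟨ +-monoʳ-≤ (Q′ * δ) (≤-trans 1≤Qε (*-monoʳ-≤-nonNeg ε (toℚ-mono-≤ (ℕ.n≤1+n (suc q))))) ⟩
      Q′ * δ + Q′ * ε    ≡⟨ *-distribˡ-+ Q′ δ ε ⟨
      Q′ * (δ + ε)       ≡⟨ cong (Q′ *_) δ+ε≡1 ⟩
      Q′ * 1ℚ            ≡⟨ *-identityʳ Q′ ⟩
      Q′                 ≡⟨ Q′≡ ⟩
      Q + 1ℚ             ∎)
      where open ≤-Reasoning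

    Q′≤Q[1+ε] : Q′ ≤ Q * (1ℚ + ε)
    Q′≤Q[1+ε] = begin
      Q′                 ≡⟨ Q′≡ ⟩
      Q + 1ℚ             ≤⟨ +-monoʳ-≤ Q 1≤Qε ⟩
      Q + Q * ε          ≡⟨ cong (_+ Q * ε) (*-identityʳ Q) ⟨
      Q * 1ℚ + Q * ε     ≡⟨ *-distribˡ-+ Q 1ℚ ε ⟨
      Q * (1ℚ + ε)       ∎
      where open ≤-Reasoning

    swap : ∀ a b c → a * (b * c) ≡ b * (a * c)
    swap a b c = trans (sym (*-assoc a b c)) (trans (cong (_* c) (*-comm a b)) (*-assoc b a c))

    module _ (n : ℕ) where
      open ≤-Reasoning
      X = toℚ (F n) ^ℚ suc u

      G*X : toℚ (suc g ℕ.* F n ℕ.^ suc u) ≡ G * X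
      G*X = trans (toℚ-* (suc g) (F n ℕ.^ suc u)) (cong (G *_) (toℚ-^ (F n) (suc u)))

      0≤x : 0ℚ ≤ x n
      0≤x = *-cancelˡ-≤-pos G (begin
        G * 0ℚ        ≡⟨ *-zeroʳ G ⟩
        0ℚ            ≤⟨ toℚ-mono-≤ {0} {w ℕ.* n} z≤n ⟩
        toℚ (w ℕ.* n) ≡⟨ gx≡wn n ⟨
        G * x n       ∎)

      convert : ∀ a b y z {Y Z} → toℚ y ≡ G * Y → toℚ z ≡ G * Z → a ℕ.* y ℕ.≤ b ℕ.* z → toℚ a * Y ≤ toℚ b * Z
      convert a b y z {Y} {Z} y≡ z≡ le = *-cancelˡ-≤-pos G (begin
        G * (toℚ a * Y)   ≡⟨ swap G (toℚ a) Y ⟩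
        toℚ a * (G * Y)   ≡⟨ cong (toℚ a *_) y≡ ⟨
        toℚ a * toℚ y     ≡⟨ toℚ-* a y ⟨
        toℚ (a ℕ.* y)     ≤⟨ toℚ-mono-≤ le ⟩
        toℚ (b ℕ.* z)     ≡⟨ toℚ-* b z ⟩
        toℚ b * toℚ z     ≡⟨ cong (toℚ b *_) z≡ ⟩
        toℚ b * (G * Z)   ≡⟨ swap (toℚ b) G Z ⟩
        G * (toℚ b * Z)   ∎)

      bounds : suc q ℕ.* (w ℕ.* n) ℕ.≤ suc (suc q) ℕ.* (suc g ℕ.* F n ℕ.^ suc u) ×
               suc q ℕ.* (suc g ℕ.* F n ℕ.^ suc u) ℕ.≤ suc (suc q) ℕ.* (w ℕ.* n) →
               δ ^ℚ suc u * x n ≤ X × X ≤ (1ℚ + ε) ^ℚ suc u * x n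
      bounds (lower , upper) =
        *-cancelˡ-≤-pos Q′ (begin
          Q′ * (δ * δ ^ℚ u * x n)      ≤⟨ *-monoˡ-≤-nonNeg Q′ (*-monoʳ-≤-nonNeg (x n) {{nonNegative 0≤x}}
                                            (*-monoˡ-≤-nonNeg δ {{nonNegative 0≤δ}} (^-≤1 0≤δ δ≤1 u))) ⟩
          Q′ * (δ * 1ℚ * x n)          ≡⟨ cong (λ a → Q′ * (a * x n)) (*-identityʳ δ) ⟩
          Q′ * (δ * x n)               ≡⟨ *-assoc Q′ δ (x n) ⟨
          Q′ * δ * x n                 ≤⟨ *-monoʳ-≤-nonNeg (x n) {{nonNegative 0≤x}} Q′δ≤Q ⟩
          Q * x n                      ≤⟨ convert (suc q) (suc (suc q)) (w ℕ.* n) (suc g ℕ.* F n ℕ.^ suc u)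
                                            (sym (gx≡wn n)) G*X lower ⟩
          Q′ * X                       ∎)
        , *-cancelˡ-≤-pos Q (begin
          Q * X                        ≤⟨ convert (suc q) (suc (suc q)) (suc g ℕ.* F n ℕ.^ suc u) (w ℕ.* n)
                                            G*X (sym (gx≡wn n)) upper ⟩
          Q′ * x n                     ≤⟨ *-monoʳ-≤-nonNeg (x n) {{nonNegative 0≤x}} Q′≤Q[1+ε] ⟩
          Q * (1ℚ + ε) * x n           ≡⟨ *-assoc Q (1ℚ + ε) (x n) ⟩
          Q * ((1ℚ + ε) * x n)         ≡⟨ cong (λ a → Q * (a * x n)) (*-identityʳ (1ℚ + ε)) ⟨
          Q * ((1ℚ + ε) * 1ℚ * x n)    ≤⟨ *-monoˡ-≤-nonNeg Q (*-monoʳ-≤-nonNeg (x n) {{nonNegative 0≤x}}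
                                            (*-monoˡ-≤-nonNeg (1ℚ + ε) {{nonNegative 0≤1+ε}} (1≤-^ 1≤1+ε u))) ⟩
          Q * ((1ℚ + ε) ^ℚ suc u * x n) ∎)

  asymptotic-of-bounds : ∀ (F : ℕ → ℕ) u g w (x : ℕ → ℚ) → 0 ℕ.< w →
    (∀ n → toℚ (suc g) * x n ≡ toℚ (w ℕ.* n)) →
    (∃ λ c → ∀ n → suc g ℕ.* F n ℕ.^ suc u ℕ.≤ w ℕ.* n ℕ.+ c ℕ.* suc (F n) ℕ.^ u) →
    (∃ λ d → ∀ n → w ℕ.* n ℕ.≤ suc g ℕ.* F n ℕ.^ suc u ℕ.+ d ℕ.* suc (F n) ℕ.^ u) →
    AsymptoticToRoot F (suc u) x
  asymptotic-of-bounds F u g w x w>0 gx≡wn (c , upper) (d , lower) = asymptotic-of-close F u g w x gx≡wn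
    (ratio-close F u (suc g) w (c ℕ.+ d) (s≤s z≤n) w>0
      (λ n → ℕ.≤-trans (upper n) (ℕ.+-monoʳ-≤ _ (ℕ.*-monoˡ-≤ (suc (F n) ℕ.^ u) (ℕ.m≤m+n c d))))
      (λ n → ℕ.≤-trans (lower n) (ℕ.+-monoʳ-≤ _ (ℕ.*-monoˡ-≤ (suc (F n) ℕ.^ u) (ℕ.m≤n+m d c)))))

-- Level 0: eventowns and their all-odd analogue

module Eventowns where

  open import Data.Parity.Base using (_+_; _*_)
  open import Data.Nat.Base using (_≤_; _^_)
  open Sums using (+-interchange)
  open DisjointnessMatrix
  open Moments

  private
    variable
      k n : ℕ

  infixl 6 _⊕_

  _⊕_ : Subset n → Subset n → Subset n
  _⊕_ = zipWith _xor_

  dot : Subset n → Subset n → 𝔽₂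
  dot []      []      = 0ℙ
  dot (b ∷ u) (c ∷ v) = (⟦ b ⟧ * ⟦ c ⟧) + dot u v

  dot≡parity : (u v : Subset n) → dot u v ≡ parity ∣ u ∩ v ∣
  dot≡parity []            []            = refl
  dot≡parity (outside ∷ u) (c       ∷ v) = dot≡parity u v
  dot≡parity (inside  ∷ u) (outside ∷ v) = dot≡parity u v
  dot≡parity (inside  ∷ u) (inside  ∷ v) =
    trans (cong (1ℙ +_) (dot≡parity u v)) (sym (parity-suc ∣ u ∩ v ∣))

  dot-comm : (u v : Subset n) → dot u v ≡ dot v u
  dot-comm []      []      = refl
  dot-comm (b ∷ u) (c ∷ v) = cong₂ _+_ (ℙ.*-comm ⟦ b ⟧ ⟦ c ⟧) (dot-comm u v)

  ⟦⟧-xor : ∀ b c → ⟦ b xor c ⟧ ≡ ⟦ b ⟧ + ⟦ c ⟧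
  ⟦⟧-xor true  true  = refl
  ⟦⟧-xor true  false = refl
  ⟦⟧-xor false c     = refl

  dot-⊕ʳ : (u v w : Subset n) → dot u (v ⊕ w) ≡ dot u v + dot u w
  dot-⊕ʳ []      []      []      = refl
  dot-⊕ʳ (a ∷ u) (b ∷ v) (c ∷ w) = trans
    (cong₂ _+_ (trans (cong (⟦ a ⟧ *_) (⟦⟧-xor b c)) (ℙ.*-distribˡ-+ ⟦ a ⟧ ⟦ b ⟧ ⟦ c ⟧)) (dot-⊕ʳ u v w))
    (+-interchange (⟦ a ⟧ * ⟦ b ⟧) (⟦ a ⟧ * ⟦ c ⟧) (dot u v) (dot u w))

  dot-⊕ˡ : (u v w : Subset n) → dot (u ⊕ v) w ≡ dot u w + dot v w
  dot-⊕ˡ u v w = trans (dot-comm (u ⊕ v) w)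
    (trans (dot-⊕ʳ w u v) (cong₂ _+_ (dot-comm w u) (dot-comm w v)))

  -- Squares are trivial in 𝔽₂, so u · u is the parity of |u|. In particular self-orthogonal vectors
  -- are orthogonal to `⊤`, so complementing preserves orthogonality to an eventown.
  dot-⊤ : (u : Subset n) → dot u ⊤ ≡ dot u u
  dot-⊤ []            = refl
  dot-⊤ (outside ∷ u) = dot-⊤ u
  dot-⊤ (inside  ∷ u) = cong (1ℙ +_) (dot-⊤ u)

  dot-⊤-⊤ : ∀ n → dot (⊤ {n}) ⊤ ≡ parity n
  dot-⊤-⊤ zero    = refl
  dot-⊤-⊤ (suc n) = trans (cong (1ℙ +_) (dot-⊤-⊤ n)) (sym (parity-suc n))

  ⊕-injective : (u : Subset n) {v w : Subset n} → u ⊕ v ≡ u ⊕ w → v ≡ w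
  ⊕-injective []      {[]}    {[]}    _  = refl
  ⊕-injective (b ∷ u) {c ∷ v} {d ∷ w} eq = cong₂ _∷_ (xor-injective b c d (Vec.∷-injectiveˡ eq))
                                                      (⊕-injective u (Vec.∷-injectiveʳ eq))
    where
    xor-injective : ∀ b c d → b xor c ≡ b xor d → c ≡ d
    xor-injective false c     d     eq = eq
    xor-injective true  false false eq = refl
    xor-injective true  true  true  eq = refl

  ∈-tails : ∀ b (P : List (Subset (suc n))) {S} → S ∈ tails b P → b ∷ S ∈ P
  ∈-tails inside  ((inside  ∷ _) ∷ P) (here refl) = here refl
  ∈-tails inside  ((inside  ∷ _) ∷ P) (there S∈)  = there (∈-tails inside P S∈)
  ∈-tails inside  ((outside ∷ _) ∷ P) S∈          = there (∈-tails inside P S∈)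
  ∈-tails outside ((inside  ∷ _) ∷ P) S∈          = there (∈-tails outside P S∈)
  ∈-tails outside ((outside ∷ _) ∷ P) (here refl) = here refl
  ∈-tails outside ((outside ∷ _) ∷ P) (there S∈)  = there (∈-tails outside P S∈)

  tails-All-≢ : ∀ b {S} (P : List (Subset (suc n))) → All (b ∷ S ≢_) P → All (S ≢_) (tails b P)
  tails-All-≢ b P ≢P = All.tabulate λ S∈ → All.lookup ≢P (∈-tails b P S∈) ∘ cong (b ∷_)

  tails-Unique : ∀ b {P : List (Subset (suc n))} → Unique P → Unique (tails b P)
  tails-Unique b       {[]}                  _          = []
  tails-Unique inside  {(inside  ∷ _) ∷ P} (S∉P ∷ P!) = tails-All-≢ inside P S∉P ∷ tails-Unique inside P!
  tails-Unique inside  {(outside ∷ _) ∷ P} (_   ∷ P!) = tails-Unique inside P!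
  tails-Unique outside {(inside  ∷ _) ∷ P} (_   ∷ P!) = tails-Unique outside P!
  tails-Unique outside {(outside ∷ _) ∷ P} (S∉P ∷ P!) = tails-All-≢ outside P S∉P ∷ tails-Unique outside P!

  Dots : 𝔽₂ → List (Subset n) → List (Subset n) → Set
  Dots p U V = ∀ {u v} → u ∈ U → v ∈ V → dot u v ≡ p

  private
    Product≤ : ℕ → Set
    Product≤ n = ∀ (U V : List (Subset n)) → Unique U → Unique V → Dots 0ℙ U V → length U ℕ.* length V ≤ 2 ^ n

    -- U₀, U₁ (and V₀, V₁) are the tails of the vectors of U that start with 0 and 1.  An element v
    -- of V₁ separates U₀ from U₁, and translating V₁ by v makes it orthogonal to both of them.
    product-step : Product≤ n → ∀ (U₀ U₁ V₀ V₁ : List (Subset n)) →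
      Unique U₀ → Unique U₁ → Unique V₀ → Unique V₁ →
      Dots 0ℙ U₀ V₀ → Dots 0ℙ U₁ V₀ → Dots 0ℙ U₀ V₁ → Dots 1ℙ U₁ V₁ →
      (length U₀ ℕ.+ length U₁) ℕ.* (length V₀ ℕ.+ length V₁) ≤ 2 ^ suc n
    -- Without a vector in V₁ nothing keeps U₀ and U₁ disjoint, so each is bounded against V₀
    -- separately.
    product-step {n} bound U₀ U₁ V₀ [] U₀! U₁! V₀! _ d₀₀ d₁₀ _ _ = begin
      (length U₀ ℕ.+ length U₁) ℕ.* (length V₀ ℕ.+ 0)
        ≡⟨ cong ((length U₀ ℕ.+ length U₁) ℕ.*_) (ℕ.+-identityʳ (length V₀)) ⟩
      (length U₀ ℕ.+ length U₁) ℕ.* length V₀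
        ≡⟨ ℕ.*-distribʳ-+ (length V₀) (length U₀) (length U₁) ⟩
      length U₀ ℕ.* length V₀ ℕ.+ length U₁ ℕ.* length V₀
        ≤⟨ ℕ.+-mono-≤ (bound U₀ V₀ U₀! V₀! d₀₀) (bound U₁ V₀ U₁! V₀! d₁₀) ⟩
      2 ^ n ℕ.+ 2 ^ n
        ≡⟨ cong (2 ^ n ℕ.+_) (ℕ.+-identityʳ (2 ^ n)) ⟨
      2 ^ suc n ∎
      where open ℕ.≤-Reasoning
    product-step {n} bound U₀ U₁ V₀ V₁@(v ∷ _) U₀! U₁! V₀! V₁! d₀₀ d₁₀ d₀₁ d₁₁ = begin
      (length U₀ ℕ.+ length U₁) ℕ.* (length V₀ ℕ.+ length V₁)
        ≡⟨ cong (ℕ._* (length V₀ ℕ.+ length V₁)) (List.length-++ U₀) ⟨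
      length U ℕ.* (length V₀ ℕ.+ length V₁)
        ≡⟨ ℕ.*-distribˡ-+ (length U) (length V₀) (length V₁) ⟩
      length U ℕ.* length V₀ ℕ.+ length U ℕ.* length V₁
        ≡⟨ cong (λ l → length U ℕ.* length V₀ ℕ.+ length U ℕ.* l) (List.length-map (v ⊕_) V₁) ⟨
      length U ℕ.* length V₀ ℕ.+ length U ℕ.* length (List.map (v ⊕_) V₁)
        ≤⟨ ℕ.+-mono-≤ (bound U V₀ U! V₀! dots) (bound U (List.map (v ⊕_) V₁) U! (Unique.map⁺ (⊕-injective v) V₁!) dots′) ⟩
      2 ^ n ℕ.+ 2 ^ n
        ≡⟨ cong (2 ^ n ℕ.+_) (ℕ.+-identityʳ (2 ^ n)) ⟨
      2 ^ suc n ∎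
      where
      open ℕ.≤-Reasoning
      U = U₀ ++ U₁
      U! : Unique U
      U! = Unique.++⁺ U₀! U₁! λ (u∈₀ , u∈₁) → 0≢1 (trans (sym (d₀₁ u∈₀ (here refl))) (d₁₁ u∈₁ (here refl)))
        where
        0≢1 : 0ℙ ≢ 1ℙ
        0≢1 ()
      dots : Dots 0ℙ U V₀
      dots u∈ w∈ with ∈-++⁻ U₀ u∈
      ... | inj₁ u∈₀ = d₀₀ u∈₀ w∈
      ... | inj₂ u∈₁ = d₁₀ u∈₁ w∈
      dots′ : Dots 0ℙ U (List.map (v ⊕_) V₁)
      dots′ {u} u∈ w∈ with ∈-map⁻ (v ⊕_) w∈ | ∈-++⁻ U₀ u∈
      ... | w , w∈₁ , refl | inj₁ u∈₀ = trans (dot-⊕ʳ u v w) (cong₂ _+_ (d₀₁ u∈₀ (here refl)) (d₀₁ u∈₀ w∈₁))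
      ... | w , w∈₁ , refl | inj₂ u∈₁ = trans (dot-⊕ʳ u v w) (cong₂ _+_ (d₁₁ u∈₁ (here refl)) (d₁₁ u∈₁ w∈₁))

  -- Stands in for dim U + dim V ≤ n, but by induction on the coordinates, so that arbitrary
  -- families need not be replaced by their spans.
  orthogonal-product : ∀ n (U V : List (Subset n)) → Unique U → Unique V → Dots 0ℙ U V →
    length U ℕ.* length V ≤ 2 ^ n
  orthogonal-product zero    U V U! V! dots =
    ℕ.*-mono-≤ (Unique⇒length≤ (Subset↔Fin 0) U!) (Unique⇒length≤ (Subset↔Fin 0) V!)
  orthogonal-product (suc n) U V U! V! dots = subst₂ (λ x y → x ℕ.* y ≤ 2 ^ suc n) (length-tails U) (length-tails V)
    (product-step (orthogonal-product n) (tails outside U) (tails inside U) (tails outside V) (tails inside V)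
      (tails-Unique outside U!) (tails-Unique inside U!) (tails-Unique outside V!) (tails-Unique inside V!)
      (λ u∈ v∈ → dots (∈-tails outside U u∈) (∈-tails outside V v∈))
      (λ u∈ v∈ → dots (∈-tails inside U u∈) (∈-tails outside V v∈))
      (λ u∈ v∈ → dots (∈-tails outside U u∈) (∈-tails inside V v∈))
      -- Two vectors that start with 1 have head product 1, so orthogonality forces their tails to
      -- have product 1.
      (λ u∈ v∈ → ℙ.+-cancelˡ-≡ 1ℙ _ 1ℙ (dots (∈-tails inside U u∈) (∈-tails inside V v∈))))

  *-square-cancel-≤ : ∀ {a b} → a ℕ.* a ≤ b ℕ.* b → a ≤ b
  *-square-cancel-≤ le = ℕ.≮⇒≥ λ b<a → ℕ.<⇒≱ (ℕ.*-mono-< b<a b<a) le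

  eventown-even : ∀ h (V : List (Subset (h ℕ.+ h))) → Unique V → Dots 0ℙ V V → length V ≤ 2 ^ h
  eventown-even h V V! dots = *-square-cancel-≤ (subst (length V ℕ.* length V ≤_) (ℕ.^-distribˡ-+-* 2 h h)
    (orthogonal-product (h ℕ.+ h) V V V! V! dots))

  -- For odd n the complements of the members form a second family orthogonal to V.
  eventown-odd : ∀ h (V : List (Subset (suc (h ℕ.+ h)))) → Unique V → Dots 0ℙ V V → length V ≤ 2 ^ h
  eventown-odd h V V! dots = *-square-cancel-≤ (ℕ.*-cancelˡ-≤ 2 double-square)
    where
    U = V ++ List.map (⊤ ⊕_) V
    length-U : length U ≡ 2 ℕ.* length V
    length-U = trans (List.length-++ V) (cong (length V ℕ.+_)
      (trans (List.length-map (⊤ ⊕_) V) (sym (ℕ.+-identityʳ _))))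
    dot-⊤⊕ : ∀ {u v} → u ∈ V → v ∈ V → dot (⊤ ⊕ u) v ≡ 0ℙ
    dot-⊤⊕ {u} {v} u∈ v∈ = trans (dot-⊕ˡ ⊤ u v) (cong₂ _+_
      (trans (dot-comm ⊤ v) (trans (dot-⊤ v) (dots v∈ v∈))) (dots u∈ v∈))
    dots′ : Dots 0ℙ U V
    dots′ u∈ v∈ with ∈-++⁻ V u∈
    ... | inj₁ u∈V = dots u∈V v∈
    ... | inj₂ u∈′ with ∈-map⁻ (⊤ ⊕_) u∈′
    ...   | w , w∈ , refl = dot-⊤⊕ w∈ v∈
    odd : parity (suc (h ℕ.+ h)) ≡ 1ℙ
    odd = trans (parity-suc (h ℕ.+ h)) (cong (1ℙ +_) (trans (ℙ.+-homo-+ h h) (ℙ.p+p≡0ℙ (parity h))))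
    -- As n is odd, the complement of an even set is odd, hence not in V.
    disjoint : ∀ {u} → u ∈ V → ¬ u ∈ List.map (⊤ ⊕_) V
    disjoint u∈ u∈′ with ∈-map⁻ (⊤ ⊕_) u∈′
    ... | w , w∈ , refl = 1≢0 (begin
      1ℙ                   ≡⟨ odd ⟨
      parity N             ≡⟨ dot-⊤-⊤ N ⟨
      dot 𝟙 𝟙              ≡⟨ ℙ.+-identityʳ (dot 𝟙 𝟙) ⟨
      dot 𝟙 𝟙 + 0ℙ         ≡⟨ cong (dot 𝟙 𝟙 +_) (trans (dot-⊤ w) (dots w∈ w∈)) ⟨
      dot 𝟙 𝟙 + dot w 𝟙    ≡⟨ dot-⊕ˡ 𝟙 w 𝟙 ⟨
      dot (𝟙 ⊕ w) 𝟙        ≡⟨ dot-⊤ (𝟙 ⊕ w) ⟩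
      dot (𝟙 ⊕ w) (𝟙 ⊕ w)  ≡⟨ dots u∈ u∈ ⟩
      0ℙ                   ∎)
      where
      open ≡-Reasoning
      N = suc (h ℕ.+ h)
      𝟙 = ⊤ {N}
      1≢0 : 1ℙ ≢ 0ℙ
      1≢0 ()
    U! : Unique U
    U! = Unique.++⁺ V! (Unique.map⁺ (⊕-injective ⊤) V!) λ (u∈ , u∈′) → disjoint u∈ u∈′
    double-square : 2 ℕ.* (length V ℕ.* length V) ≤ 2 ℕ.* (2 ^ h ℕ.* 2 ^ h)
    double-square = begin
      2 ℕ.* (length V ℕ.* length V)    ≡⟨ ℕ.*-assoc 2 (length V) (length V) ⟨
      2 ℕ.* length V ℕ.* length V      ≡⟨ cong (ℕ._* length V) length-U ⟨
      length U ℕ.* length V            ≤⟨ orthogonal-product _ U V U! V! dots′ ⟩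
      2 ℕ.* 2 ^ (h ℕ.+ h)              ≡⟨ cong (2 ℕ.*_) (ℕ.^-distribˡ-+-* 2 h h) ⟩
      2 ℕ.* (2 ^ h ℕ.* 2 ^ h)          ∎
      where open ℕ.≤-Reasoning

  -- Translating by a fixed member F turns the family into an eventown W; if n is even, then the
  -- complements of the members of W extend it to an eventown of twice the size.
  module _ {n} (F : Subset n) (𝓕 : List (Subset n)) (F∈ : F ∈ 𝓕) (𝓕! : Unique 𝓕) (dots : Dots 1ℙ 𝓕 𝓕) where
    private
      W : List (Subset n)
      W = List.map (F ⊕_) 𝓕

      length-W : length W ≡ length 𝓕
      length-W = List.length-map (F ⊕_) 𝓕

      W! : Unique W
      W! = Unique.map⁺ (⊕-injective F) 𝓕!

      dot-F⊕ : ∀ {G H} → G ∈ 𝓕 → H ∈ 𝓕 → dot G (F ⊕ H) ≡ 0ℙ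
      dot-F⊕ {G} {H} G∈ H∈ = trans (dot-⊕ʳ G F H) (cong₂ _+_ (dots G∈ F∈) (dots G∈ H∈))

      dots-W : Dots 0ℙ W W
      dots-W u∈ v∈ with ∈-map⁻ (F ⊕_) u∈ | ∈-map⁻ (F ⊕_) v∈
      ... | G , G∈ , refl | H , H∈ , refl =
        trans (dot-⊕ˡ F G (F ⊕ H)) (cong₂ _+_ (dot-F⊕ F∈ H∈) (dot-F⊕ G∈ H∈))

      W² : List (Subset n)
      W² = W ++ List.map (⊤ ⊕_) W

      -- Every vector of W is orthogonal to F, but `dot F ⊤` is 1 since |F| is odd; so a complement
      -- of a vector of W is not orthogonal to F.
      disjoint : ∀ {u} → u ∈ W → ¬ u ∈ List.map (⊤ ⊕_) W
      disjoint u∈ u∈′ with ∈-map⁻ (F ⊕_) u∈ | ∈-map⁻ (⊤ ⊕_) u∈′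
      ... | G , G∈ , eq | _ , w∈ , refl with ∈-map⁻ (F ⊕_) w∈
      ...   | H , H∈ , refl = 0≢1 (begin
        0ℙ                               ≡⟨ dot-F⊕ F∈ G∈ ⟨
        dot F (F ⊕ G)                    ≡⟨ cong (dot F) eq ⟨
        dot F (⊤ ⊕ (F ⊕ H))              ≡⟨ dot-⊕ʳ F ⊤ (F ⊕ H) ⟩
        dot F ⊤ + dot F (F ⊕ H)          ≡⟨ cong₂ _+_ (trans (dot-⊤ F) (dots F∈ F∈)) (dot-F⊕ F∈ H∈) ⟩
        1ℙ                               ∎)
        where
        open ≡-Reasoning
        0≢1 : 0ℙ ≢ 1ℙ
        0≢1 ()

      W²! : Unique W²
      W²! = Unique.++⁺ W! (Unique.map⁺ (⊕-injective ⊤) W!) λ (u∈ , u∈′) → disjoint u∈ u∈′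

      dot-⊤-W : ∀ {v} → v ∈ W → dot ⊤ v ≡ 0ℙ
      dot-⊤-W {v} v∈ = trans (dot-comm ⊤ v) (trans (dot-⊤ v) (dots-W v∈ v∈))

      dot-⊤⊕-W : ∀ {u v} → u ∈ W → v ∈ W → dot (⊤ ⊕ u) v ≡ 0ℙ
      dot-⊤⊕-W {u} {v} u∈ v∈ = trans (dot-⊕ˡ ⊤ u v) (cong₂ _+_ (dot-⊤-W v∈) (dots-W u∈ v∈))

      dots-W² : parity n ≡ 0ℙ → Dots 0ℙ W² W²
      dots-W² n-even {u} {v} u∈ v∈ with ∈-++⁻ W u∈ | ∈-++⁻ W v∈
      ... | inj₁ u∈W | inj₁ v∈W = dots-W u∈W v∈W
      ... | inj₁ u∈W | inj₂ v∈′ with ∈-map⁻ (⊤ ⊕_) v∈′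
      ...   | y , y∈ , refl = trans (dot-comm u (⊤ ⊕ y)) (dot-⊤⊕-W y∈ u∈W)
      dots-W² n-even {u} {v} u∈ v∈ | inj₂ u∈′ | inj₁ v∈W with ∈-map⁻ (⊤ ⊕_) u∈′
      ...   | x , x∈ , refl = dot-⊤⊕-W x∈ v∈W
      dots-W² n-even {u} {v} u∈ v∈ | inj₂ u∈′ | inj₂ v∈′ with ∈-map⁻ (⊤ ⊕_) u∈′ | ∈-map⁻ (⊤ ⊕_) v∈′
      ...   | x , x∈ , refl | y , y∈ , refl = trans (dot-⊕ʳ (⊤ ⊕ x) ⊤ y) (cong₂ _+_
        (trans (dot-⊕ˡ ⊤ x ⊤) (cong₂ _+_ (trans (dot-⊤-⊤ n) n-even) (trans (dot-comm x ⊤) (dot-⊤-W x∈))))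
        (dot-⊤⊕-W x∈ y∈))

    all-odd-odd : ∀ h → n ≡ suc (h ℕ.+ h) → length 𝓕 ≤ 2 ^ h
    all-odd-odd h refl = subst (_≤ 2 ^ h) length-W (eventown-odd h W W! dots-W)

    all-odd-even : ∀ h → n ≡ suc h ℕ.+ suc h → length 𝓕 ≤ 2 ^ h
    all-odd-even h refl = ℕ.*-cancelˡ-≤ 2 (subst (_≤ 2 ^ suc h) length-W²
      (eventown-even (suc h) W² W²! (dots-W² (trans (ℙ.+-homo-+ (suc h) (suc h)) (ℙ.p+p≡0ℙ (parity (suc h)))))))
      where
      length-W² : length W² ≡ 2 ℕ.* length 𝓕
      length-W² = trans (List.length-++ W) (cong₂ ℕ._+_ length-W
        (trans (List.length-map (⊤ ⊕_) W) (trans length-W (sym (ℕ.+-identityʳ _)))))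

  -- The condition on single sets gives the diagonal, since F ∩ F = F; the condition on two distinct
  -- sets gives the rest.
  constant-town-dots : ∀ {p} → 2 ≤ k → {𝓕 : List (Subset n)} → IsTown (replicate k p) 𝓕 → Dots p 𝓕 𝓕
  constant-town-dots (s≤s (s≤s _)) town {F} {G} F∈ G∈ = trans (dot≡parity F G) (parity-∩ (F ≟ˢ G))
    where
    parity-∩ : _ → parity ∣ F ∩ G ∣ ≡ _
    parity-∩ (yes refl) = trans (cong (parity ∘ ∣_∣) (trans (∩-idem F) (sym (∩-identityʳ F))))
      (town zero (F ∷ []) refl ([] ∷ []) (F∈ ∷ []))
    parity-∩ (no F≢G) = trans (cong (λ S → parity ∣ F ∩ S ∣) (sym (∩-identityʳ G)))
      (town (suc zero) (F ∷ G ∷ []) refl ((F≢G ∷ []) ∷ [] ∷ []) (F∈ ∷ G∈ ∷ []))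

  halves : ∀ n → n ≡ ⌊ n /2⌋ ℕ.+ ⌊ n /2⌋ ⊎ n ≡ suc (⌊ n /2⌋ ℕ.+ ⌊ n /2⌋)
  halves zero          = inj₁ refl
  halves (suc zero)    = inj₂ refl
  halves (suc (suc n)) with halves n
  ... | inj₁ eq = inj₁ (cong suc (trans (cong suc eq) (sym (ℕ.+-suc ⌊ n /2⌋ ⌊ n /2⌋))))
  ... | inj₂ eq = inj₂ (cong suc (cong suc (trans eq (sym (ℕ.+-suc ⌊ n /2⌋ ⌊ n /2⌋)))))

  private
    eventown-bound : ∀ n h → n ≡ h ℕ.+ h ⊎ n ≡ suc (h ℕ.+ h) →
      (V : List (Subset n)) → Unique V → Dots 0ℙ V V → length V ≤ 2 ^ h
    eventown-bound n h (inj₁ refl) = eventown-even h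
    eventown-bound n h (inj₂ refl) = eventown-odd h

  f-zeros-≤ : 2 ≤ k → ∀ n → f (replicate k 0ℙ) n ≤ 2 ^ ⌊ n /2⌋
  f-zeros-≤ {k} 2≤k n =
    let (𝓕 , 𝓕! , town , len) , _ = proj₂ (maximumTownSize (replicate k 0ℙ) n)
    in subst (_≤ 2 ^ ⌊ n /2⌋) len
         (eventown-bound n ⌊ n /2⌋ (halves n) 𝓕 𝓕! (constant-town-dots 2≤k town))

  f-ones-≤ : 2 ≤ k → ∀ n → f (replicate k 1ℙ) (suc n) ≤ 2 ^ ⌊ n /2⌋
  f-ones-≤ {k} 2≤k n =
    let (𝓕 , 𝓕! , town , len) , _ = proj₂ (maximumTownSize (replicate k 1ℙ) (suc n))
    in subst (_≤ 2 ^ ⌊ n /2⌋) len (bound 𝓕 𝓕! (constant-town-dots 2≤k town))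
    where
    bound : (𝓕 : List (Subset (suc n))) → Unique 𝓕 → Dots 1ℙ 𝓕 𝓕 → length 𝓕 ≤ 2 ^ ⌊ n /2⌋
    bound []          _  _    = z≤n
    bound 𝓕@(F ∷ _) 𝓕! dots with halves n
    ... | inj₁ eq = all-odd-odd F 𝓕 (here refl) 𝓕! dots ⌊ n /2⌋ (cong suc eq)
    ... | inj₂ eq = all-odd-even F 𝓕 (here refl) 𝓕! dots ⌊ n /2⌋
                      (cong suc (trans eq (sym (ℕ.+-suc ⌊ n /2⌋ ⌊ n /2⌋))))

  paired : ∀ n → Subset ⌊ n /2⌋ → Subset n
  paired zero          []      = []
  paired (suc zero)    []      = outside ∷ []
  paired (suc (suc n)) (b ∷ S) = b ∷ b ∷ paired n S

  paired-injective : ∀ n {S S′} → paired n S ≡ paired n S′ → S ≡ S′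
  paired-injective zero          {[]}    {[]}     _  = refl
  paired-injective (suc zero)    {[]}    {[]}     _  = refl
  paired-injective (suc (suc n)) {_ ∷ _} {_ ∷ _} eq = cong₂ _∷_ (Vec.∷-injectiveˡ eq)
    (paired-injective n (Vec.∷-injectiveʳ (Vec.∷-injectiveʳ eq)))

  paired-∩ : ∀ n S S′ → paired n S ∩ paired n S′ ≡ paired n (S ∩ S′)
  paired-∩ zero          []      []       = refl
  paired-∩ (suc zero)    []      []       = refl
  paired-∩ (suc (suc n)) (b ∷ S) (c ∷ S′) = cong (λ R → b ∧ c ∷ b ∧ c ∷ R) (paired-∩ n S S′)

  parity-paired : ∀ n S → parity ∣ paired n S ∣ ≡ 0ℙ
  parity-paired zero          []            = refl
  parity-paired (suc zero)    []            = refl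
  parity-paired (suc (suc n)) (outside ∷ S) = parity-paired n S
  parity-paired (suc (suc n)) (inside  ∷ S) = parity-paired n S

  -- `⋂` ends in `⊤`, which need not satisfy Q; hence the nonempty list and the separate case of a
  -- singleton.
  ⋂-closed : ∀ {Q : Subset n → Set} → (∀ {F G} → Q F → Q G → Q (F ∩ G)) →
             ∀ {F Fs} → All Q (F ∷ Fs) → Q (⋂ (F ∷ Fs))
  ⋂-closed {Q = Q} closed {F} (q ∷ [])       = subst Q (sym (∩-identityʳ F)) q
  ⋂-closed         closed     (q ∷ qs@(_ ∷ _)) = closed q (⋂-closed closed qs)

  closed-town : ∀ {p} (Q : Subset n → Set) → (∀ {F G} → Q F → Q G → Q (F ∩ G)) →
    (∀ {F} → Q F → parity ∣ F ∣ ≡ p) → ∀ {𝓕} → (∀ {F} → F ∈ 𝓕 → Q F) → IsTown (replicate k p) 𝓕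
  closed-town {p = p} Q closed Q⇒p 𝓕⊆Q i (F ∷ Fs) _ _ Fs∈ =
    trans (Q⇒p (⋂-closed closed (All.map 𝓕⊆Q Fs∈))) (sym (Vec.lookup-replicate i p))

  image-size≤f : ∀ {p h} (g : Subset h → Subset n) → (∀ {S S′} → g S ≡ g S′ → S ≡ S′) →
    (∀ S S′ → g S ∩ g S′ ≡ g (S ∩ S′)) → (∀ S → parity ∣ g S ∣ ≡ p) → 2 ^ h ≤ f (replicate k p) n
  image-size≤f {n} {k} {p} {h} g injective g-∩ g-parity = subst (_≤ f (replicate k p) n)
    (List.length-tabulate (g ∘ from))
    (proj₂ (proj₂ (maximumTownSize (replicate k p) n)) (List.tabulate (g ∘ from))
      (Unique.tabulate⁺ (↔-injective (↔-sym (Subset↔Fin h)) ∘ injective))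
      (closed-town (λ F → ∃ λ S → F ≡ g S)
        (λ { (S , refl) (S′ , refl) → S ∩ S′ , g-∩ S S′ })
        (λ { (S , refl) → g-parity S })
        (λ F∈ → let i , F≡ = ∈-tabulate⁻ F∈ in from i , F≡)))
    where open Inverse (Subset↔Fin h)

  f-zeros : 2 ≤ k → ∀ n → f (replicate k 0ℙ) n ≡ 2 ^ ⌊ n /2⌋
  f-zeros 2≤k n = ℕ.≤-antisym (f-zeros-≤ 2≤k n)
    (image-size≤f (paired n) (paired-injective n) (paired-∩ n) (parity-paired n))

  f-ones : 2 ≤ k → ∀ n → f (replicate k 1ℙ) (suc n) ≡ 2 ^ ⌊ n /2⌋
  f-ones 2≤k n = ℕ.≤-antisym (f-ones-≤ 2≤k n) (image-size≤f (λ S → inside ∷ paired n S)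
    (paired-injective n ∘ Vec.∷-injectiveʳ)
    (λ S S′ → cong (inside ∷_) (paired-∩ n S S′))
    (λ S → trans (parity-suc ∣ paired n S ∣) (cong (1ℙ +_) (parity-paired n S))))

open import Data.Integer.Base using (+_)
open import Data.Nat.Base using (ℕ; _∸_; _^_; _≤_; _<_; _!; ⌊_/2⌋)
open import Data.Parity.Base using (0ℙ; 1ℙ)
open import Data.Product.Base using (_×_)
import Data.Rational.Properties as ℚ
open import Data.Rational.Base using (_/_; _*_)
open import Data.Vec.Base using (Vec; replicate)
open import Relation.Binary.PropositionalEquality using (_≡_)
open UpperBound
open LowerBound
open Asymptotics
open Eventowns

theorem3 : (k : ℕ) → 1 ≤ k → (α : Vec 𝔽₂ k) →
    (2 ≤ k → lv α ≡ 0 → α ≡ replicate k 0ℙ → ∀ n → 1 ≤ n → f α n ≡ 2 ^ ⌊ n /2⌋)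
    × (2 ≤ k → lv α ≡ 0 → α ≡ replicate k 1ℙ → ∀ n → 1 ≤ n → f α n ≡ 2 ^ ⌊ n ∸ 1 /2⌋)
    × (∀ t → 0 < t → lv α ≡ t → grd α ≡ 1 →
    AsymptoticToRoot (f α) t (λ n → toℚ (t !) * toℚ n))
    × (∀ t → 0 < t → lv α ≡ t → grd α ≡ 2 →
    AsymptoticToRoot (f α) t (λ n → (+ (t !) / 2) * toℚ n))
theorem3 k _ α =
    (λ 2≤k _ α≡0 n _ → trans (cong (λ β → f β n) α≡0) (f-zeros 2≤k n))
  , (λ where 2≤k _ α≡1 (suc n) _ → trans (cong (λ β → f β (suc n)) α≡1) (f-ones 2≤k n))
  -- The numeral after u is the grade minus one, as `asymptotic-of-bounds` scales by `suc g`.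
  , (λ where (suc u) _ level grade → asymptotic-of-bounds (f α) u 0 (suc u !) _ (ℕ.1≤n! (suc u))
               (λ n → trans (ℚ.*-identityˡ _) (sym (toℚ-* (suc u !) n)))
               (power-bound-1 α u level grade) (lower-power-bound-1 α u level grade))
  , (λ where (suc u) _ level grade → asymptotic-of-bounds (f α) u 1 (suc u !) _ (ℕ.1≤n! (suc u))
               (λ n → trans (sym (ℚ.*-assoc (toℚ 2) (+ (suc u !) / 2) (toℚ n)))
                        (trans (cong (_* toℚ n) (toℚ-*-/ 1 (suc u !))) (sym (toℚ-* (suc u !) n))))
               (power-bound-2 α u level grade) (lower-power-bound-2 α u level grade))
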